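{- Let $n=p_1p_2\cdots p_\ell$ be the product of $\ell$ distinct odd primes $p_1<p_2<\dots<p_\ell$. Then $$\Psi^w_{\mathbb{Z}_n}(x)=\frac{1}{\phi(n)}\sum_{(d_1,\dots,d_\ell)}\left(\prod_{i=1}^{\ell}\phi\!\left(\frac{p_i-1}{d_i}\right)\right)\left(\sum_{R\subseteq\{1,\dots,\ell\}}(-1)^{|R|}F_R(d_1,\dots,d_\ell)\right),$$ where $d_i$ runs over all positive divisors of $p_i-1$ for each $i$.
   Context: $\phi$ is Euler's totient function. Fix divisors $d_i\mid p_i-1$. For a nonempty set $T\subseteq\{1,\dots,\ell\}$ define the integer $\alpha_T$ as follows: if $T=\{i\}$, $\alpha_T=\frac{p_i-1}{\gcd(d_i,\frac{p_i-1}{2})}$; if $|T|\ge2$, let $L_T=\mathrm{lcm}\{\frac{p_i-1}{d_i}: i\in T\}$ and set $\alpha_T=L_T$ if $d_i\mid\frac{p_i-1}{2}$ for all $i\in T$ and there is an integer $c$ with $cd_i\equiv\frac{p_i-1}{2}\pmod{p_i-1}$ for all $i\in T$, and $\alpha_T=2L_T$ otherwise. Put $f_T=\left(1+x^{\alpha_T}\right)^{\prod_{i\in T}(p_i-1)/\alpha_T}$, and for $R\subseteq\{1,\dots,\ell\}$ put $F_R(d_1,\dots,d_\ell)=\prod_{\emptyset\neq T\subseteq\{1,\dots,\ell\}\setminus R}f_T$ (so $F_{\{1,\dots,\ell\}}=1$). For the cyclic group $\mathbb{Z}_n$ and a generating set $\Omega$ with $\Omega=-\Omega$, $0\notin\Omega$,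 the Cayley graph $C(\mathbb{Z}_n,\Omega)$ has vertex set $\mathbb{Z}_n$ and edges $\{g,h\}$ with $h-g\in\Omega$, with $\mathbb{Z}_n$ acting by translation. A graph isomorphism $f$ between two such Cayley graphs is a weak equivalence if there is a group automorphism $\alpha$ of $\mathbb{Z}_n$ with $f(g+u)=\alpha(g)+f(u)$ for all $g,u$. $a^w_k(\mathbb{Z}_n)$ is the number of weak equivalence classes of Cayley graphs $C(\mathbb{Z}_n,\Omega)$ with $|\Omega|=k$ and $\Psi^w_{\mathbb{Z}_n}(x)=\sum_{k=1}^{n-1}a^w_k(\mathbb{Z}_n)x^k$. -}

module Defs where

open import Data.Bool using (Bool; true; false; if_then_else_; _∧_; _∨_; not)
open import Data.Nat as ℕ using (ℕ; zero; suc; _∸_; _≤_; _<_; NonZero)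
open import Data.Nat.DivMod using (_/_; _mod_)
open import Data.Nat.GCD using (gcd)
open import Data.Nat.LCM using (lcm)
open import Data.Nat.Divisibility as ℕD using (_∣?_)
open import Data.Nat.Coprimality using (coprime?)
open import Data.Integer as ℤ using (ℤ; +_; -_)
open import Data.Integer.Divisibility as ℤD using ()
open import Data.Fin as Fin using (Fin; toℕ)
open import Data.Fin.Subset using (Subset; _∈_; _∉_; ∣_∣; ⁅_⁆)
open import Data.List as List using (List; []; _∷_; map; concatMap; filter; length; upTo; foldr)
open import Data.List.Relation.Unary.All using (All)
open import Data.Vec as Vec using (Vec; []; _∷_)
open import Data.Vec.Functional as VF using (Vector)
open import Data.Product using (Σ; ∃; _×_; _,_)
open import Data.Sum using (_⊎_)
open import Function.Definitions using (Bijective)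
open import Relation.Binary.PropositionalEquality using (_≡_)
open import Relation.Nullary using (¬_; does)

-- Total division: m ÷ 0 = 0 (only ever used with nonzero divisors).
_÷_ : ℕ → ℕ → ℕ
m ÷ zero  = zero
m ÷ suc k = m / suc k

φ : ℕ → ℕ
φ n = length (filter (λ k → coprime? k n) (map suc (upTo n)))

divisors : ℕ → List ℕ
divisors m = filter (λ k → k ∣? m) (map suc (upTo m))

prodFin : ∀ {ℓ} → (Fin ℓ → ℕ) → ℕ
prodFin {zero}  f = 1
prodFin {suc ℓ} f = f Fin.zero ℕ.* prodFin (λ i → f (Fin.suc i))

module _ {m : ℕ} where
  N : ℕ
  N = suc m

  _+Z_ : Fin N → Fin N → Fin N
  a +Z b = (toℕ a ℕ.+ toℕ b) mod N

  0Z : Fin N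
  0Z = Fin.zero

  -Z_ : Fin N → Fin N
  -Z a = (N ∸ toℕ a) mod N

  _-Z_ : Fin N → Fin N → Fin N
  a -Z b = a +Z (-Z b)

  sumZ : List (Fin N) → Fin N
  sumZ = foldr _+Z_ 0Z

  Generates : Subset N → Set
  Generates Ω = ∀ g → ∃ λ (xs : List (Fin N)) →
    All (λ x → x ∈ Ω ⊎ (-Z x) ∈ Ω) xs × sumZ xs ≡ g

  IsConnectionSet : Subset N → Set
  IsConnectionSet Ω = (∀ x → x ∈ Ω → (-Z x) ∈ Ω) × 0Z ∉ Ω × Generates Ω

  -- graph isomorphism C(Z_N,Ω) → C(Z_N,Ω'):  {g,h} edge iff h - g ∈ Ω
  IsGraphIso : Subset N → Subset N → (Fin N → Fin N) → Set
  IsGraphIso Ω Ω' f = Bijective _≡_ _≡_ f ×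
    (∀ g h → (h -Z g) ∈ Ω → (f h -Z f g) ∈ Ω') ×
    (∀ g h → (f h -Z f g) ∈ Ω' → (h -Z g) ∈ Ω)

  IsAutomorphism : (Fin N → Fin N) → Set
  IsAutomorphism α = Bijective _≡_ _≡_ α × (∀ g h → α (g +Z h) ≡ α g +Z α h)

  WeakEquiv : Subset N → Subset N → Set
  WeakEquiv Ω Ω' = Σ (Fin N → Fin N) λ f → Σ (Fin N → Fin N) λ α →
    IsGraphIso Ω Ω' f × IsAutomorphism α × (∀ g u → f (g +Z u) ≡ α g +Z f u)

  -- "c is the number of weak equivalence classes of Cayley graphs
  --  C(Z_N, Ω) with |Ω| = k": a system of c pairwise inequivalent
  --  representatives that meets every class.
  NumWeakClasses : (k c : ℕ) → Set
  NumWeakClasses k c = Σ (Fin c → Subset N) λ rep →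
    (∀ j → IsConnectionSet (rep j) × ∣ rep j ∣ ≡ k) ×
    (∀ j j' → WeakEquiv (rep j) (rep j') → j ≡ j') ×
    (∀ Ω → IsConnectionSet Ω → ∣ Ω ∣ ≡ k → ∃ λ j → WeakEquiv Ω (rep j))

-- Integer polynomials as coefficient lists (lowest degree first)

Poly : Set
Poly = List ℤ

_+P_ : Poly → Poly → Poly
[]       +P q        = q
(a ∷ p)  +P []       = a ∷ p
(a ∷ p)  +P (b ∷ q)  = (a ℤ.+ b) ∷ (p +P q)

scaleP : ℤ → Poly → Poly
scaleP c = map (c ℤ.*_)

_*P_ : Poly → Poly → Poly
[]      *P q = []
(a ∷ p) *P q = scaleP a q +P (ℤ.+ 0 ∷ (p *P q))

oneP : Poly
oneP = ℤ.+ 1 ∷ []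

_^P_ : Poly → ℕ → Poly
p ^P zero  = oneP
p ^P suc e = p *P (p ^P e)

monoP : ℕ → Poly
monoP zero    = oneP
monoP (suc a) = ℤ.+ 0 ∷ monoP a

coeff : ℕ → Poly → ℤ
coeff k       []      = ℤ.+ 0
coeff zero    (a ∷ p) = a
coeff (suc k) (a ∷ p) = coeff k p

sumP : List Poly → Poly
sumP = foldr _+P_ []

prodP : List Poly → Poly
prodP = foldr _*P_ oneP

allSubsets : ∀ ℓ → List (Subset ℓ)
allSubsets zero    = [] ∷ []
allSubsets (suc ℓ) = concatMap (λ s → (true ∷ s) ∷ (false ∷ s) ∷ []) (allSubsets ℓ)

disjointB : ∀ {ℓ} → Subset ℓ → Subset ℓ → Bool
disjointB []      []      = true
disjointB (a ∷ s) (b ∷ t) = not (a ∧ b) ∧ disjointB s t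

nonemptyB : ∀ {ℓ} → Subset ℓ → Bool
nonemptyB []      = false
nonemptyB (a ∷ s) = a ∨ nonemptyB s

tuples : ∀ ℓ → (Fin ℓ → List ℕ) → List (Vector ℕ ℓ)
tuples zero    L = (λ ()) ∷ []
tuples (suc ℓ) L = concatMap (λ x → map (x VF.∷_) (tuples ℓ (λ i → L (Fin.suc i)))) (L Fin.zero)

prodOver : ∀ {ℓ} → Subset ℓ → (Fin ℓ → ℕ) → ℕ
prodOver T f = prodFin (λ i → if Vec.lookup T i then f i else 1)

lcmOver : ∀ {ℓ} → Subset ℓ → (Fin ℓ → ℕ) → ℕ
lcmOver {zero}  []      f = 1
lcmOver {suc ℓ} (b ∷ T) f =
  (if b then lcm (f Fin.zero) else (λ x → x)) (lcmOver T (λ i → f (Fin.suc i)))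

module _ {ℓ : ℕ} (p : Fin ℓ → ℕ) (d : Vector ℕ ℓ) where

  half : Fin ℓ → ℕ
  half i = (p i ∸ 1) / 2

  L : Subset ℓ → ℕ
  L T = lcmOver T (λ i → (p i ∸ 1) ÷ d i)

  AlphaCond : Subset ℓ → Set
  AlphaCond T = (∀ i → i ∈ T → d i ℕD.∣ half i) ×
    ∃ λ (c : ℤ) → ∀ i → i ∈ T →
      (+ (p i ∸ 1)) ℤD.∣ (c ℤ.* + d i ℤ.- + half i)

  IsAlpha : Subset ℓ → ℕ → Set
  IsAlpha T a =
    (∃ λ i → T ≡ ⁅ i ⁆ × a ≡ (p i ∸ 1) ÷ gcd (d i) (half i))
    ⊎ (2 ≤ ∣ T ∣ × ((AlphaCond T × a ≡ L T) ⊎ (¬ AlphaCond T × a ≡ 2 ℕ.* L T)))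

-- The right-hand side, multiplied by φ(n), as an integer polynomial.
-- alpha d T is a function giving α_T for the tuple d.

module _ {ℓ : ℕ} (p : Fin ℓ → ℕ) (alpha : Vector ℕ ℓ → Subset ℓ → ℕ) where

  fT : Vector ℕ ℓ → Subset ℓ → Poly
  fT d T = (oneP +P monoP (alpha d T)) ^P (prodOver T (λ i → p i ∸ 1) ÷ alpha d T)

  FR : Vector ℕ ℓ → Subset ℓ → Poly
  FR d R = prodP (map (fT d)
    (filter (λ T → Data.Bool._≟_ (nonemptyB T ∧ disjointB T R) true) (allSubsets ℓ)))

  signP : ℕ → ℤ
  signP zero    = + 1
  signP (suc k) = - signP k

  inner : Vector ℕ ℓ → Poly
  inner d = sumP (map (λ R → scaleP (signP ∣ R ∣) (FR d R)) (allSubsets ℓ))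

  weight : Vector ℕ ℓ → ℕ
  weight d = prodFin (λ i → φ ((p i ∸ 1) ÷ d i))

  RHS : Poly
  RHS = sumP (map (λ d → scaleP (+ weight d) (inner d))
                  (tuples ℓ (λ i → divisors (p i ∸ 1))))

{-# OPTIONS --safe #-}
-- A weak equivalence between C(ℤ_n, Ω) and C(ℤ_n, Ω′) exists iff Ω′ = a Ω for a unit a mod n, so by Burnside φ(n) times
-- the number of classes is the sum, over the units a, of the number of connection sets Ω with |Ω| = k and a Ω = Ω.
-- For a symmetric Ω the last condition says that Ω is a union of orbits of the group ⟨a, −1⟩.  All x that are nonzero
-- exactly at the primes of T have orbits of the same size, lcm of the orders of a mod p_i (i ∈ T), doubled unless −1 is
-- a power of a on T; this is α_T when a has order (p_i − 1)/d_i mod p_i, and f_T is the generating function of the unions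
-- of such orbits.  Ω generates ℤ_n iff no p_i divides all its elements, which inclusion–exclusion over R expresses.  By the
-- Chinese remainder theorem and the count φ((p_i − 1)/d_i) of elements of order (p_i − 1)/d_i, the tuple (d_i) occurs for
-- ∏ φ((p_i − 1)/d_i) units a.

module Submission where

open import Defs
open import Data.Nat using (ℕ; suc; _≤_; _<_; _∸_; _*_)
open import Data.Nat.Divisibility using (_∣_)
open import Data.Nat.Primality using (Prime)
open import Data.Fin as Fin using (Fin)
open import Data.Fin.Subset using (Subset; ∣_∣)
open import Data.Vec.Functional using (Vector)
open import Data.Integer using (ℤ; +_)
open import Data.Product using (∃; _×_)
open import Data.Sum using (_⊎_)
open import Relation.Nullary using (¬_)
open import Relation.Binary.PropositionalEquality using (_≡_)
open import Data.Bool using (Bool; true; false; if_then_else_; _∧_; _∨_)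
import Data.Bool.Properties as Bool
open import Data.Empty using (⊥)
open import Data.Unit using (tt)
open import Data.Nat using (zero; _+_; z≤n; s≤s; NonZero; >-nonZero; >-nonZero⁻¹; nonZero; ≢-nonZero; ≢-nonZero⁻¹)
import Data.Nat.Properties as ℕ
open import Data.Nat.DivMod using (_%_; _/_; _mod_)
open import Data.Nat.Divisibility using (divides)
import Data.Nat.Divisibility as ℕ∣
open import Data.Nat.GCD using (gcd)
open import Data.Nat.Coprimality using (Coprime; coprime?)
open import Data.Integer using (-[1+_])
  renaming (_+_ to _⊕_; _*_ to _⊛_; _-_ to _⊖_; -_ to ⊝_; _^_ to _↑_; _≤_ to _≤ᶻ_; ∣_∣ to abs)
import Data.Integer.Properties as ℤ
open import Data.Integer.DivMod using (_%ℕ_; _/ℕ_)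
open import Data.Integer.Tactic.RingSolver using (solve-∀)
open import Data.Fin using (toℕ; fromℕ<)
open import Data.Fin.Subset using (_∈_; _∉_; _⊆_; _∪_; _─_; ⁅_⁆)
open import Data.Fin.Subset.Properties using (_∈?_; _⊆?_)
open import Data.List using (List; []; _∷_; map; concatMap; filter; length; upTo; _++_; allFin; applyUpTo) renaming (tabulate to tabulateˡ; lookup to lookupˡ)
open import Data.List.Membership.Propositional using () renaming (_∈_ to _∈ˡ_)
open import Data.List.Relation.Unary.Any using (Any; here; there)
open import Data.List.Relation.Unary.All using (All; []; _∷_)
open import Data.Vec using (Vec; []; _∷_; here; there; lookup; replicate; tabulate)
open import Data.Product using (Σ; _,_; proj₁; proj₂)
open import Data.Sum using (inj₁; inj₂; [_,_]′)
open import Function using (_∘_; id)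
open import Relation.Nullary using (Dec; yes; no; does; contradiction; _×-dec_; _⊎-dec_; _→-dec_; ¬?; map′)
open import Relation.Nullary.Decidable using (dec-true; decidable-stable)
open import Relation.Binary.PropositionalEquality using (_≢_; _≗_; refl; sym; trans; cong; cong₂; subst; module ≡-Reasoning)
import Data.Fin.Properties as Fin
import Data.List.Properties as List
import Data.Vec.Properties as Vec
import Data.Nat.DivMod as ℕ/
import Data.Nat.Coprimality as Coprime
import Data.Nat.Primality as Prime
import Data.Nat.GCD as GCD
import Data.Integer.DivMod as ℤ/
import Data.Integer.Divisibility.Signed as ∣ˢ
import Data.Fin.Subset.Properties as Subset
import Data.Fin.Subset as Sub
import Data.Vec.Functional as VF
import Data.Nat.LCM as LCM
import Data.List.Membership.Propositional.Properties as Mem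
open import Data.List.Relation.Unary.Unique.Propositional using (Unique)
import Data.List.Relation.Unary.Unique.Propositional.Properties as Unique
import Data.List.Relation.Unary.AllPairs as AllPairs
import Data.List.Relation.Unary.All as All
import Data.List.Relation.Unary.All.Properties as All
import Data.List.Relation.Unary.Any as Any
import Data.List.Relation.Unary.Any.Properties as Any
open import Relation.Binary.Definitions using (DecidableEquality; Tri; tri<; tri≈; tri>)

-- Putting u = 0 in f(g + u) = α(g) + f(u) gives f(g) = α(g) + f(0): up to a translation f is the
-- automorphism α, and differences f(h) - f(g) see only α. Hence a unit a = α(1) is all that remains
-- of a weak equivalence.
--
-- The number of elements of each order mod p is found without constructing a primitive root.
-- `HasIndex` says by divisibility what y = g^d would give. If some element has order e, its powers
-- are all the e-th roots of unity, so exactly φ(e) elements have order e. In any case there are at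
-- most φ(e), and since both counts add up to p - 1 over the divisors, equality holds throughout.
--
-- All cardinalities are integer sums of 0/1 indicators over lists that contain each element once,
-- so that a double count is an exchange of two sums and the signs of inclusion-exclusion fit in.
-- Generating functions are coefficient sequences on which the polynomials of the formula act by
-- convolution. The exponent of 1 + x^α_T is the number of classes with support T; it appears by
-- removing these classes one at a time.

private variable
  A B P Q : Set

-- Finite sums

∑ : List A → (A → ℤ) → ℤ
∑ []       f = + 0
∑ (x ∷ xs) f = f x ⊕ ∑ xs f

syntax ∑ xs (λ x → e) = ∑[ x ← xs ] e
infix 5 ∑

∑-cong∈ : (xs : List A) {f g : A → ℤ} → (∀ x → x ∈ˡ xs → f x ≡ g x) → ∑ xs f ≡ ∑ xs g
∑-cong∈ []       h = refl
∑-cong∈ (x ∷ xs) h = cong₂ _⊕_ (h x (here refl)) (∑-cong∈ xs λ y m → h y (there m))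

∑-cong : (xs : List A) {f g : A → ℤ} → f ≗ g → ∑ xs f ≡ ∑ xs g
∑-cong xs h = ∑-cong∈ xs λ x _ → h x

∑-0 : (xs : List A) {f : A → ℤ} → (∀ x → f x ≡ + 0) → ∑ xs f ≡ + 0
∑-0 []       h = refl
∑-0 (x ∷ xs) h = cong₂ _⊕_ (h x) (∑-0 xs h)

∑-⊕ : (xs : List A) (f g : A → ℤ) → (∑[ x ← xs ] (f x ⊕ g x)) ≡ ∑ xs f ⊕ ∑ xs g
∑-⊕ []       f g = refl
∑-⊕ (x ∷ xs) f g = trans (cong (f x ⊕ g x ⊕_) (∑-⊕ xs f g)) (lemma (f x) (g x) (∑ xs f) (∑ xs g))
  where lemma : ∀ a b c d → a ⊕ b ⊕ (c ⊕ d) ≡ a ⊕ c ⊕ (b ⊕ d)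
        lemma = solve-∀

∑-⊛ˡ : (xs : List A) (c : ℤ) (f : A → ℤ) → (∑[ x ← xs ] (c ⊛ f x)) ≡ c ⊛ ∑ xs f
∑-⊛ˡ []       c f = sym (ℤ.*-zeroʳ c)
∑-⊛ˡ (x ∷ xs) c f = trans (cong (c ⊛ f x ⊕_) (∑-⊛ˡ xs c f)) (sym (ℤ.*-distribˡ-+ c (f x) (∑ xs f)))

∑-⊛ʳ : (xs : List A) (c : ℤ) (f : A → ℤ) → (∑[ x ← xs ] (f x ⊛ c)) ≡ ∑ xs f ⊛ c
∑-⊛ʳ xs c f = trans (∑-cong xs λ x → ℤ.*-comm (f x) c) (trans (∑-⊛ˡ xs c f) (ℤ.*-comm c (∑ xs f)))

∑-swap : (xs : List A) (ys : List B) (f : A → B → ℤ) →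
  (∑[ x ← xs ] ∑[ y ← ys ] f x y) ≡ (∑[ y ← ys ] ∑[ x ← xs ] f x y)
∑-swap []       ys f = sym (∑-0 ys λ _ → refl)
∑-swap (x ∷ xs) ys f = trans (cong (∑ ys (f x) ⊕_) (∑-swap xs ys f)) (sym (∑-⊕ ys (f x) _))

∑-map : (g : A → B) (xs : List A) (f : B → ℤ) → ∑ (map g xs) f ≡ ∑ xs (f ∘ g)
∑-map g []       f = refl
∑-map g (x ∷ xs) f = cong (f (g x) ⊕_) (∑-map g xs f)

∑-++ : (xs ys : List A) (f : A → ℤ) → ∑ (xs ++ ys) f ≡ ∑ xs f ⊕ ∑ ys f
∑-++ []       ys f = sym (ℤ.+-identityˡ _)
∑-++ (x ∷ xs) ys f = trans (cong (f x ⊕_) (∑-++ xs ys f)) (sym (ℤ.+-assoc (f x) _ _))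

∑-concatMap : (g : A → List B) (xs : List A) (f : B → ℤ) →
  ∑ (concatMap g xs) f ≡ (∑[ x ← xs ] ∑ (g x) f)
∑-concatMap g []       f = refl
∑-concatMap g (x ∷ xs) f = trans (∑-++ (g x) (concatMap g xs) f) (cong (∑ (g x) f ⊕_) (∑-concatMap g xs f))

∑-mono : (xs : List A) {f g : A → ℤ} → (∀ x → x ∈ˡ xs → f x ≤ᶻ g x) → ∑ xs f ≤ᶻ ∑ xs g
∑-mono []       h = ℤ.≤-refl
∑-mono (x ∷ xs) h = ℤ.+-mono-≤ (h x (here refl)) (∑-mono xs λ y m → h y (there m))

⊕-cancelˡ : ∀ a {b c} → a ⊕ b ≡ a ⊕ c → b ≡ c
⊕-cancelˡ a {b} {c} e = trans (sym (undo a b)) (trans (cong (⊝ a ⊕_) e) (undo a c))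
  where undo : ∀ a b → ⊝ a ⊕ (a ⊕ b) ≡ b
        undo = solve-∀

-- A strict inequality in one term could not be made up by the others. This is what turns the upper
-- bounds on the numbers of elements of each index into equalities.
∑-mono-≡ : (xs : List A) {f g : A → ℤ} → (∀ x → x ∈ˡ xs → f x ≤ᶻ g x) → ∑ xs f ≡ ∑ xs g →
  ∀ x → x ∈ˡ xs → f x ≡ g x
∑-mono-≡ (x ∷ xs) {f} {g} h e = λ where
    _ (here refl) → e₀
    y (there m)   → ∑-mono-≡ xs (λ z k → h z (there k)) (⊕-cancelˡ (f x)
                      (trans e (cong (_⊕ ∑ xs g) (sym e₀)))) y m
  where
  e₀ : f x ≡ g x
  e₀ = ℤ.≤-antisym (h x (here refl)) (ℤ.≮⇒≥ λ lt →
    ℤ.<-irrefl e (ℤ.+-mono-<-≤ lt (∑-mono xs λ z k → h z (there k))))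

∑-1 : (xs : List A) → (∑[ _ ← xs ] + 1) ≡ + length xs
∑-1 []       = refl
∑-1 (x ∷ xs) = cong (+ 1 ⊕_) (∑-1 xs)

-- Indicators and double counting

𝟙 : Dec P → ℤ
𝟙 p = if does p then + 1 else + 0

𝟙-yes : (p : Dec P) → P → 𝟙 p ≡ + 1
𝟙-yes (yes _) _ = refl
𝟙-yes (no ¬p) p = contradiction p ¬p

𝟙-no : (p : Dec P) → ¬ P → 𝟙 p ≡ + 0
𝟙-no (yes p) ¬p = contradiction p ¬p
𝟙-no (no _)  _  = refl

𝟙-cong : (p : Dec P) (q : Dec Q) → (P → Q) → (Q → P) → 𝟙 p ≡ 𝟙 q
𝟙-cong (yes p) q f g = sym (𝟙-yes q (f p))
𝟙-cong (no ¬p) q f g = sym (𝟙-no q (¬p ∘ g))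

𝟙-× : (p : Dec P) (q : Dec Q) → 𝟙 (p ×-dec q) ≡ 𝟙 p ⊛ 𝟙 q
𝟙-× (yes p) (yes q) = refl
𝟙-× (yes p) (no _)  = refl
𝟙-× (no _)  _       = refl

𝟙-¬ : (p : Dec P) → 𝟙 (¬? p) ≡ + 1 ⊖ 𝟙 p
𝟙-¬ (yes p) = refl
𝟙-¬ (no _)  = refl

-- Inside a sum, an equation may be used that holds only where the indicator is 1.
𝟙-guard : (p : Dec P) {x y : ℤ} → (P → x ≡ y) → 𝟙 p ⊛ x ≡ 𝟙 p ⊛ y
𝟙-guard (yes p) h = cong (+ 1 ⊛_) (h p)
𝟙-guard (no _)  h = refl

𝟙-≥0 : (p : Dec P) → + 0 ≤ᶻ 𝟙 p
𝟙-≥0 (yes _) = _≤ᶻ_.+≤+ z≤n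
𝟙-≥0 (no _)  = ℤ.≤-refl

-- The single equation `once` says both that `elems` is exhaustive and that it has no repetitions,
-- in the form in which double counting uses it.
record Finite (A : Set) : Set where
  infix 4 _≟_
  field
    elems : List A
    _≟_   : DecidableEquality A
    once  : ∀ a → (∑[ x ← elems ] 𝟙 (x ≟ a)) ≡ + 1

open Finite public using (elems)

module _ (F : Finite A) where
  open Finite F using (_≟_; once)

  ∑-pick : (a : A) (f : A → ℤ) → (∑[ x ← elems F ] (𝟙 (x ≟ a) ⊛ f x)) ≡ f a
  ∑-pick a f = begin
    (∑[ x ← elems F ] (𝟙 (x ≟ a) ⊛ f x)) ≡⟨ ∑-cong (elems F) (λ x → 𝟙-guard (x ≟ a) (cong f)) ⟩
    (∑[ x ← elems F ] (𝟙 (x ≟ a) ⊛ f a)) ≡⟨ ∑-⊛ʳ (elems F) (f a) _ ⟩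
    (∑[ x ← elems F ] 𝟙 (x ≟ a)) ⊛ f a   ≡⟨ cong (_⊛ f a) (once a) ⟩
    + 1 ⊛ f a                            ≡⟨ ℤ.*-identityˡ (f a) ⟩
    f a ∎
    where open ≡-Reasoning

  count-unique : {P : A → Set} (P? : ∀ x → Dec (P x)) (a : A) → P a → (∀ x → P x → x ≡ a) →
    (∑[ x ← elems F ] 𝟙 (P? x)) ≡ + 1
  count-unique {P} P? a p u = trans
    (∑-cong (elems F) λ x → 𝟙-cong (P? x) (x ≟ a) (u x) λ e → subst P (sym e) p) (once a)

∈-elems : (F : Finite A) (a : A) → a ∈ˡ elems F
∈-elems F a = go (elems F) (λ e → contradiction (trans (sym (once a)) e) λ ())
  where
  open Finite F using (_≟_; once)
  go : (xs : List _) → ¬ (∑[ x ← xs ] 𝟙 (x ≟ a)) ≡ + 0 → a ∈ˡ xs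
  go []       h = contradiction refl h
  go (x ∷ xs) h with x ≟ a
  ... | yes e = here (sym e)
  ... | no _  = there (go xs (λ e → h (trans (ℤ.+-identityˡ _) e)))

-- Double counting of the related pairs: every a with P has exactly one partner, and so has every b
-- with Q. With a relation, nothing has to be chosen outside P and Q.
count-rel : (F : Finite A) (G : Finite B) {P : A → Set} {Q : B → Set} {R : A → B → Set}
  (P? : ∀ a → Dec (P a)) (Q? : ∀ b → Dec (Q b)) (R? : ∀ a b → Dec (R a b)) →
  (∀ a → P a → Σ B λ b → R a b × (∀ b′ → R a b′ → b′ ≡ b)) →
  (∀ b → Q b → Σ A λ a → R a b × (∀ a′ → R a′ b → a′ ≡ a)) →
  (∀ a b → R a b → P a × Q b) →
  (∑[ a ← elems F ] 𝟙 (P? a)) ≡ (∑[ b ← elems G ] 𝟙 (Q? b))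
count-rel F G P? Q? R? f g h = begin
  (∑[ a ← elems F ] 𝟙 (P? a))                     ≡⟨ ∑-cong (elems F) left ⟩
  (∑[ a ← elems F ] ∑[ b ← elems G ] 𝟙 (R? a b)) ≡⟨ ∑-swap (elems F) (elems G) _ ⟩
  (∑[ b ← elems G ] ∑[ a ← elems F ] 𝟙 (R? a b)) ≡⟨ ∑-cong (elems G) right ⟩
  (∑[ b ← elems G ] 𝟙 (Q? b)) ∎
  where
  open ≡-Reasoning
  left : ∀ a → 𝟙 (P? a) ≡ (∑[ b ← elems G ] 𝟙 (R? a b))
  left a with P? a
  ... | yes p = let b , r , u = f a p in sym (count-unique G (R? a) b r u)
  ... | no ¬p = sym (∑-0 (elems G) λ b → 𝟙-no (R? a b) (¬p ∘ proj₁ ∘ h a b))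
  right : ∀ b → (∑[ a ← elems F ] 𝟙 (R? a b)) ≡ 𝟙 (Q? b)
  right b with Q? b
  ... | yes q = let a , r , u = g b q in count-unique F (λ a → R? a b) a r u
  ... | no ¬q = ∑-0 (elems F) λ a → 𝟙-no (R? a b) (¬q ∘ proj₂ ∘ h a b)

count-bij : (F : Finite A) (G : Finite B) {P : A → Set} {Q : B → Set}
  (P? : ∀ a → Dec (P a)) (Q? : ∀ b → Dec (Q b)) (f : A → B) (g : B → A) →
  (∀ a → P a → Q (f a) × g (f a) ≡ a) →
  (∀ b → Q b → P (g b) × f (g b) ≡ b) →
  (∑[ a ← elems F ] 𝟙 (P? a)) ≡ (∑[ b ← elems G ] 𝟙 (Q? b))
count-bij F G {P} {Q} P? Q? f g h k = count-rel F G P? Q?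
  (λ a b → P? a ×-dec Finite._≟_ G b (f a))
  (λ a p → f a , (p , refl) , λ _ → proj₂)
  (λ b q → g b , (proj₁ (k b q) , sym (proj₂ (k b q))) ,
    λ a (p , e) → trans (sym (proj₂ (h a p))) (cong g (sym e)))
  (λ a b (p , e) → p , subst Q (sym e) (proj₁ (h a p)))

count-image : (F : Finite A) (G : Finite B) {P : A → Set} (P? : ∀ a → Dec (P a)) (h : B → A) →
  (∀ b b′ → h b ≡ h b′ → b ≡ b′) → (∀ b → P (h b)) → (∀ a → P a → Σ B λ b → h b ≡ a) →
  (∑[ a ← elems F ] 𝟙 (P? a)) ≡ + length (elems G)
count-image F G P? h inj p sur = trans
  (count-rel F G P? (λ _ → yes tt) (λ a b → Finite._≟_ F (h b) a)
    (λ a q → let b , e = sur a q in b , e , λ b′ e′ → inj b′ b (trans e′ (sym e)))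
    (λ b _ → h b , refl , λ _ e → sym e)
    (λ a b e → subst _ e (p b) , tt))
  (∑-1 (elems G))

∑-allFin : ∀ n (f : Fin n → ℤ) (g : ℕ → ℤ) → (∀ i → f i ≡ g (toℕ i)) → ∑ (allFin n) f ≡ ∑ (upTo n) g
∑-allFin zero    f g h = refl
∑-allFin (suc n) f g h = cong₂ _⊕_ (h Fin.zero) (shift n f g h)
  where
  shift : ∀ n (f : Fin (suc n) → ℤ) g → (∀ i → f i ≡ g (toℕ i)) →
    ∑ (tabulateˡ Fin.suc) f ≡ ∑ (applyUpTo suc n) g
  shift n f g h = begin
    ∑ (tabulateˡ Fin.suc) f  ≡⟨ cong (λ l → ∑ l f) (sym (List.map-tabulate id Fin.suc)) ⟩
    ∑ (map Fin.suc (allFin n)) f      ≡⟨ ∑-map Fin.suc (allFin n) f ⟩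
    ∑ (allFin n) (f ∘ Fin.suc)        ≡⟨ ∑-allFin n (f ∘ Fin.suc) (g ∘ suc) (h ∘ Fin.suc) ⟩
    ∑ (upTo n) (g ∘ suc)              ≡⟨ ∑-map suc (upTo n) g ⟨
    ∑ (map suc (upTo n)) g            ≡⟨ cong (λ l → ∑ l g) (List.map-upTo suc n) ⟩
    ∑ (applyUpTo suc n) g   ∎
    where open ≡-Reasoning

∑-allFin-suc : ∀ n (f : Fin (suc n) → ℤ) → ∑ (allFin (suc n)) f ≡ f Fin.zero ⊕ ∑ (allFin n) (f ∘ Fin.suc)
∑-allFin-suc n f = cong (f Fin.zero ⊕_) (trans
  (cong (λ l → ∑ l f) (sym (List.map-tabulate id Fin.suc))) (∑-map Fin.suc (allFin n) f))

finFinite : ∀ n → Finite (Fin n)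
finFinite n = record { elems = allFin n ; _≟_ = Fin._≟_ ; once = once n }
  where
  once : ∀ n (a : Fin n) → (∑[ x ← allFin n ] 𝟙 (x Fin.≟ a)) ≡ + 1
  once (suc n) a = trans (∑-allFin-suc n (λ x → 𝟙 (x Fin.≟ a))) (go a)
    where
    go : ∀ a → 𝟙 (Fin.zero Fin.≟ a) ⊕ (∑[ x ← allFin n ] 𝟙 (Fin.suc x Fin.≟ a)) ≡ + 1
    go Fin.zero    = cong (+ 1 ⊕_) (∑-0 (allFin n) λ _ → refl)
    go (Fin.suc a) = trans (ℤ.+-identityˡ _) (trans
      (∑-cong (allFin n) λ x → 𝟙-cong (Fin.suc x Fin.≟ Fin.suc a) (x Fin.≟ a) Fin.suc-injective (cong Fin.suc))
      (once n a))

allSubsets-once : ∀ n (S : Subset n) (_≟_ : DecidableEquality (Subset n)) →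
  (∑[ T ← allSubsets n ] 𝟙 (T ≟ S)) ≡ + 1
allSubsets-once zero    [] _≟_ = trans (ℤ.+-identityʳ _) (𝟙-yes ([] ≟ []) refl)
allSubsets-once (suc n) (b ∷ S) _≟_ = begin
  (∑[ T ← allSubsets (suc n) ] 𝟙 (T ≟ (b ∷ S)))
    ≡⟨ ∑-concatMap _ (allSubsets n) _ ⟩
  (∑[ T ← allSubsets n ] (𝟙 ((true ∷ T) ≟ (b ∷ S)) ⊕ (𝟙 ((false ∷ T) ≟ (b ∷ S)) ⊕ + 0)))
    ≡⟨ ∑-cong (allSubsets n) (λ T → head b T) ⟩
  (∑[ T ← allSubsets n ] 𝟙 (T ≟′ S))
    ≡⟨ allSubsets-once n S _≟′_ ⟩
  + 1 ∎
  where
  open ≡-Reasoning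
  _≟′_ : DecidableEquality (Subset n)
  _≟′_ = Vec.≡-dec Bool._≟_
  same : ∀ c T → 𝟙 ((c ∷ T) ≟ (c ∷ S)) ≡ 𝟙 (T ≟′ S)
  same c T = 𝟙-cong ((c ∷ T) ≟ (c ∷ S)) (T ≟′ S) Vec.∷-injectiveʳ (cong (c ∷_))
  head : ∀ b T → 𝟙 ((true ∷ T) ≟ (b ∷ S)) ⊕ (𝟙 ((false ∷ T) ≟ (b ∷ S)) ⊕ + 0) ≡ 𝟙 (T ≟′ S)
  head true  T = trans (cong₂ (λ x y → x ⊕ (y ⊕ + 0)) (same true T)
    (𝟙-no ((false ∷ T) ≟ (true ∷ S)) λ ())) (ℤ.+-identityʳ _)
  head false T = trans (cong₂ (λ x y → x ⊕ (y ⊕ + 0)) (𝟙-no ((true ∷ T) ≟ (false ∷ S)) λ ())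
    (same false T)) (trans (ℤ.+-identityˡ _) (ℤ.+-identityʳ _))

subsetFinite : ∀ n → Finite (Subset n)
subsetFinite n = record { elems = allSubsets n ; _≟_ = _≟_ ; once = λ S → allSubsets-once n S _≟_ }
  where
  _≟_ : DecidableEquality (Subset n)
  _≟_ = Vec.≡-dec Bool._≟_

-- Congruences

∣∧<⇒≡0 : ∀ {n k} → n ∣ k → k < n → k ≡ 0
∣∧<⇒≡0 {k = zero}  d l = refl
∣∧<⇒≡0 {k = suc k} d l = contradiction (ℕ∣.∣⇒≤ d) (ℕ.<⇒≱ l)

infix 4 _≈_[_]
-- Integers under congruence rather than residue types: the same integer can then be read modulo n,
-- modulo each prime factor and, as an exponent, modulo p - 1.
record _≈_[_] (x y : ℤ) (n : ℕ) : Set where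
  constructor cong-mod
  field
    quot  : ℤ
    equal : x ⊖ y ≡ quot ⊛ + n

module _ {n : ℕ} where

  ≈-refl : ∀ {x} → x ≈ x [ n ]
  ≈-refl {x} = cong-mod (+ 0) (ℤ.+-inverseʳ x)

  ≈-reflexive : ∀ {x y} → x ≡ y → x ≈ y [ n ]
  ≈-reflexive refl = ≈-refl

  ≈-sym : ∀ {x y} → x ≈ y [ n ] → y ≈ x [ n ]
  ≈-sym {x} {y} (cong-mod q e) = cong-mod (⊝ q) (trans (lemma₁ x y) (trans (cong ⊝_ e) (lemma₂ q (+ n))))
    where lemma₁ : ∀ x y → y ⊖ x ≡ ⊝ (x ⊖ y)
          lemma₁ = solve-∀
          lemma₂ : ∀ q n → ⊝ (q ⊛ n) ≡ ⊝ q ⊛ n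
          lemma₂ = solve-∀

  ≈-trans : ∀ {x y z} → x ≈ y [ n ] → y ≈ z [ n ] → x ≈ z [ n ]
  ≈-trans {x} {y} {z} (cong-mod q e) (cong-mod r f) =
    cong-mod (q ⊕ r) (trans (lemma₁ x y z) (trans (cong₂ _⊕_ e f) (sym (ℤ.*-distribʳ-+ (+ n) q r))))
    where lemma₁ : ∀ x y z → x ⊖ z ≡ (x ⊖ y) ⊕ (y ⊖ z)
          lemma₁ = solve-∀

  ≈-⊛ : ∀ {x y z w} → x ≈ y [ n ] → z ≈ w [ n ] → x ⊛ z ≈ y ⊛ w [ n ]
  ≈-⊛ {x} {y} {z} {w} (cong-mod q e) (cong-mod r f) = cong-mod (q ⊛ z ⊕ y ⊛ r)
    (trans (lemma₁ x y z w) (trans (cong₂ (λ a b → a ⊛ z ⊕ y ⊛ b) e f) (lemma₂ q r y z (+ n))))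
    where lemma₁ : ∀ x y z w → x ⊛ z ⊖ y ⊛ w ≡ (x ⊖ y) ⊛ z ⊕ y ⊛ (z ⊖ w)
          lemma₁ = solve-∀
          lemma₂ : ∀ q r y z n → q ⊛ n ⊛ z ⊕ y ⊛ (r ⊛ n) ≡ (q ⊛ z ⊕ y ⊛ r) ⊛ n
          lemma₂ = solve-∀

  ≈-⊕ : ∀ {x y z w} → x ≈ y [ n ] → z ≈ w [ n ] → x ⊕ z ≈ y ⊕ w [ n ]
  ≈-⊕ {x} {y} {z} {w} (cong-mod q e) (cong-mod r f) = cong-mod (q ⊕ r)
    (trans (lemma₁ x y z w) (trans (cong₂ _⊕_ e f) (sym (ℤ.*-distribʳ-+ (+ n) q r))))
    where lemma₁ : ∀ x y z w → x ⊕ z ⊖ (y ⊕ w) ≡ (x ⊖ y) ⊕ (z ⊖ w)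
          lemma₁ = solve-∀

  ≈-⊝ : ∀ {x y} → x ≈ y [ n ] → ⊝ x ≈ ⊝ y [ n ]
  ≈-⊝ {x} {y} (cong-mod q e) = cong-mod (⊝ q) (trans (lemma₁ x y) (trans (cong ⊝_ e) (lemma₂ q (+ n))))
    where lemma₁ : ∀ x y → ⊝ x ⊖ ⊝ y ≡ ⊝ (x ⊖ y)
          lemma₁ = solve-∀
          lemma₂ : ∀ q n → ⊝ (q ⊛ n) ≡ ⊝ q ⊛ n
          lemma₂ = solve-∀

  ≈-⊛ˡ : ∀ {x y} c → x ≈ y [ n ] → c ⊛ x ≈ c ⊛ y [ n ]
  ≈-⊛ˡ c = ≈-⊛ (≈-refl {c})

  ≈-⊛ʳ : ∀ {x y} c → x ≈ y [ n ] → x ⊛ c ≈ y ⊛ c [ n ]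
  ≈-⊛ʳ c e = ≈-⊛ e (≈-refl {c})

  ≈-↑ : ∀ {x y} k → x ≈ y [ n ] → x ↑ k ≈ y ↑ k [ n ]
  ≈-↑ zero    e = ≈-refl
  ≈-↑ (suc k) e = ≈-⊛ e (≈-↑ k e)

  ≈⇒⊖≈0 : ∀ {x y} → x ≈ y [ n ] → x ⊖ y ≈ + 0 [ n ]
  ≈⇒⊖≈0 (cong-mod q e) = cong-mod q (trans (ℤ.+-identityʳ _) e)

  ⊖≈0⇒≈ : ∀ {x y} → x ⊖ y ≈ + 0 [ n ] → x ≈ y [ n ]
  ⊖≈0⇒≈ (cong-mod q e) = cong-mod q (trans (sym (ℤ.+-identityʳ _)) e)

  0≈⇒∣ : ∀ {x} → x ≈ + 0 [ n ] → n ∣ abs x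
  0≈⇒∣ {x} (cong-mod q e) = ∣ˢ.∣⇒∣ᵤ (∣ˢ.divides q (trans (sym (ℤ.+-identityʳ x)) e))

  ∣⇒0≈ : ∀ {x} → n ∣ abs x → x ≈ + 0 [ n ]
  ∣⇒0≈ {x} d with ∣ˢ.∣ᵤ⇒∣ {+ n} {x} d
  ... | ∣ˢ.divides q e = cong-mod q (trans (ℤ.+-identityʳ x) e)

  ≈⇒∣ : ∀ {x y} → x ≈ y [ n ] → n ∣ abs (x ⊖ y)
  ≈⇒∣ = 0≈⇒∣ ∘ ≈⇒⊖≈0

  ∣⇒≈ : ∀ {x y} → n ∣ abs (x ⊖ y) → x ≈ y [ n ]
  ∣⇒≈ = ⊖≈0⇒≈ ∘ ∣⇒0≈

  modulus≈0 : + n ≈ + 0 [ n ]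
  modulus≈0 = ∣⇒0≈ ℕ∣.∣-refl

≈? : ∀ n x y → Dec (x ≈ y [ n ])
≈? n x y = map′ ∣⇒≈ ≈⇒∣ (n ℕ∣.∣? abs (x ⊖ y))

≈-weaken : ∀ {m n x y} → m ∣ n → x ≈ y [ n ] → x ≈ y [ m ]
≈-weaken d e = ∣⇒≈ (ℕ∣.∣-trans d (≈⇒∣ e))

module ≈-Reasoning (n : ℕ) where
  infix  3 _∎≈
  infixr 2 _≈⟨_⟩_ _≡≈⟨_⟩_
  infix  1 begin≈_

  begin≈_ : ∀ {x y} → x ≈ y [ n ] → x ≈ y [ n ]
  begin≈ e = e

  _≈⟨_⟩_ : ∀ x {y z} → x ≈ y [ n ] → y ≈ z [ n ] → x ≈ z [ n ]
  x ≈⟨ e ⟩ f = ≈-trans e f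

  _≡≈⟨_⟩_ : ∀ x {y z} → x ≡ y → y ≈ z [ n ] → x ≈ z [ n ]
  x ≡≈⟨ e ⟩ f = ≈-trans (≈-reflexive e) f

  _∎≈ : ∀ x → x ≈ x [ n ]
  x ∎≈ = ≈-refl

⟦_⟧ : ∀ {n} → Fin n → ℤ
⟦ x ⟧ = + toℕ x

⟦⟧-injective : ∀ {n} {x y : Fin n} → ⟦ x ⟧ ≈ ⟦ y ⟧ [ n ] → x ≡ y
⟦⟧-injective {n} {x} {y} e = Fin.toℕ-injective (ℤ.+-injective (ℤ.i-j≡0⇒i≡j ⟦ x ⟧ ⟦ y ⟧ (ℤ.∣i∣≡0⇒i≡0 (∣∧<⇒≡0 (≈⇒∣ e) bound))))
  where
  bound : abs (⟦ x ⟧ ⊖ ⟦ y ⟧) < n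
  bound = subst (_< n) (cong abs (sym (ℤ.m-n≡m⊖n (toℕ x) (toℕ y))))
    (ℕ.≤-<-trans (ℤ.∣m⊝n∣≤m⊔n (toℕ x) (toℕ y)) (ℕ.⊔-pres-<m (Fin.toℕ<n x) (Fin.toℕ<n y)))

reduce : ∀ {n} .{{_ : NonZero n}} → ℤ → Fin n
reduce {n} z = fromℕ< (ℤ/.n%ℕd<d z n)

⟦reduce⟧ : ∀ {n} .{{_ : NonZero n}} z → ⟦ reduce {n} z ⟧ ≈ z [ n ]
⟦reduce⟧ {n} z = ≈-sym (cong-mod (z /ℕ n) (begin
  z ⊖ ⟦ reduce {n} z ⟧                        ≡⟨ cong (λ r → z ⊖ + r) (Fin.toℕ-fromℕ< _) ⟩
  z ⊖ + (z %ℕ n)                              ≡⟨ cong (_⊖ + (z %ℕ n)) (ℤ/.a≡a%ℕn+[a/ℕn]*n z n) ⟩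
  + (z %ℕ n) ⊕ (z /ℕ n) ⊛ + n ⊖ + (z %ℕ n)    ≡⟨ lemma (+ (z %ℕ n)) _ ⟩
  (z /ℕ n) ⊛ + n ∎))
  where
  open ≡-Reasoning
  lemma : ∀ r q → r ⊕ q ⊖ r ≡ q
  lemma = solve-∀

reduce-cong : ∀ {n} .{{_ : NonZero n}} {y z} → y ≈ z [ n ] → reduce {n} y ≡ reduce z
reduce-cong e = ⟦⟧-injective (≈-trans (⟦reduce⟧ _) (≈-trans e (≈-sym (⟦reduce⟧ _))))

reduce-⟦⟧ : ∀ {n} .{{_ : NonZero n}} (x : Fin n) → reduce ⟦ x ⟧ ≡ x
reduce-⟦⟧ x = ⟦⟧-injective (⟦reduce⟧ _)

mod-≈ : ∀ k n .{{_ : NonZero n}} → + toℕ (k mod n) ≈ + k [ n ]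
mod-≈ k n = ≈-trans (≈-reflexive (cong +_ (Fin.toℕ-fromℕ< _))) (≈-sym (cong-mod (+ (k / n)) (begin
  + k ⊖ + (k % n)                    ≡⟨ cong (λ z → + z ⊖ + (k % n)) (ℕ/.m≡m%n+[m/n]*n k n) ⟩
  + (k % n + k / n * n) ⊖ + (k % n)  ≡⟨ cong (_⊖ + (k % n)) (ℤ.pos-+ (k % n) (k / n * n)) ⟩
  + (k % n) ⊕ + (k / n * n) ⊖ + (k % n) ≡⟨ lemma (+ (k % n)) _ ⟩
  + (k / n * n)                      ≡⟨ ℤ.pos-* (k / n) n ⟩
  + (k / n) ⊛ + n ∎)))
  where
  open ≡-Reasoning
  lemma : ∀ r q → r ⊕ q ⊖ r ≡ q
  lemma = solve-∀

↑-+ : ∀ (a : ℤ) j k → a ↑ (j + k) ≡ a ↑ j ⊛ a ↑ k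
↑-+ a j k = ℤ.^-distribˡ-+-* a j k

↑-* : ∀ (a : ℤ) j k → a ↑ (j * k) ≡ (a ↑ j) ↑ k
↑-* a j k = sym (ℤ.^-*-assoc a j k)

1↑ : ∀ k → (+ 1) ↑ k ≡ + 1
1↑ = ℤ.^-zeroˡ

Unit : ℕ → ℤ → Set
Unit n a = Σ ℤ λ b → b ⊛ a ≈ + 1 [ n ]

⊛-cancelˡ : ∀ {n a x y} → Unit n a → a ⊛ x ≈ a ⊛ y [ n ] → x ≈ y [ n ]
⊛-cancelˡ {n} {a} {x} {y} (b , e) f = begin≈
  x            ≡≈⟨ sym (ℤ.*-identityˡ x) ⟩
  + 1 ⊛ x      ≈⟨ ≈-⊛ʳ x (≈-sym e) ⟩
  b ⊛ a ⊛ x    ≡≈⟨ ℤ.*-assoc b a x ⟩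
  b ⊛ (a ⊛ x)  ≈⟨ ≈-⊛ˡ b f ⟩
  b ⊛ (a ⊛ y)  ≡≈⟨ sym (ℤ.*-assoc b a y) ⟩
  b ⊛ a ⊛ y    ≈⟨ ≈-⊛ʳ y e ⟩
  + 1 ⊛ y      ≡≈⟨ ℤ.*-identityˡ y ⟩
  y ∎≈
  where open ≈-Reasoning n

unit-↑ : ∀ {n a} k → Unit n a → Unit n (a ↑ k)
unit-↑ zero    u = + 1 , ≈-refl
unit-↑ {a = a} (suc k) u@(b , e) with unit-↑ k u
... | c , f = b ⊛ c , ≈-trans (≈-reflexive (lemma a b c (a ↑ k))) (≈-⊛ e f)
  where lemma : ∀ a b c x → b ⊛ c ⊛ (a ⊛ x) ≡ b ⊛ a ⊛ (c ⊛ x)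
        lemma = solve-∀

coprime⇒unit : ∀ {n} k → Coprime k n → Unit n (+ k)
coprime⇒unit {n} k c with Coprime.coprime-Bézout c
... | GCD.Bézout.+- x y e = + x , cong-mod (+ y) (trans (cong (λ z → z ⊖ + 1)
        (trans (sym (ℤ.pos-* x k)) (trans (cong +_ (sym e)) (trans (ℤ.pos-+ 1 (y * n)) (cong (+ 1 ⊕_) (ℤ.pos-* y n))))))
        (lemma (+ y ⊛ + n)))
  where lemma : ∀ z → + 1 ⊕ z ⊖ + 1 ≡ z
        lemma = solve-∀
... | GCD.Bézout.-+ x y e = ⊝ + x , cong-mod (⊝ + y) (trans (lemma (+ x) (+ k))
        (trans (cong ⊝_ (trans (cong (+ 1 ⊕_) (sym (ℤ.pos-* x k))) (trans (sym (ℤ.pos-+ 1 (x * k))) (trans (cong +_ e) (ℤ.pos-* y n)))))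
          (ℤ.neg-distribˡ-* (+ y) (+ n))))
  where lemma : ∀ x k → ⊝ x ⊛ k ⊖ + 1 ≡ ⊝ (+ 1 ⊕ x ⊛ k)
        lemma = solve-∀

unit⇒coprime : ∀ {n a} → Unit n a → Coprime (abs a) n
unit⇒coprime {n} {a} (b , e) {d} (d∣a , d∣n) = ℕ∣.∣1⇒≡1 (0≈⇒∣ (begin≈
  + 1   ≈⟨ ≈-sym (≈-weaken d∣n e) ⟩
  b ⊛ a ≈⟨ ≈-⊛ˡ b (∣⇒0≈ d∣a) ⟩
  b ⊛ + 0 ≡≈⟨ ℤ.*-zeroʳ b ⟩
  + 0 ∎≈))
  where open ≈-Reasoning d

module _ {p : ℕ} (pp : Prime p) where

  euclid : ∀ x y → x ⊛ y ≈ + 0 [ p ] → x ≈ + 0 [ p ] ⊎ y ≈ + 0 [ p ]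
  euclid x y e with Prime.euclidsLemma (abs x) (abs y) pp (subst (p ∣_) (ℤ.abs-* x y) (0≈⇒∣ e))
  ... | inj₁ d = inj₁ (∣⇒0≈ d)
  ... | inj₂ d = inj₂ (∣⇒0≈ d)

  1≉0 : ¬ + 1 ≈ + 0 [ p ]
  1≉0 e = Prime.¬prime[1] (subst Prime (ℕ∣.∣1⇒≡1 (0≈⇒∣ e)) pp)

  ≉0⇒unit : ∀ {a} → ¬ a ≈ + 0 [ p ] → Unit p a
  ≉0⇒unit {a} h = let b , e = coprime⇒unit (abs a) coprime in lift a b e
    where
    coprime : Coprime (abs a) p
    coprime {d} (d∣a , d∣p) with Prime.prime⇒irreducible pp d∣p
    ... | inj₁ refl = refl
    ... | inj₂ refl = contradiction (∣⇒0≈ d∣a) h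
    lift : ∀ a b → b ⊛ + abs a ≈ + 1 [ p ] → Unit p a
    lift (+ k)      b e = b , e
    lift -[1+ k ]   b e = ⊝ b , ≈-trans (≈-reflexive (neg-neg b (+ suc k))) e
      where neg-neg : ∀ b k → ⊝ b ⊛ ⊝ k ≡ b ⊛ k
            neg-neg = solve-∀

  ↑≉0 : ∀ {a} k → ¬ a ≈ + 0 [ p ] → ¬ a ↑ k ≈ + 0 [ p ]
  ↑≉0 zero    h e = 1≉0 e
  ↑≉0 {a} (suc k) h e with euclid a (a ↑ k) e
  ... | inj₁ f = h f
  ... | inj₂ f = ↑≉0 k h f

-- Polynomials acting on sequences

Seq : Set
Seq = ℕ → ℤ

shift : ℕ → Seq → Seq
shift zero    f k       = f k
shift (suc s) f zero    = + 0
shift (suc s) f (suc k) = shift s f k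

shift-cong : ∀ s {f g : Seq} → f ≗ g → shift s f ≗ shift s g
shift-cong zero    h k       = h k
shift-cong (suc s) h zero    = refl
shift-cong (suc s) h (suc k) = shift-cong s h k

shift-linear : ∀ s c (f g : Seq) → shift s (λ k → c ⊛ f k ⊕ g k) ≗ λ k → c ⊛ shift s f k ⊕ shift s g k
shift-linear zero    c f g k       = refl
shift-linear (suc s) c f g zero    = sym (trans (ℤ.+-identityʳ _) (ℤ.*-zeroʳ c))
shift-linear (suc s) c f g (suc k) = shift-linear s c f g k

shift-0 : ∀ s → shift s (λ _ → + 0) ≗ λ _ → + 0
shift-0 zero    k       = refl
shift-0 (suc s) zero    = refl
shift-0 (suc s) (suc k) = shift-0 s k

infixr 7 _•_
-- Convolution: `p • f` is the coefficient sequence of the product of p with the power series of f.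
-- A counting sequence can thus be multiplied by a polynomial without being written as one.
_•_ : Poly → Seq → Seq
([]      • f) k = + 0
((a ∷ p) • f) k = a ⊛ f k ⊕ shift 1 (p • f) k

coeff-+P : ∀ p q k → coeff k (p +P q) ≡ coeff k p ⊕ coeff k q
coeff-+P []      q       k       = sym (ℤ.+-identityˡ _)
coeff-+P (a ∷ p) []      k       = sym (ℤ.+-identityʳ _)
coeff-+P (a ∷ p) (b ∷ q) zero    = refl
coeff-+P (a ∷ p) (b ∷ q) (suc k) = coeff-+P p q k

coeff-scaleP : ∀ c p k → coeff k (scaleP c p) ≡ c ⊛ coeff k p
coeff-scaleP c []      k       = sym (ℤ.*-zeroʳ c)
coeff-scaleP c (a ∷ p) zero    = refl
coeff-scaleP c (a ∷ p) (suc k) = coeff-scaleP c p k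

coeff-sumP : ∀ {A : Set} (xs : List A) (f : A → Poly) k → coeff k (sumP (map f xs)) ≡ (∑[ x ← xs ] coeff k (f x))
coeff-sumP []       f k = refl
coeff-sumP (x ∷ xs) f k = trans (coeff-+P (f x) _ k) (cong (coeff k (f x) ⊕_) (coeff-sumP xs f k))

coeff-*P : ∀ p q → (λ k → coeff k (p *P q)) ≗ p • λ k → coeff k q
coeff-*P []      q k = refl
coeff-*P (a ∷ p) q k = trans (coeff-+P (scaleP a q) _ k) (cong₂ _⊕_ (coeff-scaleP a q k) (tail k))
  where
  tail : (λ k → coeff k (+ 0 ∷ (p *P q))) ≗ shift 1 (p • λ k → coeff k q)
  tail zero    = refl
  tail (suc k) = coeff-*P p q k

•-cong : ∀ p {f g : Seq} → f ≗ g → p • f ≗ p • g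
•-cong []      h k = refl
•-cong (a ∷ p) h k = cong₂ (λ x y → a ⊛ x ⊕ y) (h k) (shift-cong 1 (•-cong p h) k)

•-+P : ∀ p q (f : Seq) → (p +P q) • f ≗ λ k → (p • f) k ⊕ (q • f) k
•-+P []      q       f k = sym (ℤ.+-identityˡ _)
•-+P (a ∷ p) []      f k = sym (ℤ.+-identityʳ _)
•-+P (a ∷ p) (b ∷ q) f k = begin
  (a ⊕ b) ⊛ f k ⊕ shift 1 ((p +P q) • f) k
    ≡⟨ cong ((a ⊕ b) ⊛ f k ⊕_) (shift-cong 1 (λ k → trans (•-+P p q f k) (cong (_⊕ (q • f) k) (sym (ℤ.*-identityˡ ((p • f) k))))) k) ⟩
  (a ⊕ b) ⊛ f k ⊕ shift 1 (λ k → + 1 ⊛ (p • f) k ⊕ (q • f) k) k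
    ≡⟨ cong ((a ⊕ b) ⊛ f k ⊕_) (shift-linear 1 (+ 1) (p • f) (q • f) k) ⟩
  (a ⊕ b) ⊛ f k ⊕ (+ 1 ⊛ shift 1 (p • f) k ⊕ shift 1 (q • f) k)
    ≡⟨ lemma a b (f k) _ _ ⟩
  a ⊛ f k ⊕ shift 1 (p • f) k ⊕ (b ⊛ f k ⊕ shift 1 (q • f) k) ∎
  where
  open ≡-Reasoning
  lemma : ∀ a b x y z → (a ⊕ b) ⊛ x ⊕ (+ 1 ⊛ y ⊕ z) ≡ a ⊛ x ⊕ y ⊕ (b ⊛ x ⊕ z)
  lemma = solve-∀

•-scaleP : ∀ c p (f : Seq) → scaleP c p • f ≗ λ k → c ⊛ (p • f) k
•-scaleP c []      f k = sym (ℤ.*-zeroʳ c)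
•-scaleP c (a ∷ p) f k = begin
  c ⊛ a ⊛ f k ⊕ shift 1 (scaleP c p • f) k
    ≡⟨ cong (c ⊛ a ⊛ f k ⊕_) (shift-cong 1 (λ k → trans (•-scaleP c p f k) (sym (ℤ.+-identityʳ _))) k) ⟩
  c ⊛ a ⊛ f k ⊕ shift 1 (λ k → c ⊛ (p • f) k ⊕ + 0) k
    ≡⟨ cong (c ⊛ a ⊛ f k ⊕_) (trans (shift-linear 1 c (p • f) _ k) (cong (c ⊛ shift 1 (p • f) k ⊕_) (shift-0 1 k))) ⟩
  c ⊛ a ⊛ f k ⊕ (c ⊛ shift 1 (p • f) k ⊕ + 0)
    ≡⟨ lemma c a (f k) _ ⟩
  c ⊛ (a ⊛ f k ⊕ shift 1 (p • f) k) ∎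
  where
  open ≡-Reasoning
  lemma : ∀ c a x y → c ⊛ a ⊛ x ⊕ (c ⊛ y ⊕ + 0) ≡ c ⊛ (a ⊛ x ⊕ y)
  lemma = solve-∀

•-0∷ : ∀ p (f : Seq) → (+ 0 ∷ p) • f ≗ shift 1 (p • f)
•-0∷ p f k = ℤ.+-identityˡ _

•-*P : ∀ p q (f : Seq) → (p *P q) • f ≗ p • q • f
•-*P []      q f k = refl
•-*P (a ∷ p) q f k = trans (•-+P (scaleP a q) (+ 0 ∷ (p *P q)) f k)
  (cong₂ _⊕_ (•-scaleP a q f k) (trans (•-0∷ (p *P q) f k) (shift-cong 1 (•-*P p q f) k)))

•-oneP : ∀ (f : Seq) → oneP • f ≗ f
•-oneP f k = trans (cong₂ _⊕_ (ℤ.*-identityˡ (f k)) (trans (shift-cong 1 (λ _ → refl) k) (shift-0 1 k))) (ℤ.+-identityʳ (f k))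

•-monoP : ∀ s (f : Seq) → monoP s • f ≗ shift s f
•-monoP zero    f k       = •-oneP f k
•-monoP (suc s) f zero    = •-0∷ (monoP s) f zero
•-monoP (suc s) f (suc k) = trans (•-0∷ (monoP s) f (suc k)) (•-monoP s f k)

•-binomial : ∀ s (f : Seq) k → ((oneP +P monoP s) • f) k ≡ f k ⊕ shift s f k
•-binomial s f k = trans (•-+P oneP (monoP s) f k) (cong₂ _⊕_ (•-oneP f k) (•-monoP s f k))

-- Closed subsets of an equivalence relation

⟪_⟫ : ∀ {n} {P : Fin n → Set} → (∀ x → Dec (P x)) → Subset n
⟪ P? ⟫ = tabulate (does ∘ P?)

module _ {n} {P : Fin n → Set} (P? : ∀ x → Dec (P x)) where

  ∈⟪⟫⁺ : ∀ {x} → P x → x ∈ ⟪ P? ⟫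
  ∈⟪⟫⁺ {x} p = Vec.lookup⇒[]= x _ (trans (Vec.lookup∘tabulate (does ∘ P?) x) (dec-true (P? x) p))

  ∈⟪⟫⁻ : ∀ {x} → x ∈ ⟪ P? ⟫ → P x
  ∈⟪⟫⁻ {x} m with P? x | trans (sym (Vec.[]=⇒lookup m)) (Vec.lookup∘tabulate (does ∘ P?) x)
  ... | yes p | _ = p
  ... | no _  | ()

∈─⇒∉ : ∀ {n x} (p q : Subset n) → x ∈ p ─ q → x ∉ q
∈─⇒∉ (x ∷ p) (true ∷ q) () here
∈─⇒∉ (_ ∷ p) (_ ∷ q) (there m) (there k) = ∈─⇒∉ p q m k

card : ∀ {n} (S : Subset n) → + ∣ S ∣ ≡ (∑[ x ← allFin n ] 𝟙 (x ∈? S))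
card {zero}  []      = refl
card {suc n} (b ∷ S) = trans (head b) (sym (trans (∑-allFin-suc n (λ x → 𝟙 (x ∈? (b ∷ S)))) (cong (𝟙 (Fin.zero ∈? (b ∷ S)) ⊕_)
    (trans (∑-cong (allFin n) λ x → 𝟙-cong (Fin.suc x ∈? (b ∷ S)) (x ∈? S) Subset.drop-there there) (sym (card S))))))
  where
  head : ∀ b → + ∣ b ∷ S ∣ ≡ 𝟙 (Fin.zero ∈? (b ∷ S)) ⊕ + ∣ S ∣
  head true  = refl
  head false = refl

card-⟪⟫ : ∀ {n} {P : Fin n → Set} (P? : ∀ x → Dec (P x)) → + ∣ ⟪ P? ⟫ ∣ ≡ (∑[ x ← allFin n ] 𝟙 (P? x))
card-⟪⟫ P? = trans (card ⟪ P? ⟫) (∑-cong (allFin _) λ x → 𝟙-cong (x ∈? ⟪ P? ⟫) (P? x) (∈⟪⟫⁻ P?) (∈⟪⟫⁺ P?))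

card-∪ : ∀ {n} (A B : Subset n) → (∀ x → x ∈ A → x ∉ B) → ∣ A ∪ B ∣ ≡ ∣ A ∣ + ∣ B ∣
card-∪ []          []          h = refl
card-∪ (true ∷ A)  (true ∷ B)  h = contradiction here (h Fin.zero here)
card-∪ (true ∷ A)  (false ∷ B) h = cong suc (card-∪ A B λ x m k → h _ (there m) (there k))
card-∪ (false ∷ A) (true ∷ B)  h = trans (cong suc (card-∪ A B λ x m k → h _ (there m) (there k))) (sym (ℕ.+-suc _ _))
card-∪ (false ∷ A) (false ∷ B) h = card-∪ A B λ x m k → h _ (there m) (there k)

-- Multiplying a generating function by x^s adds s to every size.
shift-count : ∀ {A : Set} (xs : List A) {Q : A → Set} (Q? : ∀ x → Dec (Q x)) (size : A → ℕ) s k →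
  shift s (λ k → ∑[ x ← xs ] 𝟙 (Q? x ×-dec (size x ℕ.≟ k))) k ≡ (∑[ x ← xs ] 𝟙 (Q? x ×-dec (s + size x ℕ.≟ k)))
shift-count xs Q? size zero    k       = refl
shift-count xs Q? size (suc s) zero    = sym (∑-0 xs λ x → 𝟙-no (Q? x ×-dec (suc s + size x ℕ.≟ 0)) λ ())
shift-count xs Q? size (suc s) (suc k) = trans (shift-count xs Q? size s k) (∑-cong xs λ x →
  𝟙-cong (Q? x ×-dec (s + size x ℕ.≟ k)) (Q? x ×-dec (suc s + size x ℕ.≟ suc k))
    (λ (q , e) → q , cong suc e) (λ (q , e) → q , ℕ.suc-injective e))

module Classes {n : ℕ} (_~_ : Fin n → Fin n → Set) (_~?_ : ∀ x y → Dec (x ~ y))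
  (~-refl : ∀ x → x ~ x) (~-sym : ∀ {x y} → x ~ y → y ~ x) (~-trans : ∀ {x y z} → x ~ y → y ~ z → x ~ z) where

  class : Fin n → Subset n
  class x = ⟪ x ~?_ ⟫

  Closed : Subset n → Set
  Closed S = ∀ x y → x ~ y → x ∈ S → y ∈ S

  closed? : ∀ S → Dec (Closed S)
  closed? S = Fin.all? λ x → Fin.all? λ y → (x ~? y) →-dec ((x ∈? S) →-dec (y ∈? S))

  closedIn? : ∀ X Ω → Dec (Closed Ω × Ω ⊆ X)
  closedIn? X Ω = closed? Ω ×-dec (Ω ⊆? X)

  countClosed : Subset n → Seq
  countClosed X k = ∑[ Ω ← allSubsets n ] 𝟙 (closedIn? X Ω ×-dec (∣ Ω ∣ ℕ.≟ k))

  ─-closed : ∀ {S} x → Closed S → Closed (S ─ class x)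
  ─-closed {S} x h y z e m = Subset.x∈p∧x∉q⇒x∈p─q (h y z e (Subset.p─q⊆p S (class x) m))
    λ k → ∈─⇒∉ S (class x) m (∈⟪⟫⁺ (x ~?_) (~-trans (∈⟪⟫⁻ (x ~?_) k) (~-sym e)))

  ∪-class-closed : ∀ {S} x → Closed S → Closed (S ∪ class x)
  ∪-class-closed {S} x h y z e m with Subset.x∈p∪q⁻ S (class x) m
  ... | inj₁ k = Subset.x∈p∪q⁺ (inj₁ (h y z e k))
  ... | inj₂ k = Subset.x∈p∪q⁺ {p = S} (inj₂ (∈⟪⟫⁺ (x ~?_) (~-trans (∈⟪⟫⁻ (x ~?_) k) e)))

  class-⊆ : ∀ {S x} → Closed S → x ∈ S → class x ⊆ S
  class-⊆ {S} {x} h m k = h x _ (∈⟪⟫⁻ (x ~?_) k) m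

  x∈class : ∀ x → x ∈ class x
  x∈class x = ∈⟪⟫⁺ (x ~?_) (~-refl x)

  ─∪-class : ∀ {S x} → Closed S → x ∈ S → (S ─ class x) ∪ class x ≡ S
  ─∪-class {S} {x} h m = Subset.⊆-antisym
      (λ k → [ Subset.p─q⊆p S (class x) , class-⊆ h m ]′ (Subset.x∈p∪q⁻ (S ─ class x) (class x) k))
      (λ {y} k → Subset.x∈p∪q⁺ (decide y k (y ∈? class x)))
    where decide : ∀ y → y ∈ S → Dec (y ∈ class x) → y ∈ S ─ class x ⊎ y ∈ class x
          decide y k (yes c) = inj₂ c
          decide y k (no c)  = inj₁ (Subset.x∈p∧x∉q⇒x∈p─q k c)

  ∪─-class : ∀ {S x} → (∀ y → y ∈ S → y ∉ class x) → (S ∪ class x) ─ class x ≡ S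
  ∪─-class {S} {x} h = Subset.⊆-antisym
    (λ k → [ id , (λ c → contradiction c (∈─⇒∉ (S ∪ class x) (class x) k)) ]′
             (Subset.x∈p∪q⁻ S (class x) (Subset.p─q⊆p _ (class x) k)))
    (λ k → Subset.x∈p∧x∉q⇒x∈p─q (Subset.x∈p∪q⁺ (inj₁ k)) (h _ k))

  -- A closed set either misses the class of x or contains all of it.
  countClosed-remove : ∀ {X x} → Closed X → x ∈ X →
    countClosed X ≗ λ k → countClosed (X ─ class x) k ⊕ shift ∣ class x ∣ (countClosed (X ─ class x)) k
  countClosed-remove {X} {x} hX m k = begin
    countClosed X k
      ≡⟨ ∑-cong (allSubsets n) (λ Ω → split (all? Ω) (x ∈? Ω)) ⟩
    (∑[ Ω ← allSubsets n ] (𝟙 (all? Ω ×-dec ¬? (x ∈? Ω)) ⊕ 𝟙 (all? Ω ×-dec (x ∈? Ω))))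
      ≡⟨ ∑-⊕ (allSubsets n) _ _ ⟩
    (∑[ Ω ← allSubsets n ] 𝟙 (all? Ω ×-dec ¬? (x ∈? Ω))) ⊕ (∑[ Ω ← allSubsets n ] 𝟙 (all? Ω ×-dec (x ∈? Ω)))
      ≡⟨ cong₂ _⊕_ (∑-cong (allSubsets n) λ Ω → 𝟙-cong (all? Ω ×-dec ¬? (x ∈? Ω)) (closedIn? X′ Ω ×-dec (∣ Ω ∣ ℕ.≟ k)) miss miss⁻) hit ⟩
    countClosed X′ k ⊕ (∑[ Ω ← allSubsets n ] 𝟙 (closedIn? X′ Ω ×-dec (∣ class x ∣ + ∣ Ω ∣ ℕ.≟ k)))
      ≡⟨ cong (countClosed X′ k ⊕_) (sym (shift-count (allSubsets n) (closedIn? X′) ∣_∣ ∣ class x ∣ k)) ⟩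
    countClosed X′ k ⊕ shift ∣ class x ∣ (countClosed X′) k ∎
    where
    open ≡-Reasoning
    X′ : Subset n
    X′ = X ─ class x
    all? : ∀ Ω → Dec ((Closed Ω × Ω ⊆ X) × ∣ Ω ∣ ≡ k)
    all? Ω = closedIn? X Ω ×-dec (∣ Ω ∣ ℕ.≟ k)
    split : ∀ {P Q : Set} (p : Dec P) (q : Dec Q) → 𝟙 p ≡ 𝟙 (p ×-dec ¬? q) ⊕ 𝟙 (p ×-dec q)
    split (yes _) (yes _) = refl
    split (yes _) (no _)  = refl
    split (no _)  _       = refl
    miss : ∀ {Ω} → ((Closed Ω × Ω ⊆ X) × ∣ Ω ∣ ≡ k) × x ∉ Ω → (Closed Ω × Ω ⊆ X′) × ∣ Ω ∣ ≡ k
    miss (((c , s) , e) , h) = (c , λ q → Subset.x∈p∧x∉q⇒x∈p─q (s q) λ r → h (c _ x (~-sym (∈⟪⟫⁻ (x ~?_) r)) q)) , e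
    miss⁻ : ∀ {Ω} → (Closed Ω × Ω ⊆ X′) × ∣ Ω ∣ ≡ k → ((Closed Ω × Ω ⊆ X) × ∣ Ω ∣ ≡ k) × x ∉ Ω
    miss⁻ ((c , s) , e) = ((c , λ q → Subset.p─q⊆p X (class x) (s q)) , e) , λ q → ∈─⇒∉ X (class x) (s q) (x∈class x)
    hit : (∑[ Ω ← allSubsets n ] 𝟙 (all? Ω ×-dec (x ∈? Ω))) ≡
          (∑[ Ω ← allSubsets n ] 𝟙 (closedIn? X′ Ω ×-dec (∣ class x ∣ + ∣ Ω ∣ ℕ.≟ k)))
    hit = count-bij (subsetFinite n) (subsetFinite n) (λ Ω → all? Ω ×-dec (x ∈? Ω))
      (λ Ω → closedIn? X′ Ω ×-dec (∣ class x ∣ + ∣ Ω ∣ ℕ.≟ k)) (_─ class x) (_∪ class x)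
      (λ Ω (((c , s) , e) , q) →
        ((─-closed x c , λ r → Subset.x∈p∧x∉q⇒x∈p─q (s (Subset.p─q⊆p Ω (class x) r)) (∈─⇒∉ Ω (class x) r)) ,
         trans (ℕ.+-comm ∣ class x ∣ _) (trans (sym (card-∪ (Ω ─ class x) (class x) λ y → ∈─⇒∉ Ω (class x)))
           (trans (cong ∣_∣ (─∪-class c q)) e))) ,
        ─∪-class c q)
      (λ Ω ((c , s) , e) →
        let disj = λ y r → ∈─⇒∉ X (class x) (s {y} r) in
        (((∪-class-closed x c , λ r → [ (λ t → Subset.p─q⊆p X (class x) (s t)) , class-⊆ hX m ]′ (Subset.x∈p∪q⁻ Ω (class x) r)) ,
          trans (card-∪ Ω (class x) disj) (trans (ℕ.+-comm ∣ Ω ∣ _) e)) ,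
         Subset.x∈p∪q⁺ {p = Ω} (inj₂ (x∈class x))) ,
        ∪─-class disj)

  -- Each class removed from A contributes a factor 1 + x^α by `countClosed-remove`; e is the number
  -- of classes removed, hence |A| = e α. The recursion is on a bound for |A|, because `A ─ class x`
  -- is smaller only in cardinality.
  countClosed-∪ : ∀ α → 1 ≤ α → ∀ fuel A B → ∣ A ∣ ≤ fuel → Closed A → Closed B → (∀ x → x ∈ A → x ∉ B) →
    (∀ x → x ∈ A → ∣ class x ∣ ≡ α) →
    Σ ℕ λ e → ∣ A ∣ ≡ e * α × countClosed (A ∪ B) ≗ ((oneP +P monoP α) ^P e) • countClosed B
  countClosed-∪ α pos fuel A B le cA cB disj size with Subset.nonempty? A
  ... | no ¬m = 0 , trans (cong ∣_∣ A≡⊥) (Subset.∣⊥∣≡0 n) ,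
          λ k → trans (cong (λ S → countClosed S k) (trans (cong (_∪ B) A≡⊥) (Subset.∪-identityˡ B))) (sym (•-oneP (countClosed B) k))
    where A≡⊥ = Subset.Empty-unique ¬m
  countClosed-∪ α pos zero A B le cA cB disj size | yes (x , m) =
    -- A nonempty A contains a class, which has α ≥ 1 elements, so the bound on |A| cannot be 0.
    contradiction (ℕ.≤-trans (subst (1 ≤_) (sym (size x m)) pos) (ℕ.≤-trans (Subset.p⊆q⇒∣p∣≤∣q∣ (class-⊆ cA m)) le)) λ ()
  countClosed-∪ α pos (suc fuel) A B le cA cB disj size | yes (x , m) =
      suc e , trans (sym card-A) (cong₂ _+_ (size x m) |A′|) , λ k → begin
        countClosed (A ∪ B) k
          ≡⟨ countClosed-remove closed-∪ (Subset.x∈p∪q⁺ (inj₁ m)) k ⟩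
        countClosed ((A ∪ B) ─ class x) k ⊕ shift ∣ class x ∣ (countClosed ((A ∪ B) ─ class x)) k
          ≡⟨ cong₂ (λ S s → countClosed S k ⊕ shift s (countClosed S) k) remaining (size x m) ⟩
        countClosed (A′ ∪ B) k ⊕ shift α (countClosed (A′ ∪ B)) k
          ≡⟨ •-binomial α (countClosed (A′ ∪ B)) k ⟨
        ((oneP +P monoP α) • countClosed (A′ ∪ B)) k
          ≡⟨ •-cong (oneP +P monoP α) gf k ⟩
        ((oneP +P monoP α) • ((oneP +P monoP α) ^P e) • countClosed B) k
          ≡⟨ •-*P (oneP +P monoP α) _ (countClosed B) k ⟨
        (((oneP +P monoP α) ^P suc e) • countClosed B) k ∎
    where
    open ≡-Reasoning
    A′ : Subset n
    A′ = A ─ class x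
    closed-∪ : Closed (A ∪ B)
    closed-∪ y z r q = Subset.x∈p∪q⁺ ([ (λ t → inj₁ (cA y z r t)) , (λ t → inj₂ (cB y z r t)) ]′ (Subset.x∈p∪q⁻ A B q))
    card-A : ∣ class x ∣ + ∣ A′ ∣ ≡ ∣ A ∣
    card-A = trans (ℕ.+-comm ∣ class x ∣ _) (trans (sym (card-∪ A′ (class x) λ y → ∈─⇒∉ A (class x))) (cong ∣_∣ (─∪-class cA m)))
    le′ : ∣ A′ ∣ ≤ fuel
    le′ = ℕ.≤-pred (ℕ.≤-trans (ℕ.+-monoˡ-≤ ∣ A′ ∣ (subst (1 ≤_) (sym (size x m)) pos)) (subst (_≤ suc fuel) (sym card-A) le))
    IH = countClosed-∪ α pos fuel A′ B le′ (─-closed x cA) cB (λ y q → disj y (Subset.p─q⊆p A (class x) q))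
           (λ y q → size y (Subset.p─q⊆p A (class x) q))
    e = proj₁ IH
    |A′| = proj₁ (proj₂ IH)
    gf = proj₂ (proj₂ IH)
    -- The class of x lies in A, hence is disjoint from B, and its removal leaves B as it was.
    remaining : (A ∪ B) ─ class x ≡ A′ ∪ B
    remaining = Subset.⊆-antisym
      (λ q → Subset.x∈p∪q⁺ ([ (λ t → inj₁ (Subset.x∈p∧x∉q⇒x∈p─q t (∈─⇒∉ (A ∪ B) (class x) q))) , inj₂ ]′
               (Subset.x∈p∪q⁻ A B (Subset.p─q⊆p (A ∪ B) (class x) q))))
      (λ q → [ (λ t → Subset.x∈p∧x∉q⇒x∈p─q (Subset.x∈p∪q⁺ (inj₁ (Subset.p─q⊆p A (class x) t))) (∈─⇒∉ A (class x) t)) ,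
               (λ t → Subset.x∈p∧x∉q⇒x∈p─q (Subset.x∈p∪q⁺ {p = A} (inj₂ t)) λ c → disj _ (class-⊆ cA m c) t) ]′
             (Subset.x∈p∪q⁻ A′ B q))

-- ε = −1 gives the orbits relevant to symmetric sets; ε = 1 gives those of a alone, for Lagrange's theorem.
module Cyclic {n : ℕ} .{{_ : NonZero n}} (a ε : ℤ) (ε² : ε ⊛ ε ≈ + 1 [ n ])
  (J : ℕ) .{{_ : NonZero J}} (a^J : a ↑ J ≈ + 1 [ n ]) where

  open ≈-Reasoning n

  sgn : Bool → ℤ
  sgn false = + 1
  sgn true  = ε

  infix 4 _~_
  -- Lying in one orbit of the group generated by a and ε. Natural exponents reach the inverses as
  -- well, since a^J = 1.
  _~_ : Fin n → Fin n → Set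
  x ~ y = Σ Bool λ s → Σ ℕ λ j → ⟦ y ⟧ ≈ sgn s ⊛ (a ↑ j ⊛ ⟦ x ⟧) [ n ]

  ↑-periodic : ∀ {E z} → a ↑ E ⊛ z ≈ z [ n ] → ∀ q r → a ↑ (r + q * E) ⊛ z ≈ a ↑ r ⊛ z [ n ]
  ↑-periodic {E} {z} h zero    r = ≈-reflexive (cong (λ k → a ↑ k ⊛ z) (ℕ.+-identityʳ r))
  ↑-periodic {E} {z} h (suc q) r = begin≈
    a ↑ (r + (E + q * E)) ⊛ z   ≡≈⟨ cong (λ k → a ↑ k ⊛ z) (trans (cong (λ z → r + z) (ℕ.+-comm E _)) (sym (ℕ.+-assoc r _ E))) ⟩
    a ↑ (r + q * E + E) ⊛ z     ≡≈⟨ trans (cong (_⊛ z) (↑-+ a (r + q * E) E)) (ℤ.*-assoc (a ↑ (r + q * E)) (a ↑ E) z) ⟩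
    a ↑ (r + q * E) ⊛ (a ↑ E ⊛ z) ≈⟨ ≈-⊛ˡ (a ↑ (r + q * E)) h ⟩
    a ↑ (r + q * E) ⊛ z         ≈⟨ ↑-periodic h q r ⟩
    a ↑ r ⊛ z ∎≈

  ↑-% : ∀ {E z} .{{_ : NonZero E}} → a ↑ E ⊛ z ≈ z [ n ] → ∀ j → a ↑ j ⊛ z ≈ a ↑ (j % E) ⊛ z [ n ]
  ↑-% {E} {z} h j = ≈-trans (≈-reflexive (cong (λ k → a ↑ k ⊛ z) (ℕ/.m≡m%n+[m/n]*n j E))) (↑-periodic h (j / E) (j % E))

  J-period : ∀ z → a ↑ J ⊛ z ≈ z [ n ]
  J-period z = ≈-trans (≈-⊛ʳ z a^J) (≈-reflexive (ℤ.*-identityˡ z))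

  -- (J - 1) j + j = J j, so a to this exponent is the inverse of a^j.
  inv : ℕ → ℕ
  inv j = (J ∸ 1) * j

  inv-↑ : ∀ j → a ↑ inv j ⊛ a ↑ j ≈ + 1 [ n ]
  inv-↑ j = begin≈
    a ↑ inv j ⊛ a ↑ j        ≡≈⟨ sym (↑-+ a (inv j) j) ⟩
    a ↑ ((J ∸ 1) * j + j)    ≡≈⟨ cong (a ↑_) (trans (ℕ.+-comm _ j) (trans (cong (_* j) (ℕ.suc-pred J)) (ℕ.*-comm J j))) ⟩
    a ↑ (j * J)              ≡≈⟨ sym (ℤ.*-identityʳ _) ⟩
    a ↑ (0 + j * J) ⊛ + 1    ≈⟨ ↑-periodic (J-period (+ 1)) j 0 ⟩
    + 1 ⊛ + 1                ≡≈⟨ refl ⟩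
    + 1 ∎≈

  unit-a↑ : ∀ j → Unit n (a ↑ j)
  unit-a↑ j = a ↑ inv j , inv-↑ j

  sgn² : ∀ s → sgn s ⊛ sgn s ≈ + 1 [ n ]
  sgn² false = ≈-refl
  sgn² true  = ε²

  sgn-xor : ∀ s t → Σ Bool λ u → sgn s ⊛ sgn t ≈ sgn u [ n ]
  sgn-xor false t     = t , ≈-reflexive (ℤ.*-identityˡ _)
  sgn-xor true  false = true , ≈-reflexive (ℤ.*-identityʳ _)
  sgn-xor true  true  = false , ε²

  ~-refl : ∀ x → x ~ x
  ~-refl x = false , 0 , ≈-reflexive (sym (trans (ℤ.*-identityˡ _) (ℤ.*-identityˡ ⟦ x ⟧)))

  ~-sym : ∀ {x y} → x ~ y → y ~ x
  ~-sym {x} {y} (s , j , e) = s , inv j , (begin≈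
    ⟦ x ⟧                                          ≡≈⟨ lemma₀ ⟦ x ⟧ ⟩
    + 1 ⊛ + 1 ⊛ ⟦ x ⟧                              ≈⟨ ≈-⊛ʳ ⟦ x ⟧ (≈-⊛ (≈-sym (sgn² s)) (≈-sym (inv-↑ j))) ⟩
    sgn s ⊛ sgn s ⊛ (a ↑ inv j ⊛ a ↑ j) ⊛ ⟦ x ⟧    ≡≈⟨ lemma (sgn s) (a ↑ inv j) (a ↑ j) ⟦ x ⟧ ⟩
    sgn s ⊛ (a ↑ inv j ⊛ (sgn s ⊛ (a ↑ j ⊛ ⟦ x ⟧))) ≈⟨ ≈-⊛ˡ (sgn s) (≈-⊛ˡ (a ↑ inv j) (≈-sym e)) ⟩
    sgn s ⊛ (a ↑ inv j ⊛ ⟦ y ⟧) ∎≈)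
    where lemma₀ : ∀ x → x ≡ + 1 ⊛ + 1 ⊛ x
          lemma₀ = solve-∀
          lemma : ∀ s b c x → s ⊛ s ⊛ (b ⊛ c) ⊛ x ≡ s ⊛ (b ⊛ (s ⊛ (c ⊛ x)))
          lemma = solve-∀

  ~-trans : ∀ {x y z} → x ~ y → y ~ z → x ~ z
  ~-trans {x} {y} {z} (s , j , e) (t , k , f) with sgn-xor t s
  ... | u , g = u , k + j , (begin≈
    ⟦ z ⟧                                        ≈⟨ f ⟩
    sgn t ⊛ (a ↑ k ⊛ ⟦ y ⟧)                      ≈⟨ ≈-⊛ˡ (sgn t) (≈-⊛ˡ (a ↑ k) e) ⟩
    sgn t ⊛ (a ↑ k ⊛ (sgn s ⊛ (a ↑ j ⊛ ⟦ x ⟧)))  ≡≈⟨ lemma (sgn t) (a ↑ k) (sgn s) (a ↑ j) ⟦ x ⟧ ⟩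
    sgn t ⊛ sgn s ⊛ (a ↑ k ⊛ a ↑ j ⊛ ⟦ x ⟧)      ≈⟨ ≈-⊛ g (≈-reflexive (cong (_⊛ ⟦ x ⟧) (sym (↑-+ a k j)))) ⟩
    sgn u ⊛ (a ↑ (k + j) ⊛ ⟦ x ⟧) ∎≈)
    where lemma : ∀ t b s c x → t ⊛ (b ⊛ (s ⊛ (c ⊛ x))) ≡ t ⊛ s ⊛ (b ⊛ c ⊛ x)
          lemma = solve-∀

  -- The first E points of the orbit of x under a, multiplied by 1 or ε. For E = `J` this finite
  -- search decides `_~_`; for E the exact period of x, the arcs with the two signs are the pieces
  -- from which the class of x is measured.
  module Arc (x : Fin n) (s : Bool) (E : ℕ) where
    arc? : (y : Fin n) → Dec (Σ (Fin E) λ j → ⟦ y ⟧ ≈ sgn s ⊛ (a ↑ toℕ j ⊛ ⟦ x ⟧) [ n ])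
    arc? y = Fin.any? λ j → ≈? n ⟦ y ⟧ (sgn s ⊛ (a ↑ toℕ j ⊛ ⟦ x ⟧))

    arc : Subset n
    arc = ⟪ arc? ⟫

  open Arc

  ∈arc : ∀ x s E .{{_ : NonZero E}} → a ↑ E ⊛ ⟦ x ⟧ ≈ ⟦ x ⟧ [ n ] → ∀ {y} j →
    ⟦ y ⟧ ≈ sgn s ⊛ (a ↑ j ⊛ ⟦ x ⟧) [ n ] → y ∈ arc x s E
  ∈arc x s E h j e = ∈⟪⟫⁺ (arc? x s E) (fromℕ< (ℕ/.m%n<n j E) ,
    ≈-trans e (≈-⊛ˡ (sgn s) (≈-trans (↑-% h j)
      (≈-reflexive (cong (λ k → a ↑ k ⊛ ⟦ x ⟧) (sym (Fin.toℕ-fromℕ< (ℕ/.m%n<n j E))))))))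

  _~?_ : ∀ x y → Dec (x ~ y)
  x ~? y = map′ from to (arc? x false J y ⊎-dec arc? x true J y)
    where
    from : _ → x ~ y
    from (inj₁ (j , e)) = false , toℕ j , e
    from (inj₂ (j , e)) = true , toℕ j , e
    to : x ~ y → _
    to (false , j , e) = inj₁ (∈⟪⟫⁻ (arc? x false J) (∈arc x false J (J-period _) j e))
    to (true , j , e)  = inj₂ (∈⟪⟫⁻ (arc? x true J) (∈arc x true J (J-period _) j e))

  open Classes _~_ _~?_ ~-refl ~-sym ~-trans public

  -- E is the exact period of x under a. The class of x is the union of the orbit of x under a and
  -- its ε-multiple, two sets of size E that are equal or disjoint according to whether ε x is some
  -- a^c x.
  module ClassSize (x : Fin n) (E : ℕ) .{{_ : NonZero E}} (period : a ↑ E ⊛ ⟦ x ⟧ ≈ ⟦ x ⟧ [ n ])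
    (minimal : ∀ k → a ↑ k ⊛ ⟦ x ⟧ ≈ ⟦ x ⟧ [ n ] → E ∣ k) where

    sgn-cancel : ∀ s {y z} → sgn s ⊛ y ≈ sgn s ⊛ z [ n ] → y ≈ z [ n ]
    sgn-cancel s = ⊛-cancelˡ (sgn s , sgn² s)

    injective-≤ : ∀ i j → i ≤ j → j < E → a ↑ i ⊛ ⟦ x ⟧ ≈ a ↑ j ⊛ ⟦ x ⟧ [ n ] → i ≡ j
    injective-≤ i j le lt e = ℕ.≤-antisym le (ℕ.m∸n≡0⇒m≤n (∣∧<⇒≡0 (minimal (j ∸ i) (⊛-cancelˡ (unit-a↑ i) (begin≈
      a ↑ i ⊛ (a ↑ (j ∸ i) ⊛ ⟦ x ⟧)  ≡≈⟨ sym (ℤ.*-assoc (a ↑ i) _ ⟦ x ⟧) ⟩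
      a ↑ i ⊛ a ↑ (j ∸ i) ⊛ ⟦ x ⟧    ≡≈⟨ cong (_⊛ ⟦ x ⟧) (sym (↑-+ a i (j ∸ i))) ⟩
      a ↑ (i + (j ∸ i)) ⊛ ⟦ x ⟧      ≡≈⟨ cong (λ k → a ↑ k ⊛ ⟦ x ⟧) (ℕ.m+[n∸m]≡n le) ⟩
      a ↑ j ⊛ ⟦ x ⟧                  ≈⟨ ≈-sym e ⟩
      a ↑ i ⊛ ⟦ x ⟧ ∎≈))) (ℕ.≤-<-trans (ℕ.m∸n≤m j i) lt)))

    card-arc : ∀ s → ∣ arc x s E ∣ ≡ E
    card-arc s = ℤ.+-injective (trans (card-⟪⟫ (arc? x s E)) (trans
      (count-image (finFinite n) (finFinite E) (arc? x s E) point
        (λ i j e → injective i j (sgn-cancel s (≈-trans (≈-sym (⟦reduce⟧ _)) (≈-trans (≈-reflexive (cong ⟦_⟧ e)) (⟦reduce⟧ _)))))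
        (λ j → j , ⟦reduce⟧ _)
        (λ y (j , e) → j , ⟦⟧-injective (≈-trans (⟦reduce⟧ _) (≈-sym e))))
      (cong +_ (List.length-tabulate id))))
      where
      point : Fin E → Fin n
      point j = reduce (sgn s ⊛ (a ↑ toℕ j ⊛ ⟦ x ⟧))
      injective : ∀ i j → a ↑ toℕ i ⊛ ⟦ x ⟧ ≈ a ↑ toℕ j ⊛ ⟦ x ⟧ [ n ] → i ≡ j
      injective i j e with ℕ.≤-total (toℕ i) (toℕ j)
      ... | inj₁ le = Fin.toℕ-injective (injective-≤ _ _ le (Fin.toℕ<n j) e)
      ... | inj₂ le = sym (Fin.toℕ-injective (injective-≤ _ _ le (Fin.toℕ<n i) (≈-sym e)))

    -- If ε x = a^c x, then ε a^j x = a^(j + c) x, and one arc already covers the class.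
    ε-in⇒size : (∃ λ c → a ↑ c ⊛ ⟦ x ⟧ ≈ ε ⊛ ⟦ x ⟧ [ n ]) → ∣ class x ∣ ≡ E
    ε-in⇒size (c , h) = trans (cong ∣_∣ (Subset.⊆-antisym (λ m → to (∈⟪⟫⁻ (x ~?_) m)) λ m → ∈⟪⟫⁺ (x ~?_) (from (∈⟪⟫⁻ (arc? x false E) m)))) (card-arc false)
      where
      from : ∀ {y} → _ → x ~ y
      from (j , e) = false , toℕ j , e
      to : ∀ {y} → x ~ y → y ∈ arc x false E
      to (false , j , e) = ∈arc x false E period j e
      to {y} (true , j , e) = ∈arc x false E period (j + c) (begin≈
        ⟦ y ⟧                        ≈⟨ e ⟩
        ε ⊛ (a ↑ j ⊛ ⟦ x ⟧)          ≡≈⟨ lemma ε (a ↑ j) ⟦ x ⟧ ⟩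
        a ↑ j ⊛ (ε ⊛ ⟦ x ⟧)          ≈⟨ ≈-⊛ˡ (a ↑ j) (≈-sym h) ⟩
        a ↑ j ⊛ (a ↑ c ⊛ ⟦ x ⟧)      ≡≈⟨ sym (ℤ.*-assoc (a ↑ j) _ ⟦ x ⟧) ⟩
        a ↑ j ⊛ a ↑ c ⊛ ⟦ x ⟧        ≡≈⟨ cong (_⊛ ⟦ x ⟧) (sym (↑-+ a j c)) ⟩
        a ↑ (j + c) ⊛ ⟦ x ⟧          ≡≈⟨ sym (ℤ.*-identityˡ _) ⟩
        + 1 ⊛ (a ↑ (j + c) ⊛ ⟦ x ⟧) ∎≈)
        where lemma : ∀ e b x → e ⊛ (b ⊛ x) ≡ b ⊛ (e ⊛ x)
              lemma = solve-∀

    -- A common point a^i x = ε a^j x of the two arcs would give ε x = a^(i - j) x, with -j realised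
    -- by `inv`.
    ε-out⇒size : ¬ (∃ λ c → a ↑ c ⊛ ⟦ x ⟧ ≈ ε ⊛ ⟦ x ⟧ [ n ]) → ∣ class x ∣ ≡ 2 * E
    ε-out⇒size h = trans (cong ∣_∣ (Subset.⊆-antisym
        (λ m → Subset.x∈p∪q⁺ (to (∈⟪⟫⁻ (x ~?_) m)))
        (λ m → ∈⟪⟫⁺ (x ~?_) (from (Subset.x∈p∪q⁻ (arc x false E) (arc x true E) m)))))
      (trans (card-∪ (arc x false E) (arc x true E) disjoint)
        (cong₂ _+_ (card-arc false) (trans (card-arc true) (sym (ℕ.+-identityʳ E)))))
      where
      to : ∀ {y} → x ~ y → y ∈ arc x false E ⊎ y ∈ arc x true E
      to (false , j , e) = inj₁ (∈arc x false E period j e)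
      to (true , j , e)  = inj₂ (∈arc x true E period j e)
      from : ∀ {y} → y ∈ arc x false E ⊎ y ∈ arc x true E → x ~ y
      from (inj₁ m) = let j , e = ∈⟪⟫⁻ (arc? x false E) m in false , toℕ j , e
      from (inj₂ m) = let j , e = ∈⟪⟫⁻ (arc? x true E) m in true , toℕ j , e
      disjoint : ∀ y → y ∈ arc x false E → y ∉ arc x true E
      disjoint y m k = let i , e = ∈⟪⟫⁻ (arc? x false E) m ; j , f = ∈⟪⟫⁻ (arc? x true E) k in h (inv (toℕ j) + toℕ i , (begin≈
        a ↑ (inv (toℕ j) + toℕ i) ⊛ ⟦ x ⟧           ≡≈⟨ cong (_⊛ ⟦ x ⟧) (↑-+ a (inv (toℕ j)) (toℕ i)) ⟩
        a ↑ inv (toℕ j) ⊛ a ↑ toℕ i ⊛ ⟦ x ⟧         ≡≈⟨ lemma₁ (a ↑ inv (toℕ j)) _ ⟦ x ⟧ ⟩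
        a ↑ inv (toℕ j) ⊛ (+ 1 ⊛ (a ↑ toℕ i ⊛ ⟦ x ⟧)) ≈⟨ ≈-⊛ˡ (a ↑ inv (toℕ j)) (≈-trans (≈-sym e) f) ⟩
        a ↑ inv (toℕ j) ⊛ (ε ⊛ (a ↑ toℕ j ⊛ ⟦ x ⟧)) ≡≈⟨ lemma₂ (a ↑ inv (toℕ j)) ε (a ↑ toℕ j) ⟦ x ⟧ ⟩
        a ↑ inv (toℕ j) ⊛ a ↑ toℕ j ⊛ (ε ⊛ ⟦ x ⟧)   ≈⟨ ≈-⊛ʳ (ε ⊛ ⟦ x ⟧) (inv-↑ (toℕ j)) ⟩
        + 1 ⊛ (ε ⊛ ⟦ x ⟧)                           ≡≈⟨ ℤ.*-identityˡ _ ⟩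
        ε ⊛ ⟦ x ⟧ ∎≈))
        where lemma₁ : ∀ b c x → b ⊛ c ⊛ x ≡ b ⊛ (+ 1 ⊛ (c ⊛ x))
              lemma₁ = solve-∀
              lemma₂ : ∀ b e c x → b ⊛ (e ⊛ (c ⊛ x)) ≡ b ⊛ c ⊛ (e ⊛ x)
              lemma₂ = solve-∀

-- Orders and roots modulo a prime

least : {P : ℕ → Set} (P? : ∀ k → Dec (P k)) → ∀ k → P k → Σ ℕ λ m → P m × (∀ j → j < m → ¬ P j)
least {P} P? zero    p = 0 , p , λ _ ()
least {P} P? (suc k) p with P? 0
... | yes q = 0 , q , λ _ ()
... | no ¬q = let m , r , h = least (P? ∘ suc) k p in
  suc m , r , λ { zero _ → ¬q ; (suc j) (s≤s l) → h j l }

-- Among the n + 1 powers a^0, ..., a^n two agree mod n, and cancelling the smaller one gives a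
-- positive period. The least one divides every other because the remainder on division by it is
-- again a period.
order : ∀ {n} .{{_ : NonZero n}} a → Unit n a →
  Σ ℕ λ e → NonZero e × a ↑ e ≈ + 1 [ n ] × (∀ j → a ↑ j ≈ + 1 [ n ] → e ∣ j)
order {n} a u = least-period (least (λ k → (1 ℕ.≤? k) ×-dec ≈? n (a ↑ k) (+ 1)) (proj₁ period) (proj₂ period))
  where
  open ≈-Reasoning n
  return : ∀ {i j} → i < j → reduce {n} (a ↑ i) ≡ reduce (a ↑ j) → a ↑ (j ∸ i) ≈ + 1 [ n ]
  return {i} {j} i<j e = ⊛-cancelˡ (unit-↑ i u) (begin≈
    a ↑ i ⊛ a ↑ (j ∸ i)       ≡≈⟨ sym (↑-+ a i _) ⟩
    a ↑ (i + (j ∸ i))         ≡≈⟨ cong (a ↑_) (ℕ.m+[n∸m]≡n (ℕ.<⇒≤ i<j)) ⟩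
    a ↑ j                     ≈⟨ ≈-sym (⟦reduce⟧ _) ⟩
    ⟦ reduce {n} (a ↑ j) ⟧    ≡≈⟨ cong ⟦_⟧ (sym e) ⟩
    ⟦ reduce {n} (a ↑ i) ⟧    ≈⟨ ⟦reduce⟧ _ ⟩
    a ↑ i                     ≡≈⟨ sym (ℤ.*-identityʳ _) ⟩
    a ↑ i ⊛ + 1 ∎≈)
  period : ∃ λ k → 1 ≤ k × a ↑ k ≈ + 1 [ n ]
  period = let i , j , i<j , e = Fin.pigeonhole (ℕ.n<1+n n) (λ i → reduce {n} (a ↑ toℕ i)) in
    toℕ j ∸ toℕ i , ℕ.m<n⇒0<n∸m i<j , return i<j e
  least-period : (Σ ℕ λ m → (1 ≤ m × a ↑ m ≈ + 1 [ n ]) × (∀ j → j < m → ¬ (1 ≤ j × a ↑ j ≈ + 1 [ n ]))) →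
    Σ ℕ λ e → NonZero e × a ↑ e ≈ + 1 [ n ] × (∀ j → a ↑ j ≈ + 1 [ n ] → e ∣ j)
  least-period (suc m , (_ , h) , minimal) =
      suc m , _ , h , λ k e → ℕ∣.m%n≡0⇒n∣m k (suc m) (zero-rem _ (ℕ/.m%n<n k (suc m)) (rem k e))
    where
    zero-rem : ∀ r → r < suc m → a ↑ r ≈ + 1 [ n ] → r ≡ 0
    zero-rem zero    l e = refl
    zero-rem (suc r) l e = contradiction (s≤s z≤n , e) (minimal (suc r) l)
    power : ∀ q → a ↑ (q * suc m) ≈ + 1 [ n ]
    power q = ≈-trans (≈-reflexive (trans (cong (a ↑_) (ℕ.*-comm q (suc m))) (↑-* a (suc m) q)))
      (≈-trans (≈-↑ q h) (≈-reflexive (1↑ q)))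
    rem : ∀ k → a ↑ k ≈ + 1 [ n ] → a ↑ (k % suc m) ≈ + 1 [ n ]
    rem k e = begin≈
      a ↑ (k % suc m)                          ≡≈⟨ sym (ℤ.*-identityʳ _) ⟩
      a ↑ (k % suc m) ⊛ + 1                    ≈⟨ ≈-⊛ˡ (a ↑ (k % suc m)) (≈-sym (power (k / suc m))) ⟩
      a ↑ (k % suc m) ⊛ a ↑ (k / suc m * suc m) ≡≈⟨ sym (↑-+ a (k % suc m) _) ⟩
      a ↑ (k % suc m + k / suc m * suc m)      ≡≈⟨ cong (a ↑_) (sym (ℕ/.m≡m%n+[m/n]*n k (suc m))) ⟩
      a ↑ k                                    ≈⟨ e ⟩
      + 1 ∎≈

-- The vector lists the lower coefficients and the leading 1 is implicit, so its length is the
-- degree also after reduction mod p.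
monic : ∀ {e} → Vec ℤ e → ℤ → ℤ
monic []       x = + 1
monic (c ∷ cs) x = c ⊕ x ⊛ monic cs x

-- f + r g for monic f and g with deg g = deg f - 1, which is again monic.
_⊞_⊡_ : ∀ {e} → Vec ℤ (suc e) → ℤ → Vec ℤ e → Vec ℤ (suc e)
(c ∷ [])      ⊞ r ⊡ []       = c ⊕ r ∷ []
(c ∷ c′ ∷ cs) ⊞ r ⊡ (d ∷ ds) = c ⊕ r ⊛ d ∷ ((c′ ∷ cs) ⊞ r ⊡ ds)

monic-⊞ : ∀ {e} (cs : Vec ℤ (suc e)) r (ds : Vec ℤ e) x → monic (cs ⊞ r ⊡ ds) x ≡ monic cs x ⊕ r ⊛ monic ds x
monic-⊞ (c ∷ [])      r []       x = lemma c r x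
  where lemma : ∀ c r x → c ⊕ r ⊕ x ⊛ + 1 ≡ c ⊕ x ⊛ + 1 ⊕ r ⊛ + 1
        lemma = solve-∀
monic-⊞ (c ∷ c′ ∷ cs) r (d ∷ ds) x = trans (cong (λ z → c ⊕ r ⊛ d ⊕ x ⊛ z) (monic-⊞ (c′ ∷ cs) r ds x)) (lemma c r d x _ _)
  where lemma : ∀ c r d x y z → c ⊕ r ⊛ d ⊕ x ⊛ (y ⊕ r ⊛ z) ≡ c ⊕ x ⊛ y ⊕ r ⊛ (d ⊕ x ⊛ z)
        lemma = solve-∀

-- Synthetic division by x - r: if f = c + x f₀ and q₀ is the quotient of f₀, then f has the
-- quotient f₀ + r q₀.
quotient : ∀ {e} → ℤ → Vec ℤ (suc e) → Vec ℤ e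
quotient r (c ∷ [])      = []
quotient r (c ∷ c′ ∷ cs) = (c′ ∷ cs) ⊞ r ⊡ quotient r (c′ ∷ cs)

quotient-eq : ∀ {e} r (cs : Vec ℤ (suc e)) x → monic cs x ≡ (x ⊖ r) ⊛ monic (quotient r cs) x ⊕ monic cs r
quotient-eq r (c ∷ [])      x = lemma c r x
  where lemma : ∀ c r x → c ⊕ x ⊛ + 1 ≡ (x ⊖ r) ⊛ + 1 ⊕ (c ⊕ r ⊛ + 1)
        lemma = solve-∀
quotient-eq r (c ∷ c′ ∷ cs) x = begin
  c ⊕ x ⊛ f₀ x
    ≡⟨ lemma₁ c r x (f₀ x) ⟩
  c ⊕ (x ⊖ r) ⊛ f₀ x ⊕ r ⊛ f₀ x
    ≡⟨ cong (λ z → c ⊕ (x ⊖ r) ⊛ f₀ x ⊕ r ⊛ z) (quotient-eq r (c′ ∷ cs) x) ⟩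
  c ⊕ (x ⊖ r) ⊛ f₀ x ⊕ r ⊛ ((x ⊖ r) ⊛ q₀ ⊕ f₀ r)
    ≡⟨ lemma₂ c r x (f₀ x) q₀ (f₀ r) ⟩
  (x ⊖ r) ⊛ (f₀ x ⊕ r ⊛ q₀) ⊕ (c ⊕ r ⊛ f₀ r)
    ≡⟨ cong (λ z → (x ⊖ r) ⊛ z ⊕ (c ⊕ r ⊛ f₀ r)) (sym (monic-⊞ (c′ ∷ cs) r _ x)) ⟩
  (x ⊖ r) ⊛ monic ((c′ ∷ cs) ⊞ r ⊡ quotient r (c′ ∷ cs)) x ⊕ (c ⊕ r ⊛ f₀ r) ∎
  where
  open ≡-Reasoning
  f₀ = monic (c′ ∷ cs)
  q₀ = monic (quotient r (c′ ∷ cs)) x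
  lemma₁ : ∀ c r x y → c ⊕ x ⊛ y ≡ c ⊕ (x ⊖ r) ⊛ y ⊕ r ⊛ y
  lemma₁ = solve-∀
  lemma₂ : ∀ c r x y q z → c ⊕ (x ⊖ r) ⊛ y ⊕ r ⊛ ((x ⊖ r) ⊛ q ⊕ z) ≡ (x ⊖ r) ⊛ (y ⊕ r ⊛ q) ⊕ (c ⊕ r ⊛ z)
  lemma₂ = solve-∀

module _ {p : ℕ} (pp : Prime p) where

  -- After division by x minus the first root, Euclid's lemma makes the other, distinct, roots into
  -- roots of the quotient. In degree 0 the polynomial is 1 and has no root modulo a prime.
  too-many-roots : ∀ {e} (cs : Vec ℤ e) (r : Fin (suc e) → ℤ) → (∀ i j → r i ≈ r j [ p ] → i ≡ j) →
    ¬ (∀ i → monic cs (r i) ≈ + 0 [ p ])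
  too-many-roots []       r inj h = 1≉0 pp (h Fin.zero)
  too-many-roots cs@(_ ∷ _) r inj h = too-many-roots (quotient r₀ cs) (r ∘ Fin.suc)
      (λ i j e → Fin.suc-injective (inj _ _ e)) root
    where
    open ≈-Reasoning p
    r₀ = r Fin.zero
    lemma : ∀ x y → x ≡ x ⊕ y ⊕ ⊝ y
    lemma = solve-∀
    root : ∀ i → monic (quotient r₀ cs) (r (Fin.suc i)) ≈ + 0 [ p ]
    root i = [ (λ e → contradiction (inj _ _ (⊖≈0⇒≈ e)) λ ()) , id ]′ (euclid pp (r (Fin.suc i) ⊖ r₀) _ (begin≈
      (r (Fin.suc i) ⊖ r₀) ⊛ monic (quotient r₀ cs) (r (Fin.suc i))
        ≡≈⟨ lemma _ (monic cs r₀) ⟩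
      (r (Fin.suc i) ⊖ r₀) ⊛ monic (quotient r₀ cs) (r (Fin.suc i)) ⊕ monic cs r₀ ⊕ ⊝ monic cs r₀
        ≡≈⟨ cong (_⊕ ⊝ monic cs r₀) (sym (quotient-eq r₀ cs (r (Fin.suc i)))) ⟩
      monic cs (r (Fin.suc i)) ⊕ ⊝ monic cs r₀
        ≈⟨ ≈-⊕ (h (Fin.suc i)) (≈-⊝ (h Fin.zero)) ⟩
      + 0 ∎≈))

  -- Once e distinct e-th roots of unity are known they are all of them, since one more would be a
  -- root too many of x^e - 1.
  roots-of-unity : ∀ {e} .{{_ : NonZero e}} (r : Fin e → ℤ) → (∀ i j → r i ≈ r j [ p ] → i ≡ j) →
    (∀ i → r i ↑ e ≈ + 1 [ p ]) → ∀ z → z ↑ e ≈ + 1 [ p ] → Σ (Fin e) λ i → z ≈ r i [ p ]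
  roots-of-unity {suc e} r inj h z hz with Fin.any? (λ i → ≈? p z (r i))
  ... | yes found = found
  -- With the exponent written `suc e`, this vector encodes x^(e + 1) - 1.
  ... | no ¬found = contradiction roots (too-many-roots (⊝ + 1 ∷ replicate e (+ 0)) r′ inj′)
    where
    r′ : Fin (suc (suc e)) → ℤ
    r′ Fin.zero    = z
    r′ (Fin.suc i) = r i
    inj′ : ∀ i j → r′ i ≈ r′ j [ p ] → i ≡ j
    inj′ Fin.zero    Fin.zero    _ = refl
    inj′ Fin.zero    (Fin.suc j) q = contradiction (j , q) ¬found
    inj′ (Fin.suc i) Fin.zero    q = contradiction (i , ≈-sym q) ¬found
    inj′ (Fin.suc i) (Fin.suc j) q = cong Fin.suc (inj i j q)
    power : ∀ k x → monic (replicate k (+ 0)) x ≡ x ↑ k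
    power zero    x = refl
    power (suc k) x = trans (ℤ.+-identityˡ _) (cong (x ⊛_) (power k x))
    eval : ∀ x → x ↑ suc e ≈ + 1 [ p ] → monic (⊝ + 1 ∷ replicate e (+ 0)) x ≈ + 0 [ p ]
    eval x q = ≈-trans (≈-reflexive (cong (λ y → ⊝ + 1 ⊕ x ⊛ y) (power e x))) (≈-⊕ (≈-refl {x = ⊝ + 1}) q)
    roots : ∀ i → monic (⊝ + 1 ∷ replicate e (+ 0)) (r′ i) ≈ + 0 [ p ]
    roots Fin.zero    = eval z hz
    roots (Fin.suc i) = eval (r i) (h i)

  instance
    prime-nonZero : NonZero p
    prime-nonZero = Prime.prime⇒nonZero pp

  nonzero? : (x : Fin p) → Dec (¬ ⟦ x ⟧ ≈ + 0 [ p ])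
  nonzero? x = ¬? (≈? p ⟦ x ⟧ (+ 0))

  count-zero : (∑[ x ← allFin p ] 𝟙 (≈? p ⟦ x ⟧ (+ 0))) ≡ + 1
  count-zero = count-unique (finFinite p) (λ x → ≈? p ⟦ x ⟧ (+ 0)) (reduce (+ 0)) (⟦reduce⟧ (+ 0))
    λ x e → ⟦⟧-injective (≈-trans e (≈-sym (⟦reduce⟧ (+ 0))))

  count-nonzero : (∑[ x ← allFin p ] 𝟙 (nonzero? x)) ≡ + (p ∸ 1)
  count-nonzero = ⊕-cancelˡ (+ 1) (begin
    + 1 ⊕ (∑[ x ← allFin p ] 𝟙 (nonzero? x))
      ≡⟨ cong (_⊕ (∑[ x ← allFin p ] 𝟙 (nonzero? x))) (sym count-zero) ⟩
    (∑[ x ← allFin p ] 𝟙 (≈? p ⟦ x ⟧ (+ 0))) ⊕ (∑[ x ← allFin p ] 𝟙 (nonzero? x))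
      ≡⟨ sym (∑-⊕ (allFin p) _ _) ⟩
    (∑[ x ← allFin p ] (𝟙 (≈? p ⟦ x ⟧ (+ 0)) ⊕ 𝟙 (nonzero? x)))
      ≡⟨ ∑-cong (allFin p) (λ x → either (≈? p ⟦ x ⟧ (+ 0))) ⟩
    (∑[ x ← allFin p ] + 1)
      ≡⟨ trans (∑-1 (allFin p)) (cong +_ (List.length-tabulate id)) ⟩
    + p
      ≡⟨ cong +_ (sym (ℕ.suc-pred p)) ⟩
    + 1 ⊕ + (p ∸ 1) ∎)
    where
    open ≡-Reasoning
    either : ∀ {P : Set} (d : Dec P) → 𝟙 d ⊕ 𝟙 (¬? d) ≡ + 1
    either (yes _) = refl
    either (no _)  = refl

  -- Lagrange's theorem: multiplication by a splits the p - 1 nonzero residues into orbits, all of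
  -- size e because nonzero residues can be cancelled.
  order∣p-1 : ∀ a e .{{_ : NonZero e}} → ¬ a ≈ + 0 [ p ] → a ↑ e ≈ + 1 [ p ] →
    (∀ j → a ↑ j ≈ + 1 [ p ] → e ∣ j) → e ∣ p ∸ 1
  order∣p-1 a e a≉0 a^e minimal =
      -- With B empty, this gives the number k of classes of size e that make up the nonzero
      -- residues.
      let k , eq , _ = countClosed-∪ e (>-nonZero⁻¹ e) ∣ nonzeros ∣ nonzeros Sub.⊥ ℕ.≤-refl closed
                         (λ x y _ m → contradiction m Subset.∉⊥) (λ x _ → Subset.∉⊥) size
      in divides k (trans (sym card-nonzeros) eq)
    where
    open Cyclic a (+ 1) ≈-refl e a^e
    nonzeros : Subset p
    nonzeros = ⟪ nonzero? ⟫
    card-nonzeros : ∣ nonzeros ∣ ≡ p ∸ 1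
    card-nonzeros = ℤ.+-injective (trans (card-⟪⟫ nonzero?) count-nonzero)
    closed : Closed nonzeros
    closed x y r m = ∈⟪⟫⁺ nonzero? (go (~-sym r))
      where
      go : y ~ x → ¬ ⟦ y ⟧ ≈ + 0 [ p ]
      go (s , j , h) z = ∈⟪⟫⁻ nonzero? m (≈-trans h (≈-trans (≈-⊛ˡ (sgn s) (≈-⊛ˡ (a ↑ j) z))
        (≈-reflexive (trans (cong (sgn s ⊛_) (ℤ.*-zeroʳ (a ↑ j))) (ℤ.*-zeroʳ (sgn s))))))
    size : ∀ x → x ∈ nonzeros → ∣ class x ∣ ≡ e
    size x m = ClassSize.ε-in⇒size x e
      (≈-trans (≈-⊛ʳ ⟦ x ⟧ a^e) (≈-reflexive (ℤ.*-identityˡ ⟦ x ⟧)))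
      (λ k h → minimal k (⊛-cancelˡ (≉0⇒unit pp (∈⟪⟫⁻ nonzero? m))
        (≈-trans (≈-reflexive (ℤ.*-comm ⟦ x ⟧ (a ↑ k))) (≈-trans h (≈-reflexive (sym (ℤ.*-identityʳ ⟦ x ⟧)))))))
      -- Here ε = 1, so ε x = a^0 x and a class is a single orbit of a.
      (0 , ≈-refl)

-- Totients

∑-filter : ∀ {A : Set} {P : A → Set} (P? : ∀ x → Dec (P x)) xs (f : A → ℤ) →
  ∑ (filter P? xs) f ≡ (∑[ x ← xs ] (𝟙 (P? x) ⊛ f x))
∑-filter P? []       f = refl
∑-filter P? (x ∷ xs) f with P? x
... | yes _ = cong₂ _⊕_ (sym (ℤ.*-identityˡ (f x))) (∑-filter P? xs f)
... | no _  = trans (∑-filter P? xs f) (sym (ℤ.+-identityˡ _))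

length-filter : ∀ {A : Set} {P : A → Set} (P? : ∀ x → Dec (P x)) xs → + length (filter P? xs) ≡ (∑[ x ← xs ] 𝟙 (P? x))
length-filter P? xs = trans (sym (∑-1 (filter P? xs))) (trans (∑-filter P? xs _) (∑-cong xs λ x → ℤ.*-identityʳ _))

∑-upTo-suc : ∀ n (f : ℕ → ℤ) → ∑ (upTo (suc n)) f ≡ f 0 ⊕ ∑ (upTo n) (f ∘ suc)
∑-upTo-suc n f = cong (f 0 ⊕_) (trans (cong (λ l → ∑ l f) (sym (List.map-upTo suc n))) (∑-map suc (upTo n) f))

-- `φ` runs over 1, ..., n and `Fin n` over 0, ..., n - 1; exchanging n for 0 does no harm when f
-- takes the same value at both.
∑-upTo-rotate : ∀ n (f : ℕ → ℤ) → f n ≡ f 0 → ∑ (upTo n) (f ∘ suc) ≡ ∑ (upTo n) f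
∑-upTo-rotate n f e = ⊕-cancelˡ (f 0) (trans (sym (∑-upTo-suc n f)) (trans (last n f) (trans (ℤ.+-comm _ (f n)) (cong (_⊕ ∑ (upTo n) f) e))))
  where
  last : ∀ n (f : ℕ → ℤ) → ∑ (upTo (suc n)) f ≡ ∑ (upTo n) f ⊕ f n
  last zero    f = ℤ.+-comm (f 0) (+ 0)
  last (suc n) f = trans (∑-upTo-suc (suc n) f) (trans (cong (f 0 ⊕_) (last n (f ∘ suc)))
    (trans (sym (ℤ.+-assoc (f 0) _ _)) (cong (_⊕ f (suc n)) (sym (∑-upTo-suc n f)))))

φ-count : ∀ n → + φ n ≡ (∑[ i ← allFin n ] 𝟙 (coprime? (toℕ i) n))
φ-count n = begin
  + φ n                                              ≡⟨ length-filter (λ k → coprime? k n) (map suc (upTo n)) ⟩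
  (∑[ k ← map suc (upTo n) ] 𝟙 (coprime? k n))       ≡⟨ ∑-map suc (upTo n) _ ⟩
  (∑[ k ← upTo n ] 𝟙 (coprime? (suc k) n))           ≡⟨ ∑-upTo-rotate n (λ k → 𝟙 (coprime? k n)) ends ⟩
  (∑[ k ← upTo n ] 𝟙 (coprime? k n))                 ≡⟨ ∑-allFin n (λ i → 𝟙 (coprime? (toℕ i) n)) _ (λ _ → refl) ⟨
  (∑[ i ← allFin n ] 𝟙 (coprime? (toℕ i) n)) ∎
  where
  open ≡-Reasoning
  ends : 𝟙 (coprime? n n) ≡ 𝟙 (coprime? 0 n)
  ends = 𝟙-cong (coprime? n n) (coprime? 0 n) (λ c (_ , d) → c (d , d)) (λ c {k} (_ , d) → c (k ℕ∣.∣0 , d))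

∑-divisors : ∀ m (f : ℕ → ℤ) → .{{_ : NonZero m}} → ∑ (divisors m) f ≡ (∑[ i ← allFin m ] (𝟙 (suc (toℕ i) ℕ∣.∣? m) ⊛ f (suc (toℕ i))))
∑-divisors m f = trans (∑-filter (λ k → k ℕ∣.∣? m) (map suc (upTo m)) f) (trans (∑-map suc (upTo m) _)
  (sym (∑-allFin m _ _ λ _ → refl)))

∈-divisors⁻ : ∀ {m d} → d ∈ˡ divisors m → d ∣ m
∈-divisors⁻ {m} k = proj₂ (Mem.∈-filter⁻ (λ k → k ℕ∣.∣? m) {xs = map suc (upTo m)} k)

divisors-once : ∀ m .{{_ : NonZero m}} g → g ∣ m → (∑[ d ← divisors m ] 𝟙 (d ℕ.≟ g)) ≡ + 1
divisors-once m zero    g∣m = contradiction (ℕ∣.0∣⇒≡0 g∣m) (≢-nonZero⁻¹ m)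
divisors-once m (suc g) g∣m = trans (∑-divisors m (λ d → 𝟙 (d ℕ.≟ suc g))) (trans
  (∑-cong (allFin m) λ i → sym (𝟙-× (suc (toℕ i) ℕ∣.∣? m) (suc (toℕ i) ℕ.≟ suc g)))
  (count-unique (finFinite m) (λ i → (suc (toℕ i) ℕ∣.∣? m) ×-dec (suc (toℕ i) ℕ.≟ suc g)) (fromℕ< g<m)
    (subst (_∣ m) (sym e) g∣m , e)
    (λ i (_ , q) → Fin.toℕ-injective (trans (ℕ.suc-injective q) (sym (Fin.toℕ-fromℕ< g<m))))))
  where
  g<m : g < m
  g<m = ℕ∣.∣⇒≤ g∣m
  e : suc (toℕ (fromℕ< g<m)) ≡ suc g
  e = cong suc (Fin.toℕ-fromℕ< g<m)

÷-cancel : ∀ d e .{{_ : NonZero d}} → (d * e) ÷ d ≡ e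
÷-cancel (suc d) e = trans (cong (_/ suc d) (ℕ.*-comm (suc d) e)) (ℕ/.m*n/n≡m e (suc d))

∣⇒÷ : ∀ {m d} .{{_ : NonZero m}} → d ∣ m → Σ (NonZero d) λ _ → m ≡ d * (m ÷ d)
∣⇒÷ {m} {zero}  h = contradiction (ℕ∣.0∣⇒≡0 h) (≢-nonZero⁻¹ m)
∣⇒÷ {m} {suc d} (divides q e) = _ , trans e (trans (ℕ.*-comm q (suc d))
  (cong (suc d *_) (sym (trans (cong (_÷ suc d) (trans e (ℕ.*-comm q (suc d)))) (÷-cancel (suc d) q)))))

module _ (m d e : ℕ) (m≡de : m ≡ d * e) .{{_ : NonZero m}} where

  private instance
    d≢0 : NonZero d
    d≢0 = ≢-nonZero λ { refl → ≢-nonZero⁻¹ m m≡de }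

  -- The multiples i = d k below m = d e correspond to the k below e, and gcd (d k) (d e) = d gcd k
  -- e equals d exactly for k coprime to e.
  count-gcd : (∑[ i ← allFin m ] 𝟙 (d ℕ.≟ gcd (toℕ i) m)) ≡ + φ e
  count-gcd = trans (count-rel (finFinite m) (finFinite e) (λ i → d ℕ.≟ gcd (toℕ i) m) (λ k → coprime? (toℕ k) e)
      (λ i k → (toℕ i ℕ.≟ d * toℕ k) ×-dec coprime? (toℕ k) e) left right both) (sym (φ-count e))
    where
    inj : ∀ (k k′ : Fin e) {i} → i ≡ d * toℕ k → i ≡ d * toℕ k′ → k ≡ k′
    inj k k′ q q′ = Fin.toℕ-injective (ℕ.*-cancelˡ-≡ _ _ d (trans (sym q) q′))
    gcd-scaled : ∀ k → gcd (d * k) m ≡ d * gcd k e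
    gcd-scaled k = trans (cong (gcd (d * k)) m≡de) (sym (GCD.c*gcd[m,n]≡gcd[cm,cn] d k e))
    left : ∀ i → d ≡ gcd (toℕ i) m → Σ (Fin e) λ k → (toℕ i ≡ d * toℕ k × Coprime (toℕ k) e) ×
      (∀ k′ → toℕ i ≡ d * toℕ k′ × Coprime (toℕ k′) e → k′ ≡ k)
    left i h = fromℕ< k<e , (i≡ , Coprime.gcd≡1⇒coprime (subst (λ z → gcd z e ≡ 1) (sym (Fin.toℕ-fromℕ< k<e)) gcd≡1)) ,
        λ k′ (q , _) → inj k′ (fromℕ< k<e) q i≡
      where
      d∣i : d ∣ toℕ i
      d∣i = subst (_∣ toℕ i) (sym h) (GCD.gcd[m,n]∣m (toℕ i) m)
      k = ℕ∣.quotient d∣i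
      eq : toℕ i ≡ d * k
      eq = trans (ℕ∣._∣_.equality d∣i) (ℕ.*-comm k d)
      k<e : k < e
      k<e = ℕ.*-cancelˡ-< d k e (subst (_< d * e) eq (subst (toℕ i <_) m≡de (Fin.toℕ<n i)))
      i≡ : toℕ i ≡ d * toℕ (fromℕ< k<e)
      i≡ = trans eq (cong (d *_) (sym (Fin.toℕ-fromℕ< k<e)))
      gcd≡1 : gcd k e ≡ 1
      gcd≡1 = ℕ.*-cancelˡ-≡ _ _ d (trans (sym (gcd-scaled k)) (trans (cong (λ z → gcd z m) (sym eq)) (trans (sym h) (sym (ℕ.*-identityʳ d)))))
    right : ∀ k → Coprime (toℕ k) e → Σ (Fin m) λ i → (toℕ i ≡ d * toℕ k × Coprime (toℕ k) e) ×
      (∀ i′ → toℕ i′ ≡ d * toℕ k × Coprime (toℕ k) e → i′ ≡ i)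
    right k c = fromℕ< lt , (Fin.toℕ-fromℕ< lt , c) , λ i′ (q , _) → Fin.toℕ-injective (trans q (sym (Fin.toℕ-fromℕ< lt)))
      where lt : d * toℕ k < m
            lt = subst (d * toℕ k <_) (sym m≡de) (ℕ.*-monoʳ-< d (Fin.toℕ<n k))
    both : ∀ i k → toℕ i ≡ d * toℕ k × Coprime (toℕ k) e → d ≡ gcd (toℕ i) m × Coprime (toℕ k) e
    both i k (q , c) = trans (sym (ℕ.*-identityʳ d)) (trans (cong (d *_) (sym (Coprime.coprime⇒gcd≡1 c)))
      (trans (sym (gcd-scaled (toℕ k))) (cong (λ z → gcd z m) (sym q)))) , c

-- The m residues are sorted by their gcd with m.
∑-φ-divisors : ∀ m .{{_ : NonZero m}} → (∑[ d ← divisors m ] + φ (m ÷ d)) ≡ + m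
∑-φ-divisors m = begin
  (∑[ d ← divisors m ] + φ (m ÷ d))
    ≡⟨ ∑-cong∈ (divisors m) (λ d k → sym (count-gcd m d (m ÷ d) (proj₂ (∣⇒÷ (∈-divisors⁻ k))))) ⟩
  (∑[ d ← divisors m ] ∑[ i ← allFin m ] 𝟙 (d ℕ.≟ gcd (toℕ i) m))
    ≡⟨ ∑-swap (divisors m) (allFin m) _ ⟩
  (∑[ i ← allFin m ] ∑[ d ← divisors m ] 𝟙 (d ℕ.≟ gcd (toℕ i) m))
    ≡⟨ ∑-cong (allFin m) (λ i → divisors-once m _ (GCD.gcd[m,n]∣n (toℕ i) m)) ⟩
  (∑[ i ← allFin m ] + 1)
    ≡⟨ trans (∑-1 (allFin m)) (cong +_ (List.length-tabulate id)) ⟩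
  + m ∎
  where open ≡-Reasoning

-- In terms of a primitive root g, this says that y generates the same subgroup as g ^ d.
HasIndex : ℕ → ℤ → ℕ → Set
HasIndex p y d = d ∣ p ∸ 1 × (∀ j → (y ↑ j ≈ + 1 [ p ] → p ∸ 1 ∣ d * j) × (p ∸ 1 ∣ d * j → y ↑ j ≈ + 1 [ p ]))

HasIndex-cong : ∀ {p y z d} → y ≈ z [ p ] → HasIndex p y d → HasIndex p z d
HasIndex-cong e (d∣ , h) = d∣ , λ j → (λ q → proj₁ (h j) (≈-trans (≈-↑ j e) q)) , λ q → ≈-trans (≈-↑ j (≈-sym e)) (proj₂ (h j) q)

module _ {p : ℕ} (pp : Prime p) where

  private instance
    p≢0 : NonZero p
    p≢0 = Prime.prime⇒nonZero pp

  p-1≢0 : NonZero (p ∸ 1)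
  p-1≢0 = go p pp
    where
    go : ∀ p → Prime p → NonZero (p ∸ 1)
    go zero          q = contradiction q Prime.¬prime[0]
    go (suc zero)    q = contradiction q Prime.¬prime[1]
    go (suc (suc p)) q = _

  private instance
    p-1≢0′ : NonZero (p ∸ 1)
    p-1≢0′ = p-1≢0

  -- d = (p - 1) / e for the order e of y, which divides p - 1 by Lagrange; then y^j = 1 iff e ∣ j
  -- iff d e ∣ d j.
  has-index : ∀ y → ¬ y ≈ + 0 [ p ] → Σ ℕ λ d → HasIndex p y d
  has-index y y≉0 = build (order y (≉0⇒unit pp y≉0))
    where
    build : (Σ ℕ λ e → NonZero e × y ↑ e ≈ + 1 [ p ] × (∀ j → y ↑ j ≈ + 1 [ p ] → e ∣ j)) →
      Σ ℕ λ d → HasIndex p y d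
    build (e , nz , y^e , minimal) = d , ℕ∣.divides e (trans eq (ℕ.*-comm d e)) , λ j →
        (λ q → subst (_∣ d * j) (sym eq) (ℕ∣.*-monoʳ-∣ d (minimal j q))) ,
        (λ q → power (ℕ∣.*-cancelˡ-∣ d {{d≢0}} (subst (_∣ d * j) eq q)))
      where
      e∣ : e ∣ p ∸ 1
      e∣ = order∣p-1 pp y e {{nz}} y≉0 y^e minimal
      d = ℕ∣.quotient e∣
      eq : p ∸ 1 ≡ d * e
      eq = ℕ∣._∣_.equality e∣
      d≢0 : NonZero d
      d≢0 = ≢-nonZero λ q → ≢-nonZero⁻¹ (p ∸ 1) (trans eq (cong (_* e) q))
      power : ∀ {j} → e ∣ j → y ↑ j ≈ + 1 [ p ]
      power (divides q refl) = ≈-trans (≈-reflexive (trans (cong (y ↑_) (ℕ.*-comm q e)) (↑-* y e q)))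
        (≈-trans (≈-↑ q y^e) (≈-reflexive (1↑ q)))

  -- With p - 1 = d e, index d gives y^e = 1, and index d′ then gives d e ∣ d′ e.
  index-∣ : ∀ {y d d′} → HasIndex p y d → HasIndex p y d′ → d ∣ d′
  index-∣ {y} {d} {d′} (d∣@(divides e eq) , h) (_ , h′) = ℕ∣.*-cancelʳ-∣ e {{e≢0}}
    (subst (_∣ d′ * e) eq′ (proj₁ (h′ e) (proj₂ (h e) (subst (p ∸ 1 ∣_) eq′ ℕ∣.∣-refl))))
    where
    eq′ : p ∸ 1 ≡ d * e
    eq′ = trans eq (ℕ.*-comm e d)
    e≢0 : NonZero e
    e≢0 = ≢-nonZero λ q → ≢-nonZero⁻¹ (p ∸ 1) (trans eq (cong (_* d) q))

  index-unique : ∀ {y d d′} → HasIndex p y d → HasIndex p y d′ → d ≡ d′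
  index-unique h h′ = ℕ∣.∣-antisym (index-∣ h h′) (index-∣ h′ h)

  -- index 0 marks the non-units
  index : ℤ → ℕ
  index y = choose (≈? p y (+ 0))
    module Index where
    choose : Dec (y ≈ + 0 [ p ]) → ℕ
    choose (yes _) = 0
    choose (no h)  = proj₁ (has-index y h)

  index-0 : ∀ {y} → y ≈ + 0 [ p ] → index y ≡ 0
  index-0 {y} e = go (≈? p y (+ 0))
    where
    go : ∀ d → Index.choose y d ≡ 0
    go (yes _) = refl
    go (no h)  = contradiction e h

  index-unit : ∀ {y} → ¬ y ≈ + 0 [ p ] → HasIndex p y (index y)
  index-unit {y} h = go (≈? p y (+ 0))
    where
    go : ∀ d → HasIndex p y (Index.choose y d)
    go (yes e) = contradiction e h
    go (no h)  = proj₂ (has-index y h)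

  index-∣p-1 : ∀ {y} → index y ∣ p ∸ 1 → ¬ y ≈ + 0 [ p ]
  index-∣p-1 {y} d e = ≢-nonZero⁻¹ (p ∸ 1) (ℕ∣.0∣⇒≡0 (subst (_∣ p ∸ 1) (index-0 e) d))

  index-cong : ∀ {y z} → y ≈ z [ p ] → index y ≡ index z
  index-cong {y} {z} e = go (≈? p y (+ 0)) (≈? p z (+ 0))
    where
    go : ∀ c d → Index.choose y c ≡ Index.choose z d
    go (yes _) (yes _) = refl
    go (yes a) (no b)  = contradiction (≈-trans (≈-sym e) a) b
    go (no a)  (yes b) = contradiction (≈-trans e b) a
    go (no a)  (no b)  = index-unique {z} (HasIndex-cong e (proj₂ (has-index y a))) (proj₂ (has-index z b))

  -- The powers y^0, ..., y^(e - 1) are e distinct e-th roots of unity, hence all of them. So every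
  -- element of index d is some y^i with i < e, and y^i has index d exactly when i is coprime to e.
  count-index-∃ : ∀ y d → HasIndex p y d → (∑[ x ← allFin p ] 𝟙 (d ℕ.≟ index ⟦ x ⟧)) ≡ + φ ((p ∸ 1) ÷ d)
  count-index-∃ y d hy@(d∣ , h) = trans
      (count-rel (finFinite p) (finFinite e) (λ x → d ℕ.≟ index ⟦ x ⟧) (λ i → coprime? (toℕ i) e)
        (λ x i → ≈? p ⟦ x ⟧ (y ↑ toℕ i) ×-dec coprime? (toℕ i) e) left right both)
      (sym (φ-count e))
    where
    e = (p ∸ 1) ÷ d
    eq : p ∸ 1 ≡ d * e
    eq = proj₂ (∣⇒÷ d∣)
    instance
      d≢0 : NonZero d
      d≢0 = proj₁ (∣⇒÷ d∣)
      e≢0 : NonZero e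
      e≢0 = ≢-nonZero λ q → ≢-nonZero⁻¹ (p ∸ 1) (trans eq (trans (cong (d *_) q) (ℕ.*-zeroʳ d)))
    period⁻ : ∀ j → y ↑ j ≈ + 1 [ p ] → e ∣ j
    period⁻ j q = ℕ∣.*-cancelˡ-∣ d (subst (_∣ d * j) eq (proj₁ (h j) q))
    period⁺ : ∀ j → e ∣ j → y ↑ j ≈ + 1 [ p ]
    period⁺ j q = proj₂ (h j) (subst (_∣ d * j) (sym eq) (ℕ∣.*-monoʳ-∣ d q))
    y≉0 : ¬ y ≈ + 0 [ p ]
    y≉0 z = 1≉0 pp (≈-trans (≈-sym (period⁺ e ℕ∣.∣-refl)) (go e {{e≢0}}))
      where go : ∀ e → .{{_ : NonZero e}} → y ↑ e ≈ + 0 [ p ]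
            go (suc e) = ≈-trans (≈-⊛ʳ (y ↑ e) z) (≈-reflexive (ℤ.*-zeroˡ (y ↑ e)))
    inj-≤ : ∀ i j → i ≤ j → j < e → y ↑ i ≈ y ↑ j [ p ] → i ≡ j
    inj-≤ i j le lt q = ℕ.≤-antisym le (ℕ.m∸n≡0⇒m≤n (∣∧<⇒≡0 (period⁻ (j ∸ i)
        (⊛-cancelˡ (unit-↑ i (≉0⇒unit pp y≉0)) (begin≈
          y ↑ i ⊛ y ↑ (j ∸ i) ≡≈⟨ sym (↑-+ y i (j ∸ i)) ⟩
          y ↑ (i + (j ∸ i))   ≡≈⟨ cong (y ↑_) (ℕ.m+[n∸m]≡n le) ⟩
          y ↑ j               ≈⟨ ≈-sym q ⟩
          y ↑ i               ≡≈⟨ sym (ℤ.*-identityʳ _) ⟩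
          y ↑ i ⊛ + 1 ∎≈))) (ℕ.≤-<-trans (ℕ.m∸n≤m j i) lt)))
      where
      open ≈-Reasoning p
    inj : ∀ (i j : Fin e) → y ↑ toℕ i ≈ y ↑ toℕ j [ p ] → i ≡ j
    inj i j q = [ (λ le → Fin.toℕ-injective (inj-≤ _ _ le (Fin.toℕ<n j) q)) ,
                  (λ le → sym (Fin.toℕ-injective (inj-≤ _ _ le (Fin.toℕ<n i) (≈-sym q)))) ]′ (ℕ.≤-total (toℕ i) (toℕ j))
    y↑↑ : ∀ i j → (y ↑ i) ↑ j ≡ y ↑ (i * j)
    y↑↑ i j = sym (↑-* y i j)
    -- If g divides i and e = e′ g, then e ∣ i e′, so (y^i)^e′ = 1. As y^i has order e, this forces
    -- e ∣ e′ and g = 1.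
    generator⇒coprime : ∀ i → HasIndex p (y ↑ i) d → Coprime i e
    generator⇒coprime i (_ , hi) {g} (divides i′ i≡ , divides e′ e≡) =
      ℕ∣.∣1⇒≡1 (ℕ∣.*-cancelˡ-∣ e′ {{e′≢0}} (subst (_∣ e′ * 1) e≡ (subst (e ∣_) (sym (ℕ.*-identityʳ e′))
        (ℕ∣.*-cancelˡ-∣ d (subst (_∣ d * e′) eq (proj₁ (hi e′) (≈-trans (≈-reflexive (y↑↑ i e′)) (period⁺ (i * e′) e∣ie′))))))))
      where
      e∣ie′ : e ∣ i * e′
      e∣ie′ = divides i′ (trans (cong (_* e′) i≡) (trans (ℕ.*-assoc i′ g e′) (cong (i′ *_) (trans (ℕ.*-comm g e′) (sym e≡)))))
      e′≢0 : NonZero e′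
      e′≢0 = ≢-nonZero λ q → ≢-nonZero⁻¹ e (trans e≡ (cong (_* g) q))
    coprime⇒generator : ∀ i → Coprime i e → HasIndex p (y ↑ i) d
    coprime⇒generator i c = d∣ , λ j →
      (λ q → subst (_∣ d * j) (sym eq) (ℕ∣.*-monoʳ-∣ d (Coprime.coprime-divisor (Coprime.sym c)
               (period⁻ (i * j) (≈-trans (≈-reflexive (sym (y↑↑ i j))) q))))) ,
      (λ q → ≈-trans (≈-reflexive (y↑↑ i j)) (period⁺ (i * j) (ℕ∣.∣n⇒∣m*n i (ℕ∣.*-cancelˡ-∣ d (subst (_∣ d * j) eq q)))))
    hasIndex : ∀ {x} → d ≡ index ⟦ x ⟧ → HasIndex p ⟦ x ⟧ d
    hasIndex {x} q = subst (HasIndex p ⟦ x ⟧) (sym q) (index-unit (index-∣p-1 (subst (_∣ p ∸ 1) q d∣)))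
    left : ∀ x → d ≡ index ⟦ x ⟧ → Σ (Fin e) λ i → (⟦ x ⟧ ≈ y ↑ toℕ i [ p ] × Coprime (toℕ i) e) ×
      (∀ j → ⟦ x ⟧ ≈ y ↑ toℕ j [ p ] × Coprime (toℕ j) e → j ≡ i)
    left x q = i , (x≈ , generator⇒coprime (toℕ i) (HasIndex-cong x≈ (hasIndex q))) ,
        λ j (r , _) → inj j i (≈-trans (≈-sym r) x≈)
      where
      root = roots-of-unity pp (λ i → y ↑ toℕ i) inj
        (λ i → ≈-trans (≈-reflexive (y↑↑ (toℕ i) e)) (period⁺ (toℕ i * e) (ℕ∣.n∣m*n (toℕ i)))) ⟦ x ⟧
        (proj₂ (proj₂ (hasIndex q) e) (subst (_∣ d * e) (sym eq) ℕ∣.∣-refl))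
      i = proj₁ root
      x≈ = proj₂ root
    right : ∀ i → Coprime (toℕ i) e → Σ (Fin p) λ x → (⟦ x ⟧ ≈ y ↑ toℕ i [ p ] × Coprime (toℕ i) e) ×
      (∀ x′ → ⟦ x′ ⟧ ≈ y ↑ toℕ i [ p ] × Coprime (toℕ i) e → x′ ≡ x)
    right i c = reduce (y ↑ toℕ i) , (⟦reduce⟧ _ , c) , λ x′ (q , _) → ⟦⟧-injective (≈-trans q (≈-sym (⟦reduce⟧ _)))
    both : ∀ x i → ⟦ x ⟧ ≈ y ↑ toℕ i [ p ] × Coprime (toℕ i) e → d ≡ index ⟦ x ⟧ × Coprime (toℕ i) e
    both x i (q , c) = index-unique {⟦ x ⟧} (HasIndex-cong (≈-sym q) (coprime⇒generator (toℕ i) c))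
      (index-unit λ z → ↑≉0 pp (toℕ i) y≉0 (≈-trans (≈-sym q) z)) , c

  -- Either no element has index d, or `count-index-∃` gives equality.
  count-index-≤ : ∀ d → d ∣ p ∸ 1 → (∑[ x ← allFin p ] 𝟙 (d ℕ.≟ index ⟦ x ⟧)) ≤ᶻ + φ ((p ∸ 1) ÷ d)
  count-index-≤ d d∣ with Fin.any? (λ (x : Fin p) → d ℕ.≟ index ⟦ x ⟧)
  ... | yes (x , q) = ℤ.≤-reflexive (count-index-∃ ⟦ x ⟧ d
          (subst (HasIndex p ⟦ x ⟧) (sym q) (index-unit (index-∣p-1 (subst (_∣ p ∸ 1) q d∣)))))
  ... | no ¬q = subst (_≤ᶻ + φ ((p ∸ 1) ÷ d)) (sym (∑-0 (allFin p) λ x → 𝟙-no (d ℕ.≟ index ⟦ x ⟧) λ q → ¬q (x , q))) (_≤ᶻ_.+≤+ z≤n)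

  -- Both sides add up to p − 1 over the divisors of p − 1, so the inequalities are equalities.
  count-index : ∀ d → d ∈ˡ divisors (p ∸ 1) → (∑[ x ← allFin p ] 𝟙 (d ℕ.≟ index ⟦ x ⟧)) ≡ + φ ((p ∸ 1) ÷ d)
  count-index = ∑-mono-≡ (divisors (p ∸ 1)) (λ d k → count-index-≤ d (∈-divisors⁻ k)) (begin
    (∑[ d ← divisors (p ∸ 1) ] ∑[ x ← allFin p ] 𝟙 (d ℕ.≟ index ⟦ x ⟧))
      ≡⟨ ∑-swap (divisors (p ∸ 1)) (allFin p) _ ⟩
    (∑[ x ← allFin p ] ∑[ d ← divisors (p ∸ 1) ] 𝟙 (d ℕ.≟ index ⟦ x ⟧))
      ≡⟨ ∑-cong (allFin p) one ⟩
    (∑[ x ← allFin p ] 𝟙 (nonzero? pp x))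
      ≡⟨ count-nonzero pp ⟩
    + (p ∸ 1)
      ≡⟨ ∑-φ-divisors (p ∸ 1) ⟨
    (∑[ d ← divisors (p ∸ 1) ] + φ ((p ∸ 1) ÷ d)) ∎)
    where
    open ≡-Reasoning
    one : ∀ x → (∑[ d ← divisors (p ∸ 1) ] 𝟙 (d ℕ.≟ index ⟦ x ⟧)) ≡ 𝟙 (nonzero? pp x)
    one x = go (nonzero? pp x)
      where
      go : (q : Dec (¬ ⟦ x ⟧ ≈ + 0 [ p ])) → (∑[ d ← divisors (p ∸ 1) ] 𝟙 (d ℕ.≟ index ⟦ x ⟧)) ≡ 𝟙 q
      go (yes u) = divisors-once (p ∸ 1) _ (proj₁ (index-unit u))
      go (no ¬u) = trans (∑-cong∈ (divisors (p ∸ 1)) λ d k → 𝟙-no (d ℕ.≟ index ⟦ x ⟧) λ q →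
        ¬u (index-∣p-1 (subst (_∣ p ∸ 1) q (∈-divisors⁻ k)))) (∑-0 (divisors (p ∸ 1)) λ _ → refl)

-- The Chinese remainder theorem

∏ : ∀ {ℓ} → (Fin ℓ → ℤ) → ℤ
∏ {zero}  f = + 1
∏ {suc ℓ} f = f Fin.zero ⊛ ∏ (f ∘ Fin.suc)

∏-cong : ∀ {ℓ} {f g : Fin ℓ → ℤ} → f ≗ g → ∏ f ≡ ∏ g
∏-cong {zero}  h = refl
∏-cong {suc ℓ} h = cong₂ _⊛_ (h Fin.zero) (∏-cong (h ∘ Fin.suc))

∏-1 : ∀ {ℓ} (f : Fin ℓ → ℤ) → (∀ i → f i ≡ + 1) → ∏ f ≡ + 1
∏-1 {zero}  f h = refl
∏-1 {suc ℓ} f h = cong₂ _⊛_ (h Fin.zero) (∏-1 (f ∘ Fin.suc) (h ∘ Fin.suc))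

∏-0 : ∀ {ℓ} (f : Fin ℓ → ℤ) i → f i ≡ + 0 → ∏ f ≡ + 0
∏-0 f Fin.zero    h = trans (cong (_⊛ ∏ (f ∘ Fin.suc)) h) (ℤ.*-zeroˡ (∏ (f ∘ Fin.suc)))
∏-0 f (Fin.suc i) h = trans (cong (f Fin.zero ⊛_) (∏-0 (f ∘ Fin.suc) i h)) (ℤ.*-zeroʳ (f Fin.zero))

+-prodFin : ∀ {ℓ} (f : Fin ℓ → ℕ) → + prodFin f ≡ ∏ (λ i → + f i)
+-prodFin {zero}  f = refl
+-prodFin {suc ℓ} f = trans (ℤ.pos-* (f Fin.zero) _) (cong (+ f Fin.zero ⊛_) (+-prodFin (f ∘ Fin.suc)))

𝟙-∏ : ∀ {ℓ} {P : Fin ℓ → Set} {Q : Set} (P? : ∀ i → Dec (P i)) (Q? : Dec Q) →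
  (Q → ∀ i → P i) → ((∀ i → P i) → Q) → 𝟙 Q? ≡ ∏ (λ i → 𝟙 (P? i))
𝟙-∏ P? (yes q) f g = sym (∏-1 _ λ i → 𝟙-yes (P? i) (f q i))
𝟙-∏ {P = P} P? (no ¬q) f g = sym (case (Fin.any? (λ i → ¬? (P? i))))
  where
  case : Dec (∃ λ i → ¬ P i) → ∏ (λ i → 𝟙 (P? i)) ≡ + 0
  case (yes (i , ¬p)) = ∏-0 _ i (𝟙-no (P? i) ¬p)
  case (no h) = contradiction (g λ i → decidable-stable (P? i) λ ¬p → h (i , ¬p)) ¬q

-- Distributivity: expanding a product of sums chooses one entry from each list.
∑-tuples : ∀ ℓ (L : Fin ℓ → List ℕ) (g : Fin ℓ → ℕ → ℤ) →
  (∑[ d ← tuples ℓ L ] ∏ (λ i → g i (d i))) ≡ ∏ (λ i → ∑ (L i) (g i))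
∑-tuples zero    L g = refl
∑-tuples (suc ℓ) L g = begin
  (∑[ d ← tuples (suc ℓ) L ] ∏ (λ i → g i (d i)))
    ≡⟨ ∑-concatMap _ (L Fin.zero) _ ⟩
  (∑[ x ← L Fin.zero ] ∑ (map (x VF.∷_) (tuples ℓ (L ∘ Fin.suc))) (λ d → ∏ (λ i → g i (d i))))
    ≡⟨ ∑-cong (L Fin.zero) (λ x → trans (∑-map (x VF.∷_) (tuples ℓ (L ∘ Fin.suc)) _) (∑-⊛ˡ (tuples ℓ (L ∘ Fin.suc)) (g Fin.zero x) _)) ⟩
  (∑[ x ← L Fin.zero ] (g Fin.zero x ⊛ (∑[ d ← tuples ℓ (L ∘ Fin.suc) ] ∏ (λ i → g (Fin.suc i) (d i)))))
    ≡⟨ ∑-⊛ʳ (L Fin.zero) _ (g Fin.zero) ⟩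
  ∑ (L Fin.zero) (g Fin.zero) ⊛ (∑[ d ← tuples ℓ (L ∘ Fin.suc) ] ∏ (λ i → g (Fin.suc i) (d i)))
    ≡⟨ cong (∑ (L Fin.zero) (g Fin.zero) ⊛_) (∑-tuples ℓ (L ∘ Fin.suc) (g ∘ Fin.suc)) ⟩
  ∏ (λ i → ∑ (L i) (g i)) ∎
  where open ≡-Reasoning

∈-tuples⁻ : ∀ ℓ (L : Fin ℓ → List ℕ) {d} → d ∈ˡ tuples ℓ L → ∀ i → d i ∈ˡ L i
∈-tuples⁻ (suc ℓ) L {d} m i = go i (Mem.∈-concatMap⁻ (λ x → map (x VF.∷_) (tuples ℓ (L ∘ Fin.suc))) {xs = L Fin.zero} m) id
  where
  go : ∀ {xs} i → Any (λ x → d ∈ˡ map (x VF.∷_) (tuples ℓ (L ∘ Fin.suc))) xs → (∀ {x} → x ∈ˡ xs → x ∈ˡ L Fin.zero) → d i ∈ˡ L i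
  go i (there k) sub = go i k (sub ∘ there)
  go i (here k) sub with Mem.∈-map⁻ (_ VF.∷_) k
  go Fin.zero    (here k) sub | d′ , k′ , refl = sub (here refl)
  go (Fin.suc i) (here k) sub | d′ , k′ , refl = ∈-tuples⁻ ℓ (L ∘ Fin.suc) k′ i

PairwiseCoprime : ∀ {ℓ} → (Fin ℓ → ℕ) → Set
PairwiseCoprime p = ∀ i j → i ≢ j → Coprime (p i) (p j)

coprime-* : ∀ {k a b} → Coprime k a → Coprime k b → Coprime k (a * b)
coprime-* {k} {a} ca cb {d} (d∣k , d∣ab) = cb (d∣k , Coprime.coprime-divisor coprime-d d∣ab)
  where coprime-d : Coprime d a
        coprime-d (x , y) = ca (ℕ∣.∣-trans x d∣k , y)

coprime-prodFin : ∀ {ℓ} {p : Fin ℓ → ℕ} {k} → (∀ i → Coprime k (p i)) → Coprime k (prodFin p)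
coprime-prodFin {zero}  h (_ , d) = ℕ∣.∣1⇒≡1 d
coprime-prodFin {suc ℓ} h = coprime-* (h Fin.zero) (coprime-prodFin (h ∘ Fin.suc))

head-coprime : ∀ {ℓ} {p : Fin (suc ℓ) → ℕ} → PairwiseCoprime p → Coprime (p Fin.zero) (prodFin (p ∘ Fin.suc))
head-coprime h = coprime-prodFin λ i → h Fin.zero (Fin.suc i) λ ()

tail-coprime : ∀ {ℓ} {p : Fin (suc ℓ) → ℕ} → PairwiseCoprime p → PairwiseCoprime (p ∘ Fin.suc)
tail-coprime h i j ne = h _ _ (ne ∘ Fin.suc-injective)

∣-prodFin : ∀ {ℓ} (p : Fin ℓ → ℕ) i → p i ∣ prodFin p
∣-prodFin p Fin.zero    = ℕ∣.m∣m*n _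
∣-prodFin p (Fin.suc i) = ℕ∣.∣n⇒∣m*n (p Fin.zero) (∣-prodFin (p ∘ Fin.suc) i)

coprime-*-∣ : ∀ {m n z} → Coprime m n → m ∣ z → n ∣ z → m * n ∣ z
coprime-*-∣ {m} {n} c (divides q refl) n∣ = subst (m * n ∣_) (ℕ.*-comm m q)
  (ℕ∣.*-monoʳ-∣ m (Coprime.coprime-divisor (Coprime.sym c) (subst (n ∣_) (ℕ.*-comm q m) n∣)))

prodFin-∣ : ∀ {ℓ} {p : Fin ℓ → ℕ} {z} → PairwiseCoprime p → (∀ i → p i ∣ z) → prodFin p ∣ z
prodFin-∣ {zero}  h d = ℕ∣.1∣ _
prodFin-∣ {suc ℓ} h d = coprime-*-∣ (head-coprime h) (d Fin.zero) (prodFin-∣ (tail-coprime h) (d ∘ Fin.suc))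

≈-prodFin : ∀ {ℓ} {p : Fin ℓ → ℕ} {x y} → PairwiseCoprime p → (∀ i → x ≈ y [ p i ]) → x ≈ y [ prodFin p ]
≈-prodFin h e = ∣⇒≈ (prodFin-∣ h (≈⇒∣ ∘ e))

Periodic : ℕ → (ℤ → ℤ) → Set
Periodic n f = ∀ {x y} → x ≈ y [ n ] → f x ≡ f y

-- Replaces a value at z by an indicator-weighted sum over residues, which makes the value at the
-- residue independent of z.
∑-residue : ∀ n .{{_ : NonZero n}} {f} → Periodic n f → ∀ z → f z ≡ (∑[ y ← allFin n ] (𝟙 (≈? n ⟦ y ⟧ z) ⊛ f ⟦ y ⟧))
∑-residue n {f} per z = sym (begin
  (∑[ y ← allFin n ] (𝟙 (≈? n ⟦ y ⟧ z) ⊛ f ⟦ y ⟧))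
    ≡⟨ ∑-cong (allFin n) (λ y → 𝟙-guard (≈? n ⟦ y ⟧ z) per) ⟩
  (∑[ y ← allFin n ] (𝟙 (≈? n ⟦ y ⟧ z) ⊛ f z))
    ≡⟨ ∑-⊛ʳ (allFin n) (f z) _ ⟩
  (∑[ y ← allFin n ] 𝟙 (≈? n ⟦ y ⟧ z)) ⊛ f z
    ≡⟨ cong (_⊛ f z) (count-unique (finFinite n) (λ y → ≈? n ⟦ y ⟧ z) (reduce z) (⟦reduce⟧ z)
         λ y e → ⟦⟧-injective (≈-trans e (≈-sym (⟦reduce⟧ z)))) ⟩
  + 1 ⊛ f z
    ≡⟨ ℤ.*-identityˡ (f z) ⟩
  f z ∎)
  where open ≡-Reasoning

crt-solve : ∀ {m n} → Coprime m n → ∀ y z → ∃ λ x → x ≈ y [ m ] × x ≈ z [ n ]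
-- b is the inverse of m mod n, so the correction m b (z - y) is 0 mod m and z - y mod n.
crt-solve {m} {n} c y z = y ⊕ + m ⊛ (b ⊛ (z ⊖ y)) ,
    ≈-trans (≈-⊕ (≈-refl {x = y}) (≈-⊛ʳ (b ⊛ (z ⊖ y)) modulus≈0)) (≈-reflexive (lemma₁ y (b ⊛ (z ⊖ y)))) ,
    ≈-trans (≈-reflexive (lemma₂ y z (+ m) b)) (≈-trans (≈-⊕ (≈-refl {x = y}) (≈-⊛ʳ (z ⊖ y) (proj₂ unit))) (≈-reflexive (lemma₃ y z)))
  where
  unit = coprime⇒unit m c
  b = proj₁ unit
  lemma₁ : ∀ y w → y ⊕ + 0 ⊛ w ≡ y
  lemma₁ y w = trans (cong (y ⊕_) (ℤ.*-zeroˡ w)) (ℤ.+-identityʳ y)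
  lemma₂ : ∀ y z m b → y ⊕ m ⊛ (b ⊛ (z ⊖ y)) ≡ y ⊕ b ⊛ m ⊛ (z ⊖ y)
  lemma₂ = solve-∀
  lemma₃ : ∀ y z → y ⊕ + 1 ⊛ (z ⊖ y) ≡ z
  lemma₃ = solve-∀

-- Both factors are expanded over residues y mod m and z mod n. After exchanging the sums, each pair
-- (y, z) is weighted by the number of x with these residues, which is 1.
∑-crt₂ : ∀ m n .{{_ : NonZero m}} .{{_ : NonZero n}} → Coprime m n → ∀ {f g} → Periodic m f → Periodic n g →
  (∑[ x ← allFin (m * n) ] (f ⟦ x ⟧ ⊛ g ⟦ x ⟧)) ≡ (∑[ y ← allFin m ] f ⟦ y ⟧) ⊛ (∑[ z ← allFin n ] g ⟦ z ⟧)
∑-crt₂ m n c {f} {g} pf pg = begin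
  (∑[ x ← allFin (m * n) ] (f ⟦ x ⟧ ⊛ g ⟦ x ⟧))
    ≡⟨ ∑-cong (allFin (m * n)) expand ⟩
  (∑[ x ← allFin (m * n) ] ∑[ y ← allFin m ] ∑[ z ← allFin n ] (𝟙 (both? y z x) ⊛ (f ⟦ y ⟧ ⊛ g ⟦ z ⟧)))
    ≡⟨ ∑-swap (allFin (m * n)) (allFin m) _ ⟩
  (∑[ y ← allFin m ] ∑[ x ← allFin (m * n) ] ∑[ z ← allFin n ] (𝟙 (both? y z x) ⊛ (f ⟦ y ⟧ ⊛ g ⟦ z ⟧)))
    ≡⟨ ∑-cong (allFin m) (λ y → ∑-swap (allFin (m * n)) (allFin n) _) ⟩
  (∑[ y ← allFin m ] ∑[ z ← allFin n ] ∑[ x ← allFin (m * n) ] (𝟙 (both? y z x) ⊛ (f ⟦ y ⟧ ⊛ g ⟦ z ⟧)))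
    ≡⟨ ∑-cong (allFin m) (λ y → ∑-cong (allFin n) λ z → trans (∑-⊛ʳ (allFin (m * n)) _ _)
         (trans (cong (_⊛ (f ⟦ y ⟧ ⊛ g ⟦ z ⟧)) (unique y z)) (ℤ.*-identityˡ _))) ⟩
  (∑[ y ← allFin m ] ∑[ z ← allFin n ] (f ⟦ y ⟧ ⊛ g ⟦ z ⟧))
    ≡⟨ ∑-cong (allFin m) (λ y → ∑-⊛ˡ (allFin n) (f ⟦ y ⟧) _) ⟩
  (∑[ y ← allFin m ] (f ⟦ y ⟧ ⊛ (∑[ z ← allFin n ] g ⟦ z ⟧)))
    ≡⟨ ∑-⊛ʳ (allFin m) _ _ ⟩
  (∑[ y ← allFin m ] f ⟦ y ⟧) ⊛ (∑[ z ← allFin n ] g ⟦ z ⟧) ∎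
  where
  open ≡-Reasoning
  both? : (y : Fin m) (z : Fin n) (x : Fin (m * n)) → Dec (⟦ y ⟧ ≈ ⟦ x ⟧ [ m ] × ⟦ z ⟧ ≈ ⟦ x ⟧ [ n ])
  both? y z x = ≈? m ⟦ y ⟧ ⟦ x ⟧ ×-dec ≈? n ⟦ z ⟧ ⟦ x ⟧
  expand : ∀ x → f ⟦ x ⟧ ⊛ g ⟦ x ⟧ ≡ (∑[ y ← allFin m ] ∑[ z ← allFin n ] (𝟙 (both? y z x) ⊛ (f ⟦ y ⟧ ⊛ g ⟦ z ⟧)))
  expand x = trans (cong₂ _⊛_ (∑-residue m pf ⟦ x ⟧) (∑-residue n pg ⟦ x ⟧)) (trans (sym (∑-⊛ʳ (allFin m) _ _))
    (∑-cong (allFin m) λ y → trans (sym (∑-⊛ˡ (allFin n) (𝟙 (≈? m ⟦ y ⟧ ⟦ x ⟧) ⊛ f ⟦ y ⟧) (λ z → 𝟙 (≈? n ⟦ z ⟧ ⟦ x ⟧) ⊛ g ⟦ z ⟧))) (∑-cong (allFin n) λ z →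
      trans (rearrange (𝟙 (≈? m ⟦ y ⟧ ⟦ x ⟧)) (f ⟦ y ⟧) (𝟙 (≈? n ⟦ z ⟧ ⟦ x ⟧)) (g ⟦ z ⟧))
        (cong (_⊛ (f ⟦ y ⟧ ⊛ g ⟦ z ⟧)) (sym (𝟙-× (≈? m ⟦ y ⟧ ⟦ x ⟧) (≈? n ⟦ z ⟧ ⟦ x ⟧)))))))
    where rearrange : ∀ a b c d → a ⊛ b ⊛ (c ⊛ d) ≡ a ⊛ c ⊛ (b ⊛ d)
          rearrange = solve-∀
  unique : ∀ y z → (∑[ x ← allFin (m * n) ] 𝟙 (both? y z x)) ≡ + 1
  unique y z = let x , x≈y , x≈z = crt-solve c ⟦ y ⟧ ⟦ z ⟧ in
    count-unique (finFinite (m * n)) (both? y z) (reduce {{mn≢0}} x)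
      (≈-trans (≈-sym x≈y) (≈-sym (≈-weaken (ℕ∣.m∣m*n n) (⟦reduce⟧ {{mn≢0}} x))) ,
       ≈-trans (≈-sym x≈z) (≈-sym (≈-weaken (ℕ∣.n∣m*n m) (⟦reduce⟧ {{mn≢0}} x))))
      λ x′ (e₁ , e₂) → ⟦⟧-injective (≈-trans {z = ⟦ reduce {{mn≢0}} x ⟧} (∣⇒≈ (coprime-*-∣ c (≈⇒∣ (≈-trans (≈-sym e₁) (≈-sym x≈y))) (≈⇒∣ (≈-trans (≈-sym e₂) (≈-sym x≈z)))))
        (≈-sym (⟦reduce⟧ {{mn≢0}} x)))
    where
    mn≢0 : NonZero (m * n)
    mn≢0 = ℕ.m*n≢0 m n

prodFin≢0 : ∀ {ℓ} {p : Fin ℓ → ℕ} → (∀ i → NonZero (p i)) → NonZero (prodFin p)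
prodFin≢0 {zero}      nz = _
prodFin≢0 {suc ℓ} {p} nz = ℕ.m*n≢0 (p Fin.zero) _ {{nz Fin.zero}} {{prodFin≢0 (nz ∘ Fin.suc)}}

∏-periodic : ∀ {ℓ} (p : Fin ℓ → ℕ) (f : Fin ℓ → ℤ → ℤ) → (∀ i → Periodic (p i) (f i)) →
  Periodic (prodFin p) (λ x → ∏ (λ i → f i x))
∏-periodic p f per e = ∏-cong λ i → per i (≈-weaken (∣-prodFin p i) e)

∑-crt : ∀ {ℓ} (p : Fin ℓ → ℕ) → (∀ i → NonZero (p i)) → PairwiseCoprime p →
  (f : Fin ℓ → ℤ → ℤ) → (∀ i → Periodic (p i) (f i)) →
  (∑[ x ← allFin (prodFin p) ] ∏ (λ i → f i ⟦ x ⟧)) ≡ ∏ (λ i → ∑[ y ← allFin (p i) ] f i ⟦ y ⟧)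
∑-crt {zero}  p nz h f per = refl
∑-crt {suc ℓ} p nz h f per = trans
  (∑-crt₂ (p Fin.zero) (prodFin (p ∘ Fin.suc)) {{nz Fin.zero}} {{prodFin≢0 (nz ∘ Fin.suc)}} (head-coprime h)
    (per Fin.zero) (∏-periodic (p ∘ Fin.suc) (f ∘ Fin.suc) (per ∘ Fin.suc)))
  (cong ((∑[ y ← allFin (p Fin.zero) ] f Fin.zero ⟦ y ⟧) ⊛_)
    (∑-crt (p ∘ Fin.suc) (nz ∘ Fin.suc) (tail-coprime h) (f ∘ Fin.suc) (per ∘ Fin.suc)))

-- Orbit sizes

lcmOver-least : ∀ {ℓ} (T : Subset ℓ) (f : Fin ℓ → ℕ) {k} → (∀ i → i ∈ T → f i ∣ k) → lcmOver T f ∣ k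
lcmOver-least []          f h = ℕ∣.1∣ _
lcmOver-least (true ∷ T)  f h = LCM.lcm-least (h Fin.zero here) (lcmOver-least T (f ∘ Fin.suc) λ i m → h (Fin.suc i) (there m))
lcmOver-least (false ∷ T) f h = lcmOver-least T (f ∘ Fin.suc) λ i m → h (Fin.suc i) (there m)

∣-lcmOver : ∀ {ℓ} (T : Subset ℓ) (f : Fin ℓ → ℕ) {i} → i ∈ T → f i ∣ lcmOver T f
∣-lcmOver (true ∷ T)  f here      = LCM.m∣lcm[m,n] (f Fin.zero) _
∣-lcmOver (true ∷ T)  f (there m) = ℕ∣.∣-trans (∣-lcmOver T (f ∘ Fin.suc) m) (LCM.n∣lcm[m,n] (f Fin.zero) _)
∣-lcmOver (false ∷ T) f (there m) = ∣-lcmOver T (f ∘ Fin.suc) m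

odd-double : ∀ p → ¬ 2 ∣ p → p ∸ 1 ≡ 2 * ((p ∸ 1) / 2)
odd-double p odd = go (p % 2) (ℕ/.m%n<n p 2) (ℕ/.m≡m%n+[m/n]*n p 2)
  where
  go : ∀ r → r < 2 → p ≡ r + p / 2 * 2 → p ∸ 1 ≡ 2 * ((p ∸ 1) / 2)
  go 0 _ e = contradiction (divides (p / 2) e) odd
  go 1 _ e = trans (cong (_∸ 1) e) (trans (ℕ.*-comm (p / 2) 2) (cong (2 *_)
    (sym (trans (cong (λ z → (z ∸ 1) / 2) e) (ℕ/.m*n/n≡m (p / 2) 2)))))
  go (suc (suc r)) (s≤s (s≤s ())) e

module _ {p : ℕ} (pp : Prime p) (odd : ¬ 2 ∣ p) where

  private
    h : ℕ
    h = (p ∸ 1) / 2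
    p-1≡2h : p ∸ 1 ≡ 2 * h
    p-1≡2h = odd-double p odd
    instance
      h≢0 : NonZero h
      h≢0 = ≢-nonZero λ e → ≢-nonZero⁻¹ (p ∸ 1) {{p-1≢0 pp}} (trans p-1≡2h (cong (2 *_) e))

  -1≉1 : ¬ ⊝ + 1 ≈ + 1 [ p ]
  -1≉1 e = [ (λ { refl → Prime.¬prime[1] pp }) , (λ { refl → odd ℕ∣.∣-refl }) ]′ (Prime.prime⇒irreducible Prime.prime[2] (≈⇒∣ e))

  square-root : ∀ x → x ⊛ x ≈ + 1 [ p ] → x ≈ + 1 [ p ] ⊎ x ≈ ⊝ + 1 [ p ]
  square-root x e = [ inj₁ ∘ ⊖≈0⇒≈ , inj₂ ∘ ⊖≈0⇒≈ ]′ (euclid pp (x ⊖ + 1) (x ⊖ ⊝ + 1)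
      (≈-trans (≈-reflexive (lemma x)) (≈⇒⊖≈0 e)))
    where lemma : ∀ x → (x ⊖ + 1) ⊛ (x ⊖ ⊝ + 1) ≡ x ⊛ x ⊖ + 1
          lemma = solve-∀

  private
    ↑-double : ∀ y c → y ↑ (c * 2) ≡ y ↑ c ⊛ y ↑ c
    ↑-double y c = trans (↑-* y c 2) (cong (y ↑ c ⊛_) (ℤ.*-identityʳ (y ↑ c)))
    h≉0 : ¬ + h ≈ + 0 [ p ∸ 1 ]
    h≉0 e = ℕ.<⇒≱ (ℕ.m<m+n h (>-nonZero⁻¹ h)) (subst (_≤ h) (trans p-1≡2h (cong (λ z → h + z) (ℕ.+-identityʳ h)))
      (ℕ∣.∣⇒≤ (0≈⇒∣ e)))
    2h≈0 : + 2 ⊛ + h ≈ + 0 [ p ∸ 1 ]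
    2h≈0 = ≈-trans (≈-reflexive (trans (sym (ℤ.pos-* 2 h)) (cong +_ (sym p-1≡2h)))) modulus≈0

  index-period⁻ : ∀ {y d} c → HasIndex p y d → y ↑ c ≈ + 1 [ p ] → + c ⊛ + d ≈ + 0 [ p ∸ 1 ]
  index-period⁻ {y} {d} c (_ , H) e = ≈-trans (≈-reflexive (trans (ℤ.*-comm (+ c) (+ d)) (sym (ℤ.pos-* d c)))) (∣⇒0≈ (proj₁ (H c) e))

  index-period⁺ : ∀ {y d} c → HasIndex p y d → + c ⊛ + d ≈ + 0 [ p ∸ 1 ] → y ↑ c ≈ + 1 [ p ]
  index-period⁺ {y} {d} c (_ , H) e = proj₂ (H c) (0≈⇒∣ (≈-trans (≈-reflexive (trans (ℤ.pos-* d c) (ℤ.*-comm (+ d) (+ c)))) e))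

  -- Writing y = g ^ d for a primitive root g, the element −1 = g ^ h is a power of y iff h is a multiple of d mod p − 1.
  power-1⇒half : ∀ {y d} c → HasIndex p y d → y ↑ c ≈ ⊝ + 1 [ p ] → + c ⊛ + d ≈ + h [ p ∸ 1 ]
  power-1⇒half {y} {d} c H e = parity (q % 2) (ℕ/.m%n<n q 2) (ℕ/.m≡m%n+[m/n]*n q 2)
    where
    -- Squaring removes the sign, so p - 1 = 2 h divides 2 d c, and h divides d c.
    square : y ↑ (c * 2) ≈ + 1 [ p ]
    square = ≈-trans (≈-reflexive (↑-double y c)) (≈-trans (≈-⊛ e e) (≈-reflexive refl))
    h∣dc : h ∣ d * c
    h∣dc = ℕ∣.*-cancelʳ-∣ 2 (subst (_∣ d * c * 2) (trans p-1≡2h (ℕ.*-comm 2 h))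
      (subst (p ∸ 1 ∣_) (sym (ℕ.*-assoc d c 2)) (proj₁ (proj₂ H (c * 2)) square)))
    q = ℕ∣.quotient h∣dc
    cd≈qh : + c ⊛ + d ≡ + q ⊛ + h
    cd≈qh = trans (ℤ.*-comm (+ c) (+ d)) (trans (sym (ℤ.pos-* d c)) (trans (cong +_ (ℕ∣._∣_.equality h∣dc)) (ℤ.pos-* q h)))
    expand : ∀ r → q ≡ r + q / 2 * 2 → + c ⊛ + d ≈ + r ⊛ + h [ p ∸ 1 ]
    expand r f = begin≈
      + c ⊛ + d                                 ≡≈⟨ cd≈qh ⟩
      + q ⊛ + h                                 ≡≈⟨ cong (_⊛ + h) (trans (cong +_ f) (trans (ℤ.pos-+ r _) (cong (+ r ⊕_) (ℤ.pos-* (q / 2) 2)))) ⟩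
      (+ r ⊕ + (q / 2) ⊛ + 2) ⊛ + h             ≡≈⟨ lemma (+ r) (+ (q / 2)) (+ 2) (+ h) ⟩
      + r ⊛ + h ⊕ + (q / 2) ⊛ (+ 2 ⊛ + h)       ≈⟨ ≈-⊕ (≈-refl {x = + r ⊛ + h}) (≈-⊛ˡ (+ (q / 2)) 2h≈0) ⟩
      + r ⊛ + h ⊕ + (q / 2) ⊛ + 0               ≡≈⟨ trans (cong (+ r ⊛ + h ⊕_) (ℤ.*-zeroʳ (+ (q / 2)))) (ℤ.+-identityʳ _) ⟩
      + r ⊛ + h ∎≈
      where
      open ≈-Reasoning (p ∸ 1)
      lemma : ∀ r s t h → (r ⊕ s ⊛ t) ⊛ h ≡ r ⊛ h ⊕ s ⊛ (t ⊛ h)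
      lemma = solve-∀
    -- Writing c d = q h, only the parity of q matters, as 2 h ≡ 0; an even q would give y^c = 1.
    parity : ∀ r → r < 2 → q ≡ r + q / 2 * 2 → + c ⊛ + d ≈ + h [ p ∸ 1 ]
    parity 0 _ f = contradiction (≈-trans (≈-sym e) (index-period⁺ c H
      (≈-trans (expand 0 f) (≈-reflexive (ℤ.*-zeroˡ (+ h)))))) -1≉1
    parity 1 _ f = ≈-trans (expand 1 f) (≈-reflexive (ℤ.*-identityˡ (+ h)))
    parity (suc (suc r)) (s≤s (s≤s ())) f

  -- y^c has square 1 because 2 h ≡ 0 mod p - 1, and is not 1 because h is not 0 mod p - 1. The only
  -- other square root of 1 is -1.
  half⇒power-1 : ∀ {y d} c → HasIndex p y d → + c ⊛ + d ≈ + h [ p ∸ 1 ] → y ↑ c ≈ ⊝ + 1 [ p ]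
  half⇒power-1 {y} {d} c H e = [ (λ f → contradiction (≈-trans (≈-sym e) (index-period⁻ c H f)) h≉0) , id ]′
    (square-root (y ↑ c) (≈-trans (≈-reflexive (sym (↑-double y c))) (index-period⁺ (c * 2) H (begin≈
      + (c * 2) ⊛ + d     ≡≈⟨ cong (_⊛ + d) (ℤ.pos-* c 2) ⟩
      + c ⊛ + 2 ⊛ + d     ≡≈⟨ lemma (+ c) (+ 2) (+ d) ⟩
      + 2 ⊛ (+ c ⊛ + d)   ≈⟨ ≈-⊛ˡ (+ 2) e ⟩
      + 2 ⊛ + h           ≈⟨ 2h≈0 ⟩
      + 0 ∎≈))))
    where
    open ≈-Reasoning (p ∸ 1)
    lemma : ∀ c t d → c ⊛ t ⊛ d ≡ t ⊛ (c ⊛ d)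
    lemma = solve-∀

module Squarefree {ℓ : ℕ} (p : Fin ℓ → ℕ) (pr : ∀ i → Prime (p i)) (odd : ∀ i → ¬ 2 ∣ p i) (coprime : PairwiseCoprime p)
  (n : ℕ) .{{_ : NonZero n}} (n≡ : n ≡ prodFin p) where

  private instance
    prime-1≢0 : ∀ {i} → NonZero (p i ∸ 1)
    prime-1≢0 {i} = p-1≢0 (pr i)

  ≈-join : ∀ {x y} → (∀ i → x ≈ y [ p i ]) → x ≈ y [ n ]
  ≈-join e = subst (λ k → _ ≈ _ [ k ]) (sym n≡) (≈-prodFin coprime e)

  ≈-at : ∀ i {x y} → x ≈ y [ n ] → x ≈ y [ p i ]
  ≈-at i = ≈-weaken (subst (p i ∣_) (sym n≡) (∣-prodFin p i))

  unit-at? : ∀ z i → Dec (¬ z ≈ + 0 [ p i ])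
  unit-at? z i = ¬? (≈? (p i) z (+ 0))

  support : ℤ → Subset ℓ
  support z = ⟪ unit-at? z ⟫

  -- At a prime outside the support of z both products vanish, so only the primes of the support
  -- have to be compared.
  ≈-⊛-at : ∀ {u v z} → (∀ i → i ∈ support z → u ≈ v [ p i ]) → u ⊛ z ≈ v ⊛ z [ n ]
  ≈-⊛-at {u} {v} {z} h = ≈-join λ i → go i (≈? (p i) z (+ 0))
    where
    go : ∀ i → Dec (z ≈ + 0 [ p i ]) → u ⊛ z ≈ v ⊛ z [ p i ]
    go i (no z≉0)  = ≈-⊛ʳ z (h i (∈⟪⟫⁺ (unit-at? z) z≉0))
    go i (yes z≈0) = ≈-trans (≈-⊛ˡ u z≈0) (≈-trans (≈-reflexive (trans (ℤ.*-zeroʳ u) (sym (ℤ.*-zeroʳ v)))) (≈-⊛ˡ v (≈-sym z≈0)))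

  ≈-cancel-at : ∀ {u v z} → u ⊛ z ≈ v ⊛ z [ n ] → ∀ i → i ∈ support z → u ≈ v [ p i ]
  ≈-cancel-at {u} {v} {z} e i m = ⊛-cancelˡ (≉0⇒unit (pr i) (∈⟪⟫⁻ (unit-at? z) m))
    (≈-trans (≈-reflexive (ℤ.*-comm z u)) (≈-trans (≈-at i e) (≈-reflexive (ℤ.*-comm v z))))

  -- A common multiple of the orders of a modulo all the primes; it serves as the period `J`.
  exponent : ℕ
  exponent = prodFin (λ i → p i ∸ 1)

  exponent≢0 : NonZero exponent
  exponent≢0 = prodFin≢0 λ i → p-1≢0 (pr i)

  module Action (a : ℤ) (d : Vector ℕ ℓ) (hd : ∀ i → HasIndex (p i) a (d i)) where

    d∣ : ∀ i → d i ∣ p i ∸ 1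
    d∣ i = proj₁ (hd i)

    p-1≡d*÷ : ∀ i → p i ∸ 1 ≡ d i * ((p i ∸ 1) ÷ d i)
    p-1≡d*÷ i = proj₂ (∣⇒÷ (d∣ i))

    a^exponent : a ↑ exponent ≈ + 1 [ n ]
    a^exponent = ≈-join λ i → proj₂ (proj₂ (hd i) exponent) (ℕ∣.∣n⇒∣m*n (d i) (∣-prodFin (λ i → p i ∸ 1) i))

    open Cyclic a (⊝ + 1) (≈-reflexive refl) exponent {{exponent≢0}} a^exponent public

    L≢0 : ∀ T → NonZero (L p d T)
    L≢0 T = ≢-nonZero λ e → ≢-nonZero⁻¹ exponent {{exponent≢0}} (ℕ∣.0∣⇒≡0 (subst (_∣ exponent) e
      (lcmOver-least T _ λ i _ → ℕ∣.∣-trans (divides (d i) (p-1≡d*÷ i)) (∣-prodFin (λ i → p i ∸ 1) i))))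

    -- At i the power a^k is 1 iff (p_i - 1) / d_i divides k. Multiplied by z, this is asked only at
    -- the primes of the support, so with the converse below `L` is the exact period of z.
    L∣⇒period : ∀ z k → L p d (support z) ∣ k → a ↑ k ⊛ z ≈ z [ n ]
    L∣⇒period z k h = ≈-trans (≈-⊛-at {v = + 1} λ i m → proj₂ (proj₂ (hd i) k)
        (subst (_∣ d i * k) (sym (p-1≡d*÷ i)) (ℕ∣.*-monoʳ-∣ (d i) (ℕ∣.∣-trans (∣-lcmOver (support z) (λ i → (p i ∸ 1) ÷ d i) m) h))))
      (≈-reflexive (ℤ.*-identityˡ z))

    period⇒L∣ : ∀ z k → a ↑ k ⊛ z ≈ z [ n ] → L p d (support z) ∣ k
    period⇒L∣ z k e = lcmOver-least (support z) _ λ i m → ℕ∣.*-cancelˡ-∣ (d i) {{proj₁ (∣⇒÷ (d∣ i))}}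
      (subst (_∣ d i * k) (p-1≡d*÷ i) (proj₁ (proj₂ (hd i) k)
        (≈-cancel-at {v = + 1} (≈-trans e (≈-reflexive (sym (ℤ.*-identityˡ z)))) i m)))

    AlphaCond⇒ : ∀ z → AlphaCond p d (support z) → ∃ λ c → a ↑ c ⊛ z ≈ ⊝ + 1 ⊛ z [ n ]
    AlphaCond⇒ z (_ , c , h) = toℕ c′ , ≈-⊛-at λ i m → half⇒power-1 (pr i) (odd i) (toℕ c′) (hd i)
        (≈-trans (≈-⊛ʳ (+ d i) (≈-weaken (∣-prodFin (λ i → p i ∸ 1) i) (⟦reduce⟧ {{exponent≢0}} c))) (∣⇒≈ (h i m)))
      where
      -- The integer c may be negative; reduction modulo a common multiple of all p_i - 1 makes it a
      -- natural exponent without changing the congruences.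
      c′ : Fin exponent
      c′ = reduce {{exponent≢0}} c

    ⇒AlphaCond : ∀ z → (∃ λ c → a ↑ c ⊛ z ≈ ⊝ + 1 ⊛ z [ n ]) → AlphaCond p d (support z)
    -- Since d_i divides p_i - 1, the congruence c d_i ≡ h_i can be read modulo d_i, which gives d_i
    -- ∣ h_i.
    ⇒AlphaCond z (c , e) = (λ i m → 0≈⇒∣ (≈-trans (≈-sym (≈-weaken (d∣ i) (cd≈h i m))) (≈-trans (≈-⊛ˡ (+ c) modulus≈0) (≈-reflexive (ℤ.*-zeroʳ (+ c)))))) ,
        + c , λ i m → ≈⇒∣ (cd≈h i m)
      where
      cd≈h : ∀ i → i ∈ support z → + c ⊛ + d i ≈ + half p d i [ p i ∸ 1 ]
      cd≈h i m = power-1⇒half (pr i) (odd i) c (hd i) (≈-cancel-at e i m)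

    class-size-L : ∀ x → AlphaCond p d (support ⟦ x ⟧) → ∣ class x ∣ ≡ L p d (support ⟦ x ⟧)
    class-size-L x c = ClassSize.ε-in⇒size x _ {{L≢0 _}} (L∣⇒period ⟦ x ⟧ _ ℕ∣.∣-refl) (period⇒L∣ ⟦ x ⟧) (AlphaCond⇒ ⟦ x ⟧ c)

    class-size-2L : ∀ x → ¬ AlphaCond p d (support ⟦ x ⟧) → ∣ class x ∣ ≡ 2 * L p d (support ⟦ x ⟧)
    class-size-2L x ¬c = ClassSize.ε-out⇒size x _ {{L≢0 _}} (L∣⇒period ⟦ x ⟧ _ ℕ∣.∣-refl) (period⇒L∣ ⟦ x ⟧) (¬c ∘ ⇒AlphaCond ⟦ x ⟧)

    L-singleton : ∀ i → L p d ⁅ i ⁆ ≡ (p i ∸ 1) ÷ d i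
    L-singleton i = ℕ∣.∣-antisym
      (lcmOver-least ⁅ i ⁆ _ λ j m → subst (λ j → (p j ∸ 1) ÷ d j ∣ (p i ∸ 1) ÷ d i) (sym (Subset.x∈⁅y⁆⇒x≡y i m)) ℕ∣.∣-refl)
      (∣-lcmOver ⁅ i ⁆ (λ i → (p i ∸ 1) ÷ d i) (Subset.x∈⁅x⁆ i))

    -- With a single congruence to satisfy, c = h / d solves it exactly.
    AlphaCond-singleton : ∀ i → d i ∣ half p d i → AlphaCond p d ⁅ i ⁆
    AlphaCond-singleton i (divides c eq) = (λ j m → subst (λ j → d j ∣ half p d j) (sym (Subset.x∈⁅y⁆⇒x≡y i m)) (divides c eq)) ,
      + c , λ j m → subst (λ j → p j ∸ 1 ∣ abs (+ c ⊛ + d j ⊖ + half p d j)) (sym (Subset.x∈⁅y⁆⇒x≡y i m))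
        (≈⇒∣ (≈-reflexive (trans (sym (ℤ.pos-* c (d i))) (cong +_ (sym eq)))))

    -- p i − 1 = d i * e = 2 h with d i ∤ h forces e to be odd, hence d i = 2 gcd (d i) h.
    ÷gcd-odd : ∀ i → ¬ d i ∣ half p d i → (p i ∸ 1) ÷ gcd (d i) (half p d i) ≡ 2 * ((p i ∸ 1) ÷ d i)
    ÷gcd-odd i ¬d∣h = trans (cong (_÷ g) p-1≡) (÷-cancel g (2 * e))
      where
      e = (p i ∸ 1) ÷ d i
      g = gcd (d i) (half p d i)
      2h≡de : 2 * half p d i ≡ d i * e
      2h≡de = trans (sym (odd-double (p i) (odd i))) (p-1≡d*÷ i)
      odd-e : ¬ 2 ∣ e
      odd-e (divides f eq) = ¬d∣h (divides f (ℕ.*-cancelˡ-≡ _ _ 2 (trans 2h≡de (trans (cong (d i *_) eq)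
        (trans (sym (ℕ.*-assoc (d i) f 2)) (trans (ℕ.*-comm (d i * f) 2) (cong (2 *_) (ℕ.*-comm (d i) f))))))))
      gcd-2-e : gcd 2 e ≡ 1
      gcd-2-e = [ id , (λ q → contradiction (subst (_∣ e) q (GCD.gcd[m,n]∣n 2 e)) odd-e) ]′
        (Prime.prime⇒irreducible Prime.prime[2] (GCD.gcd[m,n]∣m 2 e))
      d≡2g : d i ≡ 2 * g
      d≡2g = sym (begin
        2 * g                               ≡⟨ GCD.c*gcd[m,n]≡gcd[cm,cn] 2 (d i) (half p d i) ⟩
        gcd (2 * d i) (2 * half p d i)      ≡⟨ cong₂ gcd (ℕ.*-comm 2 (d i)) 2h≡de ⟩
        gcd (d i * 2) (d i * e)             ≡⟨ GCD.c*gcd[m,n]≡gcd[cm,cn] (d i) 2 e ⟨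
        d i * gcd 2 e                       ≡⟨ cong (d i *_) gcd-2-e ⟩
        d i * 1                             ≡⟨ ℕ.*-identityʳ (d i) ⟩
        d i ∎)
        where open ≡-Reasoning
      p-1≡ : p i ∸ 1 ≡ g * (2 * e)
      p-1≡ = trans (p-1≡d*÷ i) (trans (cong (_* e) (trans d≡2g (ℕ.*-comm 2 g))) (ℕ.*-assoc g 2 e))
      instance
        g≢0 : NonZero g
        g≢0 = ≢-nonZero λ q → ≢-nonZero⁻¹ (p i ∸ 1) (trans p-1≡ (cong (_* (2 * e)) q))

    -- The size is L or 2 L according to `AlphaCond`. For a singleton both values are hidden in one
    -- formula: the gcd is d if d ∣ h, giving L, and d / 2 otherwise, giving 2 L.
    class-size : ∀ {T α} → IsAlpha p d T α → ∀ x → support ⟦ x ⟧ ≡ T → ∣ class x ∣ ≡ α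
    class-size {T} h x refl = cases h
      where
      cases : ∀ {α} → IsAlpha p d T α → ∣ class x ∣ ≡ α
      cases (inj₂ (_ , inj₁ (c , e)))  = trans (class-size-L x c) (sym e)
      cases (inj₂ (_ , inj₂ (¬c , e))) = trans (class-size-2L x ¬c) (sym e)
      cases (inj₁ (i , T≡ , e)) = singleton (d i ℕ∣.∣? half p d i)
        where
        singleton : Dec (d i ∣ half p d i) → _
        singleton (yes d∣h) = trans (class-size-L x (subst (AlphaCond p d) (sym T≡) (AlphaCond-singleton i d∣h)))
          (trans (cong (L p d) T≡) (trans (L-singleton i) (trans (cong ((p i ∸ 1) ÷_)
            (ℕ∣.∣-antisym (GCD.gcd-greatest ℕ∣.∣-refl d∣h) (GCD.gcd[m,n]∣m (d i) _))) (sym e))))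
        singleton (no d∤h) = trans (class-size-2L x λ c → d∤h (proj₁ c i (subst (i ∈_) (sym T≡) (Subset.x∈⁅x⁆ i))))
          (trans (cong (λ S → 2 * L p d S) T≡) (trans (cong (2 *_) (L-singleton i)) (trans (sym (÷gcd-odd i d∤h)) (sym e))))

-- Supports and inclusion–exclusion

∑-member : ∀ {A : Set} {xs : List A} {f : A → ℤ} → (∀ x → + 0 ≤ᶻ f x) → ∀ {x} → x ∈ˡ xs → f x ≤ᶻ ∑ xs f
∑-member {xs = x ∷ xs} {f} pos (here refl) = subst (_≤ᶻ f x ⊕ ∑ xs f) (ℤ.+-identityʳ (f x))
  (ℤ.+-monoʳ-≤ (f x) (subst (_≤ᶻ ∑ xs f) (∑-0 xs λ _ → refl) (∑-mono xs λ y _ → pos y)))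
∑-member {xs = x ∷ xs} {f} pos (there m) = subst (_≤ᶻ f x ⊕ ∑ xs f) (ℤ.+-identityˡ _) (ℤ.+-mono-≤ (pos x) (∑-member pos m))

at-most-once⇒Unique : ∀ {A : Set} (_≟_ : DecidableEquality A) xs → (∀ a → (∑[ x ← xs ] 𝟙 (x ≟ a)) ≤ᶻ + 1) → Unique xs
at-most-once⇒Unique _≟_ []       h = AllPairs.[]
at-most-once⇒Unique _≟_ (x ∷ xs) h =
    All.tabulate (λ m e → twice (subst (_∈ˡ xs) (sym e) m)) AllPairs.∷
    at-most-once⇒Unique _≟_ xs λ a → ℤ.≤-trans (subst (_≤ᶻ 𝟙 (x ≟ a) ⊕ ∑ xs (λ y → 𝟙 (y ≟ a))) (ℤ.+-identityˡ _)
      (ℤ.+-monoˡ-≤ _ (𝟙-≥0 (x ≟ a)))) (h a)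
  where
  twice : ¬ x ∈ˡ xs
  twice m = contradiction (ℤ.≤-trans (ℤ.+-mono-≤ one (ℤ.≤-trans one (∑-member (λ y → 𝟙-≥0 (y ≟ x)) m))) (h x))
      λ { (_≤ᶻ_.+≤+ (s≤s ())) }
    where one : + 1 ≤ᶻ 𝟙 (x ≟ x)
          one = ℤ.≤-reflexive (sym (𝟙-yes (x ≟ x) refl))

allSubsets-unique : ∀ ℓ → Unique (allSubsets ℓ)
allSubsets-unique ℓ = at-most-once⇒Unique (Finite._≟_ (subsetFinite ℓ)) (allSubsets ℓ)
  λ S → ℤ.≤-reflexive (Finite.once (subsetFinite ℓ) S)

nonemptyB⁺ : ∀ {ℓ} {T : Subset ℓ} {i} → i ∈ T → nonemptyB T ≡ true
nonemptyB⁺ {T = b ∷ T} here      = refl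
nonemptyB⁺ {T = b ∷ T} (there m) = trans (cong (b ∨_) (nonemptyB⁺ m)) (Bool.∨-zeroʳ b)

nonemptyB⁻ : ∀ {ℓ} (T : Subset ℓ) → nonemptyB T ≡ true → ∃ λ i → i ∈ T
nonemptyB⁻ (true ∷ T)  e = Fin.zero , here
nonemptyB⁻ (false ∷ T) e = let i , m = nonemptyB⁻ T e in Fin.suc i , there m

disjointB⁺ : ∀ {ℓ} (T R : Subset ℓ) → (∀ i → i ∈ R → i ∉ T) → disjointB T R ≡ true
disjointB⁺ []          []          h = refl
disjointB⁺ (true ∷ T)  (true ∷ R)  h = contradiction here (h Fin.zero here)
disjointB⁺ (true ∷ T)  (false ∷ R) h = disjointB⁺ T R λ i m k → h _ (there m) (there k)
disjointB⁺ (false ∷ T) (_ ∷ R)     h = disjointB⁺ T R λ i m k → h _ (there m) (there k)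

disjointB⁻ : ∀ {ℓ} (T R : Subset ℓ) → disjointB T R ≡ true → ∀ i → i ∈ R → i ∉ T
disjointB⁻ (true ∷ T)  (false ∷ R) e (Fin.suc i) (there m) (there k) = disjointB⁻ T R e i m k
disjointB⁻ (false ∷ T) (_ ∷ R)     e (Fin.suc i) (there m) (there k) = disjointB⁻ T R e i m k

∧-true : ∀ {a b} → a ∧ b ≡ true → a ≡ true × b ≡ true
∧-true {true} {true} refl = refl , refl

module InclusionExclusion {ℓ₀ : ℕ} (p : Fin ℓ₀ → ℕ) (alpha : Vector ℕ ℓ₀ → Subset ℓ₀ → ℕ) where

  term : ∀ {ℓ} → (Fin ℓ → ℤ) → Subset ℓ → ℤ
  term b R = ∏ (λ i → if lookup R i then b i else + 1)

  -- Expansion of ∏ (1 - b i) one coordinate at a time: subsets containing the first index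
  -- contribute - b 0, the others 1.
  inclusion-exclusion : ∀ ℓ (b : Fin ℓ → ℤ) →
    (∑[ R ← allSubsets ℓ ] (signP p alpha ∣ R ∣ ⊛ term b R)) ≡ ∏ (λ i → + 1 ⊖ b i)
  inclusion-exclusion zero    b = refl
  inclusion-exclusion (suc ℓ) b = begin
    (∑[ R ← allSubsets (suc ℓ) ] (signP p alpha ∣ R ∣ ⊛ term b R))
      ≡⟨ ∑-concatMap _ (allSubsets ℓ) _ ⟩
    (∑[ R ← allSubsets ℓ ] (⊝ signP p alpha ∣ R ∣ ⊛ (b Fin.zero ⊛ term b′ R) ⊕ (signP p alpha ∣ R ∣ ⊛ (+ 1 ⊛ term b′ R) ⊕ + 0)))
      ≡⟨ ∑-cong (allSubsets ℓ) (λ R → lemma (signP p alpha ∣ R ∣) (b Fin.zero) (term b′ R)) ⟩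
    (∑[ R ← allSubsets ℓ ] ((+ 1 ⊖ b Fin.zero) ⊛ (signP p alpha ∣ R ∣ ⊛ term b′ R)))
      ≡⟨ ∑-⊛ˡ (allSubsets ℓ) (+ 1 ⊖ b Fin.zero) _ ⟩
    (+ 1 ⊖ b Fin.zero) ⊛ (∑[ R ← allSubsets ℓ ] (signP p alpha ∣ R ∣ ⊛ term b′ R))
      ≡⟨ cong ((+ 1 ⊖ b Fin.zero) ⊛_) (inclusion-exclusion ℓ b′) ⟩
    ∏ (λ i → + 1 ⊖ b i) ∎
    where
    open ≡-Reasoning
    b′ = b ∘ Fin.suc
    lemma : ∀ s b t → ⊝ s ⊛ (b ⊛ t) ⊕ (s ⊛ (+ 1 ⊛ t) ⊕ + 0) ≡ (+ 1 ⊖ b) ⊛ (s ⊛ t)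
    lemma = solve-∀

module Support {ℓ : ℕ} (p : Fin ℓ → ℕ) (pr : ∀ i → Prime (p i)) (odd : ∀ i → ¬ 2 ∣ p i) (coprime : PairwiseCoprime p)
  (n : ℕ) .{{_ : NonZero n}} (n≡ : n ≡ prodFin p) where

  open Squarefree p pr odd coprime n n≡ public

  ∑-crt-n : (f : Fin ℓ → ℤ → ℤ) → (∀ i → Periodic (p i) (f i)) →
    (∑[ x ← allFin n ] ∏ (λ i → f i ⟦ x ⟧)) ≡ ∏ (λ i → ∑[ y ← allFin (p i) ] f i ⟦ y ⟧)
  ∑-crt-n f per = subst (λ n → (∑[ x ← allFin n ] ∏ (λ i → f i ⟦ x ⟧)) ≡ ∏ (λ i → ∑[ y ← allFin (p i) ] f i ⟦ y ⟧)) (sym n≡)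
    (∑-crt p (λ i → Prime.prime⇒nonZero (pr i)) coprime f per)

  _≟ₛ_ : DecidableEquality (Subset ℓ)
  _≟ₛ_ = Finite._≟_ (subsetFinite ℓ)

  -- The condition `support z ≡ T` at one prime; it depends only on z mod p_i, so its indicator can
  -- go through the Chinese remainder theorem.
  Match : Subset ℓ → Fin ℓ → ℤ → Set
  Match T i z = (i ∈ T → ¬ z ≈ + 0 [ p i ]) × (i ∉ T → z ≈ + 0 [ p i ])

  match? : ∀ T i z → Dec (Match T i z)
  match? T i z = ((i ∈? T) →-dec unit-at? z i) ×-dec (¬? (i ∈? T) →-dec ≈? (p i) z (+ 0))

  support-match⁻ : ∀ {T z} → support z ≡ T → ∀ i → Match T i z
  support-match⁻ {z = z} refl i = ∈⟪⟫⁻ (unit-at? z) , λ h → go h (≈? (p i) z (+ 0))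
    where
    go : i ∉ support z → Dec (z ≈ + 0 [ p i ]) → z ≈ + 0 [ p i ]
    go h (yes e) = e
    go h (no ¬e) = contradiction (∈⟪⟫⁺ (unit-at? z) ¬e) h

  support-match⁺ : ∀ {T z} → (∀ i → Match T i z) → support z ≡ T
  support-match⁺ {T} {z} h = Subset.⊆-antisym
      (λ {i} m → go i m (i ∈? T)) (λ {i} m → ∈⟪⟫⁺ (unit-at? z) (proj₁ (h i) m))
    where
    go : ∀ i → i ∈ support z → Dec (i ∈ T) → i ∈ T
    go i m (yes k) = k
    go i m (no k)  = contradiction (proj₂ (h i) k) (∈⟪⟫⁻ (unit-at? z) m)

  hasSupport? : ∀ T (x : Fin n) → Dec (support ⟦ x ⟧ ≡ T)
  hasSupport? T x = support ⟦ x ⟧ ≟ₛ T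

  withSupport : Subset ℓ → Subset n
  withSupport T = ⟪ hasSupport? T ⟫

  -- The indicator factors over the primes. Locally there are p_i - 1 choices for i ∈ T and the
  -- single choice 0 for i ∉ T.
  card-withSupport : ∀ T → ∣ withSupport T ∣ ≡ prodOver T (λ i → p i ∸ 1)
  card-withSupport T = ℤ.+-injective (begin
    + ∣ withSupport T ∣
      ≡⟨ card-⟪⟫ (hasSupport? T) ⟩
    (∑[ x ← allFin n ] 𝟙 (support ⟦ x ⟧ ≟ₛ T))
      ≡⟨ ∑-cong (allFin n) (λ x → 𝟙-∏ (λ i → match? T i ⟦ x ⟧) (support ⟦ x ⟧ ≟ₛ T) support-match⁻ support-match⁺) ⟩
    (∑[ x ← allFin n ] ∏ (λ i → 𝟙 (match? T i ⟦ x ⟧)))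
      ≡⟨ ∑-crt-n (λ i z → 𝟙 (match? T i z)) (λ i e → 𝟙-cong (match? T i _) (match? T i _) (transport e) (transport (≈-sym e))) ⟩
    ∏ (λ i → ∑[ y ← allFin (p i) ] 𝟙 (match? T i ⟦ y ⟧))
      ≡⟨ ∏-cong (λ i → local i (i ∈? T)) ⟩
    ∏ (λ i → + (if lookup T i then p i ∸ 1 else 1))
      ≡⟨ +-prodFin (λ i → if lookup T i then p i ∸ 1 else 1) ⟨
    + prodOver T (λ i → p i ∸ 1) ∎)
    where
    open ≡-Reasoning
    transport : ∀ {i x y} → x ≈ y [ p i ] → Match T i x → Match T i y
    transport e (f , g) = (λ m z → f m (≈-trans e z)) , λ m → ≈-trans (≈-sym e) (g m)
    local : ∀ i → Dec (i ∈ T) → (∑[ y ← allFin (p i) ] 𝟙 (match? T i ⟦ y ⟧)) ≡ + (if lookup T i then p i ∸ 1 else 1)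
    local i (yes m) = trans (∑-cong (allFin (p i)) λ y → 𝟙-cong (match? T i ⟦ y ⟧) (nonzero? (pr i) y) (λ (f , _) → f m)
        (λ h → (λ _ → h) , λ k → contradiction m k))
      (trans (count-nonzero (pr i)) (cong (λ b → + (if b then p i ∸ 1 else 1)) (sym (Vec.[]=⇒lookup m))))
    local i (no k) = trans (∑-cong (allFin (p i)) λ y → 𝟙-cong (match? T i ⟦ y ⟧) (≈? (p i) ⟦ y ⟧ (+ 0)) (λ (_ , g) → g k)
        (λ h → (λ m → contradiction m k) , λ _ → h))
      (trans (count-zero (pr i)) (cong (λ b → + (if b then p i ∸ 1 else 1))
        (sym (Bool.¬-not λ e → k (Vec.lookup⇒[]= i T e)))))

  -- The cardinality is a product of nonzero numbers. A point with support T is what shows α_T to be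
  -- positive.
  withSupport-nonempty : ∀ T → ∃ λ x → x ∈ withSupport T
  withSupport-nonempty T = go (Subset.nonempty? (withSupport T))
    where
    positive : ∀ {ℓ} (p : Fin ℓ → ℕ) → (∀ i → NonZero (p i ∸ 1)) → (T : Subset ℓ) → NonZero (prodOver T (λ i → p i ∸ 1))
    positive p h T = prodFin≢0 λ i → choose i (lookup T i)
      where choose : ∀ i b → NonZero (if b then p i ∸ 1 else 1)
            choose i true  = h i
            choose i false = _
    go : Dec (∃ λ x → x ∈ withSupport T) → ∃ λ x → x ∈ withSupport T
    go (yes q) = q
    go (no ¬q) = contradiction (trans (sym (card-withSupport T)) (trans (cong ∣_∣ (Subset.Empty-unique ¬q)) (Subset.∣⊥∣≡0 n)))
      (≢-nonZero⁻¹ _ {{positive p (λ i → p-1≢0 (pr i)) T}})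

  supportIn? : ∀ (Ts : List (Subset ℓ)) (x : Fin n) → Dec (support ⟦ x ⟧ ∈ˡ Ts)
  supportIn? Ts x = Any.any? (λ T → support ⟦ x ⟧ ≟ₛ T) Ts

  supportIn : List (Subset ℓ) → Subset n
  supportIn Ts = ⟪ supportIn? Ts ⟫

  Vanishes : Subset n → Fin ℓ → Set
  Vanishes Ω i = ∀ x → x ∈ Ω → ⟦ x ⟧ ≈ + 0 [ p i ]

  vanishes? : ∀ Ω i → Dec (Vanishes Ω i)
  vanishes? Ω i = Fin.all? λ x → (x ∈? Ω) →-dec ≈? (p i) ⟦ x ⟧ (+ 0)

  NoZero : Subset n → Set
  NoZero Ω = ∀ x → x ∈ Ω → ¬ ⟦ x ⟧ ≈ + 0 [ n ]

  noZero? : ∀ Ω → Dec (NoZero Ω)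
  noZero? Ω = Fin.all? λ x → (x ∈? Ω) →-dec ¬? (≈? n ⟦ x ⟧ (+ 0))

  -- For symmetric Ω this is the decidable form of 0 ∉ Ω together with generation.
  Full : Subset n → Set
  Full Ω = NoZero Ω × (∀ i → ¬ Vanishes Ω i)

  full? : ∀ Ω → Dec (Full Ω)
  full? Ω = noZero? Ω ×-dec Fin.all? (λ i → ¬? (vanishes? Ω i))

  module FixedSets (a : ℤ) (d : Vector ℕ ℓ) (hd : ∀ i → HasIndex (p i) a (d i)) (alpha : Vector ℕ ℓ → Subset ℓ → ℕ)
    (isAlpha : ∀ T → 1 ≤ ∣ T ∣ → IsAlpha p d T (alpha d T)) where

    open Action a d hd public
    open InclusionExclusion p alpha

    support-~ : ∀ {x y} → x ~ y → support ⟦ x ⟧ ≡ support ⟦ y ⟧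
    support-~ {x} {y} r = Subset.⊆-antisym (λ m → ⊆ (~-sym r) m) (λ m → ⊆ r m)
      where
      ⊆ : ∀ {x y} → x ~ y → ∀ {i} → i ∈ support ⟦ y ⟧ → i ∈ support ⟦ x ⟧
      ⊆ {x} {y} (s , j , e) {i} m = ∈⟪⟫⁺ (unit-at? ⟦ x ⟧) λ z → ∈⟪⟫⁻ (unit-at? ⟦ y ⟧) m
        (≈-trans (≈-at i e) (≈-trans (≈-⊛ˡ (sgn s) (≈-⊛ˡ (a ↑ j) z))
          (≈-reflexive (trans (cong (sgn s ⊛_) (ℤ.*-zeroʳ (a ↑ j))) (ℤ.*-zeroʳ (sgn s))))))

    withSupport-closed : ∀ T → Closed (withSupport T)
    withSupport-closed T x y r m = ∈⟪⟫⁺ (hasSupport? T) (trans (sym (support-~ r)) (∈⟪⟫⁻ (hasSupport? T) m))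

    supportIn-closed : ∀ Ts → Closed (supportIn Ts)
    supportIn-closed Ts x y r m = ∈⟪⟫⁺ (supportIn? Ts) (subst (_∈ˡ Ts) (support-~ r) (∈⟪⟫⁻ (supportIn? Ts) m))

    countClosed-⊥ : ∀ k → countClosed Sub.⊥ k ≡ coeff k oneP
    countClosed-⊥ zero = count-unique (subsetFinite n) (λ Ω → closedIn? Sub.⊥ Ω ×-dec (∣ Ω ∣ ℕ.≟ 0)) Sub.⊥
      (((λ x y _ m → contradiction m Subset.∉⊥) , id) , Subset.∣⊥∣≡0 n)
      λ Ω ((_ , s) , _) → Subset.Empty-unique λ (x , m) → Subset.∉⊥ (s m)
    countClosed-⊥ (suc k) = ∑-0 (allSubsets n) λ Ω → 𝟙-no (closedIn? Sub.⊥ Ω ×-dec (∣ Ω ∣ ℕ.≟ suc k))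
      λ ((_ , s) , e) → contradiction (trans (sym (Subset.∣⊥∣≡0 n)) (trans (cong ∣_∣ (sym (Subset.Empty-unique {p = Ω} λ (x , m) → Subset.∉⊥ (s m)))) e)) λ ()

    -- The points with support T form a closed layer in which all classes have size α_T, so adding
    -- the layer multiplies the generating function by `fT`.
    countClosed-supportIn : ∀ Ts → Unique Ts → (∀ T → T ∈ˡ Ts → 1 ≤ ∣ T ∣) →
      ∀ k → countClosed (supportIn Ts) k ≡ coeff k (prodP (map (fT p alpha d) Ts))
    countClosed-supportIn [] u h k = trans (cong (λ S → countClosed S k) empty) (countClosed-⊥ k)
      where empty : supportIn [] ≡ Sub.⊥
            empty = Subset.Empty-unique λ (x , m) → contradiction (∈⟪⟫⁻ (supportIn? []) m) λ ()
    countClosed-supportIn (T ∷ Ts) (T∉ AllPairs.∷ u) h k = begin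
      countClosed (supportIn (T ∷ Ts)) k
        ≡⟨ cong (λ S → countClosed S k) split ⟩
      countClosed (withSupport T ∪ supportIn Ts) k
        ≡⟨ proj₂ (proj₂ main) k ⟩
      (((oneP +P monoP α) ^P e) • countClosed (supportIn Ts)) k
        ≡⟨ cong (λ e → (((oneP +P monoP α) ^P e) • countClosed (supportIn Ts)) k) e≡ ⟩
      (fT p alpha d T • countClosed (supportIn Ts)) k
        ≡⟨ •-cong (fT p alpha d T) (countClosed-supportIn Ts u λ S m → h S (there m)) k ⟩
      (fT p alpha d T • (λ k → coeff k (prodP (map (fT p alpha d) Ts)))) k
        ≡⟨ coeff-*P (fT p alpha d T) _ k ⟨
      coeff k (prodP (map (fT p alpha d) (T ∷ Ts))) ∎
      where
      open ≡-Reasoning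
      α = alpha d T
      size : ∀ x → x ∈ withSupport T → ∣ class x ∣ ≡ α
      size x m = class-size (isAlpha T (h T (here refl))) x (∈⟪⟫⁻ (hasSupport? T) m)
      -- α is the size of the class of some x with support T, and that class contains x.
      1≤α : 1 ≤ α
      1≤α = let x , m = withSupport-nonempty T in
        subst (1 ≤_) (size x m) (subst (_≤ ∣ class x ∣) (Subset.∣⁅x⁆∣≡1 x)
          (Subset.p⊆q⇒∣p∣≤∣q∣ λ k → subst (_∈ class x) (sym (Subset.x∈⁅y⁆⇒x≡y x k)) (x∈class x)))
      disjoint : ∀ x → x ∈ withSupport T → x ∉ supportIn Ts
      disjoint x m k = All.lookup T∉ (∈⟪⟫⁻ (supportIn? Ts) k) (sym (∈⟪⟫⁻ (hasSupport? T) m))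
      main = countClosed-∪ α 1≤α _ (withSupport T) (supportIn Ts) ℕ.≤-refl (withSupport-closed T) (supportIn-closed Ts) disjoint size
      e = proj₁ main
      -- The layer has ∏ (p_i - 1) elements in e classes of size α, so the number of classes is the
      -- exponent prescribed by the formula.
      e≡ : e ≡ prodOver T (λ i → p i ∸ 1) ÷ α
      e≡ = sym (trans (cong (_÷ α) (trans (sym (card-withSupport T)) (trans (proj₁ (proj₂ main)) (ℕ.*-comm e α)))) (÷-cancel α e {{>-nonZero 1≤α}}))
      split : supportIn (T ∷ Ts) ≡ withSupport T ∪ supportIn Ts
      split = Subset.⊆-antisym (λ m → Subset.x∈p∪q⁺ (to (∈⟪⟫⁻ (supportIn? (T ∷ Ts)) m)))
          (λ m → ∈⟪⟫⁺ (supportIn? (T ∷ Ts)) (from (Subset.x∈p∪q⁻ (withSupport T) (supportIn Ts) m)))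
        where
        to : ∀ {x} → support ⟦ x ⟧ ∈ˡ (T ∷ Ts) → x ∈ withSupport T ⊎ x ∈ supportIn Ts
        to (here q)  = inj₁ (∈⟪⟫⁺ (hasSupport? T) q)
        to (there q) = inj₂ (∈⟪⟫⁺ (supportIn? Ts) q)
        from : ∀ {x} → x ∈ withSupport T ⊎ x ∈ supportIn Ts → support ⟦ x ⟧ ∈ˡ (T ∷ Ts)
        from (inj₁ q) = here (∈⟪⟫⁻ (hasSupport? T) q)
        from (inj₂ q) = there (∈⟪⟫⁻ (supportIn? Ts) q)

    allowed? : ∀ (R T : Subset ℓ) → Dec (nonemptyB T ∧ disjointB T R ≡ true)
    allowed? R T = Bool._≟_ (nonemptyB T ∧ disjointB T R) true

    allowed : Subset ℓ → List (Subset ℓ)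
    allowed R = filter (allowed? R) (allSubsets ℓ)

    coeff-FR : ∀ R k → coeff k (FR p alpha d R) ≡ countClosed (supportIn (allowed R)) k
    coeff-FR R k = sym (countClosed-supportIn (allowed R) (Unique.filter⁺ (allowed? R) (allSubsets-unique ℓ))
      (λ T m → let i , q = nonemptyB⁻ T (proj₁ (∧-true (proj₂ (Mem.∈-filter⁻ (allowed? R) {xs = allSubsets ℓ} m)))) in
        subst (_≤ ∣ T ∣) (Subset.∣⁅x⁆∣≡1 i) (Subset.p⊆q⇒∣p∣≤∣q∣ λ k → subst (_∈ T) (sym (Subset.x∈⁅y⁆⇒x≡y i k)) q)) k)

    -- A nonempty support means being nonzero mod n, and a support disjoint from R means being 0 at
    -- every prime of R.
    ⊆-supportIn-allowed⁻ : ∀ {R Ω} → Ω ⊆ supportIn (allowed R) → NoZero Ω × (∀ i → i ∈ R → Vanishes Ω i)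
    ⊆-supportIn-allowed⁻ {R} {Ω} s =
        (λ x m z → let i , q = nonemptyB⁻ _ (proj₁ (condition x m)) in ∈⟪⟫⁻ (unit-at? ⟦ x ⟧) q (≈-at i z)) ,
        (λ i r x m → proj₂ (support-match⁻ refl i) (disjointB⁻ _ R (proj₂ (condition x m)) i r))
      where
      condition : ∀ x → x ∈ Ω → nonemptyB (support ⟦ x ⟧) ≡ true × disjointB (support ⟦ x ⟧) R ≡ true
      condition x m = ∧-true (proj₂ (Mem.∈-filter⁻ (allowed? R) {xs = allSubsets ℓ} (∈⟪⟫⁻ (supportIn? (allowed R)) (s m))))

    ⊆-supportIn-allowed⁺ : ∀ {R Ω} → NoZero Ω → (∀ i → i ∈ R → Vanishes Ω i) → Ω ⊆ supportIn (allowed R)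
    ⊆-supportIn-allowed⁺ {R} {Ω} nz v {x} m = ∈⟪⟫⁺ (supportIn? (allowed R))
        (Mem.∈-filter⁺ (allowed? R) (∈-elems (subsetFinite ℓ) (support ⟦ x ⟧)) (cong₂ _∧_ nonempty
          (disjointB⁺ (support ⟦ x ⟧) R λ i r q → ∈⟪⟫⁻ (unit-at? ⟦ x ⟧) q (v i r x m))))
      where
      nonempty : nonemptyB (support ⟦ x ⟧) ≡ true
      nonempty = go (Fin.any? (λ i → i ∈? support ⟦ x ⟧))
        where
        go : Dec (∃ λ i → i ∈ support ⟦ x ⟧) → _
        go (yes (i , q)) = nonemptyB⁺ q
        go (no ¬q) = contradiction (≈-join λ i → proj₂ (support-match⁻ refl i) λ q → ¬q (i , q)) (nz x m)

    -- For fixed Ω, let b i be the indicator that Ω vanishes at i. Vanishing on R has the indicator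
    -- ∏ b i over i ∈ R, and after the sums over R and Ω are exchanged the signed sum over R becomes
    -- ∏ (1 - b i).
    coeff-inner : ∀ k → coeff k (inner p alpha d) ≡ (∑[ Ω ← allSubsets n ] 𝟙 ((closed? Ω ×-dec full? Ω) ×-dec (∣ Ω ∣ ℕ.≟ k)))
    coeff-inner k = begin
      coeff k (inner p alpha d)
        ≡⟨ coeff-sumP (allSubsets ℓ) _ k ⟩
      (∑[ R ← allSubsets ℓ ] coeff k (scaleP (signP p alpha ∣ R ∣) (FR p alpha d R)))
        ≡⟨ ∑-cong (allSubsets ℓ) (λ R → trans (coeff-scaleP (signP p alpha ∣ R ∣) (FR p alpha d R) k)
             (cong (signP p alpha ∣ R ∣ ⊛_) (trans (coeff-FR R k) (∑-cong (allSubsets n) (factor R))))) ⟩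
      (∑[ R ← allSubsets ℓ ] (signP p alpha ∣ R ∣ ⊛ (∑[ Ω ← allSubsets n ] (𝟙 (base? Ω) ⊛ term (b Ω) R))))
        ≡⟨ ∑-cong (allSubsets ℓ) (λ R → sym (∑-⊛ˡ (allSubsets n) (signP p alpha ∣ R ∣) _)) ⟩
      (∑[ R ← allSubsets ℓ ] ∑[ Ω ← allSubsets n ] (signP p alpha ∣ R ∣ ⊛ (𝟙 (base? Ω) ⊛ term (b Ω) R)))
        ≡⟨ ∑-swap (allSubsets ℓ) (allSubsets n) _ ⟩
      (∑[ Ω ← allSubsets n ] ∑[ R ← allSubsets ℓ ] (signP p alpha ∣ R ∣ ⊛ (𝟙 (base? Ω) ⊛ term (b Ω) R)))
        ≡⟨ ∑-cong (allSubsets n) resum ⟩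
      (∑[ Ω ← allSubsets n ] 𝟙 ((closed? Ω ×-dec full? Ω) ×-dec (∣ Ω ∣ ℕ.≟ k))) ∎
      where
      open ≡-Reasoning
      base? : ∀ Ω → Dec ((Closed Ω × NoZero Ω) × ∣ Ω ∣ ≡ k)
      base? Ω = (closed? Ω ×-dec noZero? Ω) ×-dec (∣ Ω ∣ ℕ.≟ k)
      b : Subset n → Fin ℓ → ℤ
      b Ω i = 𝟙 (vanishes? Ω i)
      rest? : ∀ R Ω → Dec (∀ i → i ∈ R → Vanishes Ω i)
      rest? R Ω = Fin.all? λ i → (i ∈? R) →-dec vanishes? Ω i
      local : ∀ R Ω i → 𝟙 ((i ∈? R) →-dec vanishes? Ω i) ≡ (if lookup R i then b Ω i else + 1)
      local R Ω i = go (i ∈? R)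
        where
        go : (q : Dec (i ∈ R)) → 𝟙 (q →-dec vanishes? Ω i) ≡ (if lookup R i then b Ω i else + 1)
        go (yes m) = trans (𝟙-cong (yes m →-dec vanishes? Ω i) (vanishes? Ω i) (λ f → f m) (λ v _ → v))
          (cong (λ c → if c then b Ω i else + 1) (sym (Vec.[]=⇒lookup m)))
        go (no ¬m) = cong (λ c → if c then b Ω i else + 1) (sym (Bool.¬-not λ e → ¬m (Vec.lookup⇒[]= i R e)))
      factor : ∀ R Ω → 𝟙 (closedIn? (supportIn (allowed R)) Ω ×-dec (∣ Ω ∣ ℕ.≟ k)) ≡ 𝟙 (base? Ω) ⊛ term (b Ω) R
      factor R Ω = begin
        𝟙 (closedIn? (supportIn (allowed R)) Ω ×-dec (∣ Ω ∣ ℕ.≟ k))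
          ≡⟨ 𝟙-cong (closedIn? (supportIn (allowed R)) Ω ×-dec (∣ Ω ∣ ℕ.≟ k)) (base? Ω ×-dec rest? R Ω)
               (λ ((c , s) , e) → let nz , v = ⊆-supportIn-allowed⁻ s in ((c , nz) , e) , v)
               (λ (((c , nz) , e) , v) → (c , ⊆-supportIn-allowed⁺ nz v) , e) ⟩
        𝟙 (base? Ω ×-dec rest? R Ω)
          ≡⟨ 𝟙-× (base? Ω) (rest? R Ω) ⟩
        𝟙 (base? Ω) ⊛ 𝟙 (rest? R Ω)
          ≡⟨ cong (𝟙 (base? Ω) ⊛_) (trans (𝟙-∏ (λ i → (i ∈? R) →-dec vanishes? Ω i) (rest? R Ω) id id) (∏-cong (local R Ω))) ⟩
        𝟙 (base? Ω) ⊛ term (b Ω) R ∎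
      resum : ∀ Ω → (∑[ R ← allSubsets ℓ ] (signP p alpha ∣ R ∣ ⊛ (𝟙 (base? Ω) ⊛ term (b Ω) R))) ≡
        𝟙 ((closed? Ω ×-dec full? Ω) ×-dec (∣ Ω ∣ ℕ.≟ k))
      resum Ω = begin
        (∑[ R ← allSubsets ℓ ] (signP p alpha ∣ R ∣ ⊛ (𝟙 (base? Ω) ⊛ term (b Ω) R)))
          ≡⟨ ∑-cong (allSubsets ℓ) (λ R → lemma (signP p alpha ∣ R ∣) (𝟙 (base? Ω)) (term (b Ω) R)) ⟩
        (∑[ R ← allSubsets ℓ ] (𝟙 (base? Ω) ⊛ (signP p alpha ∣ R ∣ ⊛ term (b Ω) R)))
          ≡⟨ ∑-⊛ˡ (allSubsets ℓ) (𝟙 (base? Ω)) _ ⟩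
        𝟙 (base? Ω) ⊛ (∑[ R ← allSubsets ℓ ] (signP p alpha ∣ R ∣ ⊛ term (b Ω) R))
          ≡⟨ cong (𝟙 (base? Ω) ⊛_) (trans (inclusion-exclusion ℓ (b Ω)) (∏-cong λ i → sym (𝟙-¬ (vanishes? Ω i)))) ⟩
        𝟙 (base? Ω) ⊛ ∏ (λ i → 𝟙 (¬? (vanishes? Ω i)))
          ≡⟨ cong (𝟙 (base? Ω) ⊛_) (sym (𝟙-∏ (λ i → ¬? (vanishes? Ω i)) (Fin.all? (λ i → ¬? (vanishes? Ω i))) id id)) ⟩
        𝟙 (base? Ω) ⊛ 𝟙 (Fin.all? (λ i → ¬? (vanishes? Ω i)))
          ≡⟨ 𝟙-× (base? Ω) (Fin.all? (λ i → ¬? (vanishes? Ω i))) ⟨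
        𝟙 (base? Ω ×-dec Fin.all? (λ i → ¬? (vanishes? Ω i)))
          ≡⟨ 𝟙-cong (base? Ω ×-dec Fin.all? (λ i → ¬? (vanishes? Ω i))) ((closed? Ω ×-dec full? Ω) ×-dec (∣ Ω ∣ ℕ.≟ k))
               (λ (((c , nz) , e) , v) → (c , nz , v) , e) (λ ((c , nz , v) , e) → ((c , nz) , e) , v) ⟩
        𝟙 ((closed? Ω ×-dec full? Ω) ×-dec (∣ Ω ∣ ℕ.≟ k)) ∎
        where lemma : ∀ s x t → s ⊛ (x ⊛ t) ≡ x ⊛ (s ⊛ t)
              lemma = solve-∀

-- Weak equivalence and generation in the cyclic group

module _ {m : ℕ} where

  private
    n : ℕ
    n = suc m

  ⟦+Z⟧ : ∀ (x y : Fin n) → ⟦ x +Z y ⟧ ≈ ⟦ x ⟧ ⊕ ⟦ y ⟧ [ n ]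
  ⟦+Z⟧ x y = ≈-trans (mod-≈ (toℕ x + toℕ y) n) (≈-reflexive (ℤ.pos-+ (toℕ x) (toℕ y)))

  ⟦-Z⟧ : ∀ (x : Fin n) → ⟦ -Z x ⟧ ≈ ⊝ ⟦ x ⟧ [ n ]
  ⟦-Z⟧ x = begin≈
    ⟦ -Z x ⟧             ≈⟨ mod-≈ (n ∸ toℕ x) n ⟩
    + (n ∸ toℕ x)        ≡≈⟨ sym (trans (ℤ.m-n≡m⊖n n (toℕ x)) (ℤ.⊖-≥ (ℕ.<⇒≤ (Fin.toℕ<n x)))) ⟩
    + n ⊕ ⊝ ⟦ x ⟧        ≈⟨ ≈-⊕ modulus≈0 (≈-refl {x = ⊝ ⟦ x ⟧}) ⟩
    + 0 ⊕ ⊝ ⟦ x ⟧        ≡≈⟨ ℤ.+-identityˡ (⊝ ⟦ x ⟧) ⟩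
    ⊝ ⟦ x ⟧ ∎≈
    where open ≈-Reasoning n

  ⟦--Z⟧ : ∀ (x y : Fin n) → ⟦ x -Z y ⟧ ≈ ⟦ x ⟧ ⊖ ⟦ y ⟧ [ n ]
  ⟦--Z⟧ x y = ≈-trans (⟦+Z⟧ x (-Z y)) (≈-⊕ (≈-refl {x = ⟦ x ⟧}) (⟦-Z⟧ y))

  mul : ℤ → Fin n → Fin n
  mul a x = reduce (a ⊛ ⟦ x ⟧)

  ⟦mul⟧ : ∀ a x → ⟦ mul a x ⟧ ≈ a ⊛ ⟦ x ⟧ [ n ]
  ⟦mul⟧ a x = ⟦reduce⟧ (a ⊛ ⟦ x ⟧)

  mul-+Z : ∀ a x y → mul a (x +Z y) ≡ mul a x +Z mul a y
  mul-+Z a x y = ⟦⟧-injective (begin≈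
    ⟦ mul a (x +Z y) ⟧               ≈⟨ ⟦mul⟧ a (x +Z y) ⟩
    a ⊛ ⟦ x +Z y ⟧                   ≈⟨ ≈-⊛ˡ a (⟦+Z⟧ x y) ⟩
    a ⊛ (⟦ x ⟧ ⊕ ⟦ y ⟧)              ≡≈⟨ ℤ.*-distribˡ-+ a ⟦ x ⟧ ⟦ y ⟧ ⟩
    a ⊛ ⟦ x ⟧ ⊕ a ⊛ ⟦ y ⟧            ≈⟨ ≈-⊕ (≈-sym (⟦mul⟧ a x)) (≈-sym (⟦mul⟧ a y)) ⟩
    ⟦ mul a x ⟧ ⊕ ⟦ mul a y ⟧        ≈⟨ ≈-sym (⟦+Z⟧ (mul a x) (mul a y)) ⟩
    ⟦ mul a x +Z mul a y ⟧ ∎≈)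
    where open ≈-Reasoning n

  mul-mul : ∀ a b x → mul a (mul b x) ≡ mul (a ⊛ b) x
  mul-mul a b x = ⟦⟧-injective (≈-trans (⟦mul⟧ a _) (≈-trans (≈-⊛ˡ a (⟦mul⟧ b x))
    (≈-trans (≈-reflexive (sym (ℤ.*-assoc a b ⟦ x ⟧))) (≈-sym (⟦mul⟧ (a ⊛ b) x)))))

  mul-cong : ∀ {a b} → a ≈ b [ n ] → ∀ x → mul a x ≡ mul b x
  mul-cong e x = reduce-cong (≈-⊛ʳ ⟦ x ⟧ e)

  mul-1 : ∀ x → mul (+ 1) x ≡ x
  mul-1 x = trans (reduce-cong (≈-reflexive (ℤ.*-identityˡ ⟦ x ⟧))) (reduce-⟦⟧ x)

  mul-inverse : ∀ {a b} → b ⊛ a ≈ + 1 [ n ] → ∀ x → mul b (mul a x) ≡ x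
  mul-inverse {a} {b} e x = trans (mul-mul b a x) (trans (mul-cong e x) (mul-1 x))

  mul-difference : ∀ a g h → mul a h -Z mul a g ≡ mul a (h -Z g)
  mul-difference a g h = ⟦⟧-injective (begin≈
    ⟦ mul a h -Z mul a g ⟧       ≈⟨ ⟦--Z⟧ (mul a h) (mul a g) ⟩
    ⟦ mul a h ⟧ ⊖ ⟦ mul a g ⟧    ≈⟨ ≈-⊕ (⟦mul⟧ a h) (≈-⊝ (⟦mul⟧ a g)) ⟩
    a ⊛ ⟦ h ⟧ ⊖ a ⊛ ⟦ g ⟧        ≡≈⟨ lemma a ⟦ h ⟧ ⟦ g ⟧ ⟩
    a ⊛ (⟦ h ⟧ ⊖ ⟦ g ⟧)          ≈⟨ ≈-⊛ˡ a (≈-sym (⟦--Z⟧ h g)) ⟩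
    a ⊛ ⟦ h -Z g ⟧               ≈⟨ ≈-sym (⟦mul⟧ a (h -Z g)) ⟩
    ⟦ mul a (h -Z g) ⟧ ∎≈)
    where
    open ≈-Reasoning n
    lemma : ∀ a h g → a ⊛ h ⊖ a ⊛ g ≡ a ⊛ (h ⊖ g)
    lemma = solve-∀

  -Z-0Z : ∀ (x : Fin n) → x -Z 0Z ≡ x
  -Z-0Z x = ⟦⟧-injective (≈-trans (⟦--Z⟧ x 0Z) (≈-reflexive (ℤ.+-identityʳ ⟦ x ⟧)))

  -Z-+Z : ∀ (h g : Fin n) → (h -Z g) +Z g ≡ h
  -Z-+Z h g = ⟦⟧-injective (≈-trans (⟦+Z⟧ (h -Z g) g) (≈-trans (≈-⊕ (⟦--Z⟧ h g) (≈-refl {x = ⟦ g ⟧})) (≈-reflexive (lemma ⟦ h ⟧ ⟦ g ⟧))))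
    where lemma : ∀ h g → h ⊖ g ⊕ g ≡ h
          lemma = solve-∀

  +Z--Z : ∀ (x g : Fin n) → (x +Z g) -Z g ≡ x
  +Z--Z x g = ⟦⟧-injective (≈-trans (⟦--Z⟧ (x +Z g) g) (≈-trans (≈-⊕ (⟦+Z⟧ x g) (≈-refl {x = ⊝ ⟦ g ⟧})) (≈-reflexive (lemma ⟦ x ⟧ ⟦ g ⟧))))
    where lemma : ∀ x g → x ⊕ g ⊕ ⊝ g ≡ x
          lemma = solve-∀

  Preimage : ℤ → Subset n → Subset n → Set
  Preimage a Ω Ω′ = ∀ x → (x ∈ Ω → mul a x ∈ Ω′) × (mul a x ∈ Ω′ → x ∈ Ω)

  -- Multiplication by a serves both as the graph isomorphism and as the group automorphism.
  preimage⇒WeakEquiv : ∀ {a Ω Ω′} → Unit n a → Preimage a Ω Ω′ → WeakEquiv Ω Ω′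
  preimage⇒WeakEquiv {a} {Ω} {Ω′} (b , e) h = mul a , mul a ,
      (bijective , (λ x y k → subst (_∈ Ω′) (sym (mul-difference a x y)) (proj₁ (h (y -Z x)) k)) ,
                   (λ x y k → proj₂ (h (y -Z x)) (subst (_∈ Ω′) (mul-difference a x y) k))) ,
      (bijective , mul-+Z a) , mul-+Z a
    where
    bijective = (λ {x} {y} q → trans (sym (mul-inverse {a} {b} e x)) (trans (cong (mul b) q) (mul-inverse {a} {b} e y))) ,
      λ y → mul b y , λ { refl → mul-inverse {b} {a} (≈-trans (≈-reflexive (ℤ.*-comm a b)) e) y }

  module _ {α : Fin n → Fin n} (hom : ∀ g h → α (g +Z h) ≡ α g +Z α h) where
    private
      one : Fin n
      one = reduce (+ 1)

    hom-0 : ⟦ α 0Z ⟧ ≈ + 0 [ n ]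
    hom-0 = ≈-trans (≈-trans (≈-reflexive (lemma ⟦ α 0Z ⟧)) (≈-⊕ (≈-trans (≈-sym (⟦+Z⟧ (α 0Z) (α 0Z)))
        (≈-reflexive (cong ⟦_⟧ (trans (sym (hom 0Z 0Z)) (cong α 0+0))))) (≈-refl {x = ⊝ ⟦ α 0Z ⟧}))) (≈-reflexive (ℤ.+-inverseʳ ⟦ α 0Z ⟧))
      where
      0+0 : 0Z +Z 0Z ≡ 0Z
      0+0 = ⟦⟧-injective (⟦+Z⟧ 0Z 0Z)
      lemma : ∀ x → x ≡ x ⊕ x ⊕ ⊝ x
      lemma = solve-∀

    hom-reduce : ∀ k → ⟦ α (reduce (+ k)) ⟧ ≈ ⟦ α one ⟧ ⊛ + k [ n ]
    hom-reduce zero    = ≈-trans (≈-trans (≈-reflexive (cong (⟦_⟧ ∘ α) (⟦⟧-injective (⟦reduce⟧ (+ 0))))) hom-0)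
      (≈-reflexive (sym (ℤ.*-zeroʳ ⟦ α one ⟧)))
    hom-reduce (suc k) = begin≈
      ⟦ α (reduce (+ suc k)) ⟧                   ≡≈⟨ cong (⟦_⟧ ∘ α) split ⟩
      ⟦ α (one +Z reduce (+ k)) ⟧                ≡≈⟨ cong ⟦_⟧ (hom one (reduce (+ k))) ⟩
      ⟦ α one +Z α (reduce (+ k)) ⟧              ≈⟨ ⟦+Z⟧ (α one) _ ⟩
      ⟦ α one ⟧ ⊕ ⟦ α (reduce (+ k)) ⟧           ≈⟨ ≈-⊕ (≈-refl {x = ⟦ α one ⟧}) (hom-reduce k) ⟩
      ⟦ α one ⟧ ⊕ ⟦ α one ⟧ ⊛ + k                ≡≈⟨ lemma ⟦ α one ⟧ (+ k) ⟩
      ⟦ α one ⟧ ⊛ (+ 1 ⊕ + k)                    ∎≈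
      where
      open ≈-Reasoning n
      lemma : ∀ a k → a ⊕ a ⊛ k ≡ a ⊛ (+ 1 ⊕ k)
      lemma = solve-∀
      split : reduce (+ suc k) ≡ one +Z reduce (+ k)
      split = ⟦⟧-injective (≈-trans (⟦reduce⟧ (+ suc k)) (≈-sym (≈-trans (⟦+Z⟧ one (reduce (+ k)))
        (≈-⊕ (⟦reduce⟧ (+ 1)) (⟦reduce⟧ (+ k))))))

    -- An endomorphism of a cyclic group is determined by its value at the generator 1.
    hom≡mul : ∀ x → α x ≡ mul ⟦ α one ⟧ x
    hom≡mul x = ⟦⟧-injective (≈-trans (≈-reflexive (cong (⟦_⟧ ∘ α) (sym (reduce-⟦⟧ x))))
      (≈-trans (hom-reduce (toℕ x)) (≈-sym (⟦mul⟧ ⟦ α one ⟧ x))))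

  -- It is enough to look at edges from 0: f(x) - f(0) = α(x) = a x with a = α(1), so x ∈ Ω and a x
  -- ∈ Ω′ are the same condition.
  WeakEquiv⇒preimage : ∀ {Ω Ω′} → WeakEquiv Ω Ω′ → ∃ λ (a : Fin n) → Coprime (toℕ a) n × Preimage ⟦ a ⟧ Ω Ω′
  WeakEquiv⇒preimage {Ω} {Ω′} (f , α , (_ , iso , iso⁻) , ((_ , sur) , hom) , compat) = α one , unit⇒coprime unit , λ x →
      (λ k → subst (_∈ Ω′) (difference x) (iso 0Z x (subst (_∈ Ω) (sym (-Z-0Z x)) k))) ,
      (λ k → subst (_∈ Ω) (-Z-0Z x) (iso⁻ 0Z x (subst (_∈ Ω′) (sym (difference x)) k)))
    where
    one : Fin n
    one = reduce (+ 1)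
    -- Since α is multiplication by α(1), an element b with α(b) = 1 is the inverse of α(1).
    b = proj₁ (sur one)
    unit : Unit n ⟦ α one ⟧
    unit = ⟦ b ⟧ , ≈-trans (≈-reflexive (ℤ.*-comm ⟦ b ⟧ ⟦ α one ⟧)) (≈-trans (≈-sym (⟦mul⟧ ⟦ α one ⟧ b))
      (≈-trans (≈-reflexive (cong ⟦_⟧ (trans (sym (hom≡mul {α} hom b)) (proj₂ (sur one) refl)))) (⟦reduce⟧ (+ 1))))
    difference : ∀ x → f x -Z f 0Z ≡ mul ⟦ α one ⟧ x
    difference x = trans (cong (_-Z f 0Z) (trans (cong f (sym (trans (cong (_+Z 0Z) (sym (-Z-0Z x))) (-Z-+Z x 0Z)))) (compat x 0Z)))
      (trans (+Z--Z (α x) (f 0Z)) (hom≡mul {α} hom x))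

  -- z lies in the subgroup generated by Ω. With z an integer, n itself is reached and gcds can be
  -- formed.
  Reach : Subset n → ℤ → Set
  Reach Ω z = ∃ λ (xs : List (Fin n)) → All (λ x → x ∈ Ω ⊎ (-Z x) ∈ Ω) xs × ⟦ sumZ xs ⟧ ≈ z [ n ]

  module _ {Ω : Subset n} where

    reach-0 : Reach Ω (+ 0)
    reach-0 = [] , [] , ≈-refl

    reach-∈ : ∀ {x} → x ∈ Ω → Reach Ω ⟦ x ⟧
    reach-∈ {x} m = x ∷ [] , inj₁ m ∷ [] , ≈-trans (⟦+Z⟧ x 0Z) (≈-reflexive (ℤ.+-identityʳ ⟦ x ⟧))

    reach-≈ : ∀ {y z} → y ≈ z [ n ] → Reach Ω y → Reach Ω z
    reach-≈ e (xs , h , f) = xs , h , ≈-trans f e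

    sumZ-++ : ∀ (xs ys : List (Fin n)) → ⟦ sumZ (xs ++ ys) ⟧ ≈ ⟦ sumZ xs ⟧ ⊕ ⟦ sumZ ys ⟧ [ n ]
    sumZ-++ []       ys = ≈-reflexive (sym (ℤ.+-identityˡ ⟦ sumZ ys ⟧))
    sumZ-++ (x ∷ xs) ys = begin≈
      ⟦ x +Z sumZ (xs ++ ys) ⟧                   ≈⟨ ⟦+Z⟧ x _ ⟩
      ⟦ x ⟧ ⊕ ⟦ sumZ (xs ++ ys) ⟧                ≈⟨ ≈-⊕ (≈-refl {x = ⟦ x ⟧}) (sumZ-++ xs ys) ⟩
      ⟦ x ⟧ ⊕ (⟦ sumZ xs ⟧ ⊕ ⟦ sumZ ys ⟧)        ≡≈⟨ sym (ℤ.+-assoc ⟦ x ⟧ ⟦ sumZ xs ⟧ ⟦ sumZ ys ⟧) ⟩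
      ⟦ x ⟧ ⊕ ⟦ sumZ xs ⟧ ⊕ ⟦ sumZ ys ⟧          ≈⟨ ≈-⊕ (≈-sym (⟦+Z⟧ x (sumZ xs))) (≈-refl {x = ⟦ sumZ ys ⟧}) ⟩
      ⟦ x +Z sumZ xs ⟧ ⊕ ⟦ sumZ ys ⟧ ∎≈
      where open ≈-Reasoning n

    reach-⊕ : ∀ {y z} → Reach Ω y → Reach Ω z → Reach Ω (y ⊕ z)
    reach-⊕ (xs , h , e) (ys , k , f) = xs ++ ys , All.++⁺ h k , ≈-trans (sumZ-++ xs ys) (≈-⊕ e f)

    -Z-involutive : ∀ (x : Fin n) → -Z (-Z x) ≡ x
    -Z-involutive x = ⟦⟧-injective (≈-trans (⟦-Z⟧ (-Z x)) (≈-trans (≈-⊝ (⟦-Z⟧ x)) (≈-reflexive (ℤ.neg-involutive ⟦ x ⟧))))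

    reach-⊝ : ∀ {z} → Reach Ω z → Reach Ω (⊝ z)
    reach-⊝ {z} (xs , h , e) = map -Z_ xs , go xs h , ≈-trans (sum xs) (≈-⊝ e)
      where
      go : ∀ xs → All (λ x → x ∈ Ω ⊎ (-Z x) ∈ Ω) xs → All (λ x → x ∈ Ω ⊎ (-Z x) ∈ Ω) (map -Z_ xs)
      go []       []           = []
      go (x ∷ xs) (inj₁ m ∷ h) = inj₂ (subst (_∈ Ω) (sym (-Z-involutive x)) m) ∷ go xs h
      go (x ∷ xs) (inj₂ m ∷ h) = inj₁ m ∷ go xs h
      sum : ∀ xs → ⟦ sumZ (map -Z_ xs) ⟧ ≈ ⊝ ⟦ sumZ xs ⟧ [ n ]
      sum []       = ≈-refl
      sum (x ∷ xs) = begin≈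
        ⟦ (-Z x) +Z sumZ (map -Z_ xs) ⟧        ≈⟨ ⟦+Z⟧ (-Z x) _ ⟩
        ⟦ -Z x ⟧ ⊕ ⟦ sumZ (map -Z_ xs) ⟧       ≈⟨ ≈-⊕ (⟦-Z⟧ x) (sum xs) ⟩
        ⊝ ⟦ x ⟧ ⊕ ⊝ ⟦ sumZ xs ⟧                ≡≈⟨ sym (ℤ.neg-distrib-+ ⟦ x ⟧ ⟦ sumZ xs ⟧) ⟩
        ⊝ (⟦ x ⟧ ⊕ ⟦ sumZ xs ⟧)                ≈⟨ ≈-⊝ (≈-sym (⟦+Z⟧ x (sumZ xs))) ⟩
        ⊝ ⟦ x +Z sumZ xs ⟧ ∎≈
        where open ≈-Reasoning n

    reach-* : ∀ c {z} → Reach Ω z → Reach Ω (+ c ⊛ z)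
    reach-* zero    {z} r = reach-≈ (≈-reflexive (sym (ℤ.*-zeroˡ z))) reach-0
    reach-* (suc k) {z} r = reach-≈ (≈-reflexive (sym (ℤ.suc-* (+ k) z))) (reach-⊕ r (reach-* k r))

    reach-⊛ : ∀ c {z} → Reach Ω z → Reach Ω (c ⊛ z)
    reach-⊛ (+ k)    r = reach-* k r
    reach-⊛ -[1+ k ] {z} r = reach-≈ (≈-reflexive (ℤ.neg-distribˡ-* (+ suc k) z)) (reach-⊝ (reach-* (suc k) r))

    reach-gcd : ∀ j k → Reach Ω (+ j) → Reach Ω (+ k) → Reach Ω (+ gcd j k)
    reach-gcd j k rj rk = go (GCD.Bézout.identity (GCD.gcd-GCD j k))
      where
      solveFor : ∀ {g u v : ℤ} → g ⊕ v ≡ u → u ⊖ v ≡ g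
      solveFor {g} {u} {v} refl = lemma g v
        where lemma : ∀ g v → g ⊕ v ⊖ v ≡ g
              lemma = solve-∀
      lift : ∀ {g x j y k} → g + y * k ≡ x * j → + g ⊕ + y ⊛ + k ≡ + x ⊛ + j
      lift {g} {x} {j} {y} {k} e = trans (cong (+ g ⊕_) (sym (ℤ.pos-* y k))) (trans (sym (ℤ.pos-+ g (y * k))) (trans (cong +_ e) (ℤ.pos-* x j)))
      go : GCD.Bézout.Identity (gcd j k) j k → Reach Ω (+ gcd j k)
      go (GCD.Bézout.+- x y e) = reach-≈ (≈-reflexive (solveFor {+ gcd j k} (lift {gcd j k} {x} {j} {y} {k} e)))
        (reach-⊕ (reach-⊛ (+ x) rj) (reach-⊝ (reach-⊛ (+ y) rk)))
      go (GCD.Bézout.-+ x y e) = reach-≈ (≈-reflexive (solveFor {+ gcd j k} (lift {gcd j k} {y} {k} {x} {j} e)))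
        (reach-⊕ (reach-⊛ (+ y) rk) (reach-⊝ (reach-⊛ (+ x) rj)))

    -- The gcd of n and the elements of Ω in xs, reached through Bézout one element at a time. The
    -- start is n, which is the empty sum mod n.
    reach-common : ∀ (xs : List (Fin n)) → ∃ λ g → Reach Ω (+ g) × g ∣ n × (∀ x → x ∈ˡ xs → x ∈ Ω → g ∣ toℕ x)
    reach-common [] = n , reach-≈ (≈-sym modulus≈0) reach-0 , ℕ∣.∣-refl , λ _ ()
    reach-common (x ∷ xs) = step (reach-common xs) (x ∈? Ω)
      where
      step : (∃ λ g → Reach Ω (+ g) × g ∣ n × (∀ x → x ∈ˡ xs → x ∈ Ω → g ∣ toℕ x)) → Dec (x ∈ Ω) →
        ∃ λ g → Reach Ω (+ g) × g ∣ n × (∀ y → y ∈ˡ (x ∷ xs) → y ∈ Ω → g ∣ toℕ y)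
      step (g , r , d , h) (no ∉) = g , r , d , λ { _ (here refl) k → contradiction k ∉ ; y (there q) k → h y q k }
      step (g , r , d , h) (yes ∈) = gcd (toℕ x) g , reach-gcd (toℕ x) g (reach-∈ ∈) r ,
        ℕ∣.∣-trans (GCD.gcd[m,n]∣n (toℕ x) g) d ,
        λ { _ (here refl) k → GCD.gcd[m,n]∣m (toℕ x) g ; y (there q) k → ℕ∣.∣-trans (GCD.gcd[m,n]∣n (toℕ x) g) (h y q k) }

module ConnectionSets {ℓ : ℕ} (p : Fin ℓ → ℕ) (pr : ∀ i → Prime (p i)) (odd : ∀ i → ¬ 2 ∣ p i) (coprime : PairwiseCoprime p)
  (m : ℕ) (n≡ : suc m ≡ prodFin p) where

  open Support p pr odd coprime (suc m) n≡ public

  private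
    n : ℕ
    n = suc m

  -- If all elements of Ω were 0 mod p_i, so would be every sum of them, among them 1.
  generates⇒¬vanishes : ∀ {Ω} → (∀ x → x ∈ Ω → (-Z x) ∈ Ω) → Generates Ω → ∀ i → ¬ Vanishes Ω i
  generates⇒¬vanishes {Ω} neg gen i v with gen (reduce (+ 1))
  ... | xs , h , e = 1≉0 (pr i) (≈-trans (≈-at i (≈-trans (≈-sym (⟦reduce⟧ (+ 1))) (≈-reflexive (cong ⟦_⟧ (sym e))))) (sum xs h))
    where
    element : ∀ {x} → x ∈ Ω ⊎ (-Z x) ∈ Ω → ⟦ x ⟧ ≈ + 0 [ p i ]
    element (inj₁ k) = v _ k
    element {x} (inj₂ k) = ≈-trans (≈-reflexive (cong ⟦_⟧ (sym (-Z-involutive {Ω = Ω} x)))) (v _ (neg (-Z x) k))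
    sum : ∀ xs → All (λ x → x ∈ Ω ⊎ (-Z x) ∈ Ω) xs → ⟦ sumZ xs ⟧ ≈ + 0 [ p i ]
    sum []       []      = ≈-refl
    sum (x ∷ xs) (k ∷ h) = ≈-trans (≈-at i (⟦+Z⟧ x (sumZ xs))) (≈-⊕ (element k) (sum xs h))

  -- The gcd g of n and Ω is not divisible by any p_i, hence is coprime to n. As g divides n, it is
  -- 1, so 1 and all its multiples are reached.
  ¬vanishes⇒generates : ∀ {Ω} → (∀ i → ¬ Vanishes Ω i) → Generates Ω
  ¬vanishes⇒generates {Ω} ¬v z = let xs , h , e = reach-≈ (≈-reflexive (ℤ.*-identityʳ ⟦ z ⟧)) (reach-⊛ ⟦ z ⟧ reach-1) in
      xs , h , ⟦⟧-injective e
    where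
    common = reach-common {Ω = Ω} (allFin n)
    g = proj₁ common
    coprime-g : ∀ i → Coprime g (p i)
    coprime-g i {q} (q∣g , q∣p) = [ id , (λ { refl → contradiction (vanish q∣g) (¬v i) }) ]′ (Prime.prime⇒irreducible (pr i) q∣p)
      where
      vanish : p i ∣ g → Vanishes Ω i
      vanish d x k = ∣⇒0≈ (ℕ∣.∣-trans d (proj₂ (proj₂ (proj₂ common)) x (∈-elems (finFinite n) x) k))
    g≡1 : g ≡ 1
    g≡1 = coprime-prodFin {p = p} coprime-g (ℕ∣.∣-refl , subst (g ∣_) n≡ (proj₁ (proj₂ (proj₂ common))))
    reach-1 : Reach Ω (+ 1)
    reach-1 = subst (λ k → Reach Ω (+ k)) g≡1 (proj₁ (proj₂ common))

-- Burnside's lemma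

-- The group is the part U of the finite type B, and orbits are counted among the Good points only.
-- In the application the sums can therefore run over all residues and all subsets.
module Burnside {A B : Set} (FA : Finite A) (FB : Finite B)
  {U : B → Set} (U? : ∀ a → Dec (U a)) (_∙_ : B → B → B) (one : B) (U-one : U one)
  (U-∙ : ∀ {a b} → U a → U b → U (a ∙ b)) (∙-assoc : ∀ a b c → (a ∙ b) ∙ c ≡ a ∙ (b ∙ c)) (∙-one : ∀ a → a ∙ one ≡ a)
  (inverse : ∀ {a} → U a → Σ B λ b → U b × b ∙ a ≡ one × a ∙ b ≡ one)
  (act : B → A → A) (act-one : ∀ x → act one x ≡ x) (act-∙ : ∀ a b x → act (a ∙ b) x ≡ act a (act b x))
  {Good : A → Set} (Good? : ∀ x → Dec (Good x)) (Good-act : ∀ {a x} → U a → Good x → Good (act a x)) where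

  _∼_ : A → A → Set
  x ∼ y = Σ B λ a → U a × x ≡ act a y

  private
    _≟_ = Finite._≟_ FA

  _∼?_ : ∀ x y → Dec (x ∼ y)
  x ∼? y = map′ Any.satisfied (λ (a , h) → Any.map (λ { refl → h }) (∈-elems FB a)) (Any.any? (λ a → U? a ×-dec (x ≟ act a y)) (elems FB))

  ∼-sym : ∀ {x y} → x ∼ y → y ∼ x
  ∼-sym {x} {y} (a , u , refl) = let b , v , ba , _ = inverse u in
    b , v , trans (sym (act-one y)) (trans (cong (λ c → act c y) (sym ba)) (act-∙ b a y))

  ∼-trans : ∀ {x y z} → x ∼ y → y ∼ z → x ∼ z
  ∼-trans {z = z} (a , u , refl) (b , v , refl) = a ∙ b , U-∙ u v , sym (act-∙ a b z)

  ∼-refl : ∀ x → x ∼ x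
  ∼-refl x = one , U-one , sym (act-one x)

  Transversal : List A → List A → Set
  Transversal xs rs = All Good rs × AllPairs.AllPairs (λ r s → ¬ r ∼ s) rs × (∀ x → x ∈ˡ xs → Good x → Any (x ∼_) rs)

  -- Greedy choice: an element is kept if it is good and equivalent to none kept so far.
  transversal : ∀ xs → ∃ (Transversal xs)
  transversal [] = [] , [] , AllPairs.[] , λ _ ()
  transversal (x ∷ xs) = step (transversal xs) (Good? x)
    where
    step : ∃ (Transversal xs) → Dec (Good x) → ∃ (Transversal (x ∷ xs))
    step (rs , g , ap , c) (no ¬g) = rs , g , ap , λ { _ (here refl) h → contradiction h ¬g ; y (there k) h → c y k h }
    step (rs , g , ap , c) (yes gx) = decide (Any.any? (x ∼?_) rs)
      where
      decide : Dec (Any (x ∼_) rs) → ∃ (Transversal (x ∷ xs))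
      decide (yes a) = rs , g , ap , λ { _ (here refl) h → a ; y (there k) h → c y k h }
      decide (no ¬a) = x ∷ rs , gx ∷ g , All.tabulate (λ m e → ¬a (Any.map (λ { refl → e }) m)) AllPairs.∷ ap ,
        λ { _ (here refl) h → here (∼-refl x) ; y (there k) h → there (c y k h) }

  representatives : List A
  representatives = proj₁ (transversal (elems FA))

  representatives-good : All Good representatives
  representatives-good = proj₁ (proj₂ (transversal (elems FA)))

  representatives-inequivalent : AllPairs.AllPairs (λ r s → ¬ r ∼ s) representatives
  representatives-inequivalent = proj₁ (proj₂ (proj₂ (transversal (elems FA))))

  representative : ∀ x → Good x → Any (x ∼_) representatives
  representative x = proj₂ (proj₂ (proj₂ (transversal (elems FA)))) x (∈-elems FA x)

  lookup-inequivalent : ∀ {rs} → AllPairs.AllPairs (λ r s → ¬ r ∼ s) rs →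
    ∀ i j → lookupˡ rs i ∼ lookupˡ rs j → i ≡ j
  lookup-inequivalent (_ AllPairs.∷ _)  Fin.zero    Fin.zero    e = refl
  lookup-inequivalent (h AllPairs.∷ _)  Fin.zero    (Fin.suc j) e = contradiction e (All.lookup h (Mem.∈-lookup j))
  lookup-inequivalent (h AllPairs.∷ _)  (Fin.suc i) Fin.zero    e = contradiction (∼-sym e) (All.lookup h (Mem.∈-lookup i))
  lookup-inequivalent (_ AllPairs.∷ ap) (Fin.suc i) (Fin.suc j) e = cong Fin.suc (lookup-inequivalent ap i j e)

  count-representatives : ∀ {rs} x → AllPairs.AllPairs (λ r s → ¬ r ∼ s) rs → Any (x ∼_) rs → (∑[ r ← rs ] 𝟙 (x ∼? r)) ≡ + 1
  count-representatives {r ∷ rs} x (h AllPairs.∷ ap) (here e) = cong₂ _⊕_ (𝟙-yes (x ∼? r) e)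
    (trans (∑-cong∈ rs λ s m → 𝟙-no (x ∼? s) λ f → All.lookup h m (∼-trans (∼-sym e) f)) (∑-0 rs λ _ → refl))
  count-representatives {r ∷ rs} x (h AllPairs.∷ ap) (there k) = cong₂ _⊕_ (𝟙-no (x ∼? r) λ e → not-in e k h) (count-representatives x ap k)
    where
    not-in : x ∼ r → ∀ {ss} → Any (x ∼_) ss → All (λ s → ¬ r ∼ s) ss → ⊥
    not-in e (here f)  (n ∷ _) = n (∼-trans (∼-sym e) f)
    not-in e (there f) (_ ∷ n) = not-in e f n

  Fixes : B → A → Set
  Fixes a x = U a × Good x × act a x ≡ x

  fixes? : ∀ a x → Dec (Fixes a x)
  fixes? a x = U? a ×-dec (Good? x ×-dec (act a x ≟ x))

  private
    moves? : ∀ r x a → Dec (U a × x ≡ act a r)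
    moves? r x a = U? a ×-dec (x ≟ act a r)

  -- If x = b r, then a ↦ a b is a bijection from the stabilizer of x to the elements carrying r to
  -- x. If x is not in the orbit of r, both sums are 0.
  stabilizer-count : ∀ r x → Good r →
    (∑[ a ← elems FB ] (𝟙 (fixes? a x) ⊛ 𝟙 (x ∼? r))) ≡ (∑[ a ← elems FB ] 𝟙 (moves? r x a))
  stabilizer-count r x gr = go (x ∼? r)
    where
    go : (q : Dec (x ∼ r)) → (∑[ a ← elems FB ] (𝟙 (fixes? a x) ⊛ 𝟙 q)) ≡ (∑[ a ← elems FB ] 𝟙 (moves? r x a))
    go (no ¬q) = trans (∑-0 (elems FB) λ a → ℤ.*-zeroʳ (𝟙 (fixes? a x)))
      (sym (∑-0 (elems FB) λ a → 𝟙-no (moves? r x a) λ h → ¬q (a , h)))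
    go (yes (b , v , refl)) = trans (∑-cong (elems FB) λ a → ℤ.*-identityʳ (𝟙 (fixes? a x)))
      (count-bij FB FB (λ a → fixes? a x) (moves? r x) (_∙ b) (_∙ b′)
        (λ a (u , _ , e) → (U-∙ u v , sym (trans (act-∙ a b r) e)) ,
          trans (∙-assoc a b b′) (trans (cong (a ∙_) bb′) (∙-one a)))
        (λ c (u , e) → (U-∙ u v′ , Good-act v gr , trans (act-∙ c b′ x) (trans (cong (act c) back) (sym e))) ,
          trans (∙-assoc c b′ b) (trans (cong (c ∙_) b′b) (∙-one c))))
      where
      b′ = proj₁ (inverse v)
      v′ = proj₁ (proj₂ (inverse v))
      b′b = proj₁ (proj₂ (proj₂ (inverse v)))
      bb′ = proj₂ (proj₂ (proj₂ (inverse v)))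
      back : act b′ (act b r) ≡ r
      back = trans (sym (act-∙ b′ b r)) (trans (cong (λ c → act c r) b′b) (act-one r))

  -- Every good x is assigned to its one representative r. Each a in U carries r to exactly one x,
  -- so every representative collects |U| in total.
  orbit-count : (∑[ a ← elems FB ] ∑[ x ← elems FA ] 𝟙 (fixes? a x)) ≡ (∑[ a ← elems FB ] 𝟙 (U? a)) ⊛ + length representatives
  orbit-count = begin
    (∑[ a ← elems FB ] ∑[ x ← elems FA ] 𝟙 (fixes? a x))
      ≡⟨ ∑-swap (elems FB) (elems FA) _ ⟩
    (∑[ x ← elems FA ] ∑[ a ← elems FB ] 𝟙 (fixes? a x))
      ≡⟨ ∑-cong (elems FA) (λ x → trans (∑-cong (elems FB) (λ a → distribute a x)) (∑-swap (elems FB) rs _)) ⟩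
    (∑[ x ← elems FA ] ∑[ r ← rs ] ∑[ a ← elems FB ] (𝟙 (fixes? a x) ⊛ 𝟙 (x ∼? r)))
      ≡⟨ ∑-swap (elems FA) rs _ ⟩
    (∑[ r ← rs ] ∑[ x ← elems FA ] ∑[ a ← elems FB ] (𝟙 (fixes? a x) ⊛ 𝟙 (x ∼? r)))
      ≡⟨ ∑-cong∈ rs (λ r m → trans (∑-cong (elems FA) λ x → stabilizer-count r x (All.lookup representatives-good m)) (orbit r)) ⟩
    (∑[ r ← rs ] u)
      ≡⟨ ∑-cong rs (λ _ → sym (ℤ.*-identityʳ u)) ⟩
    (∑[ r ← rs ] (u ⊛ + 1))
      ≡⟨ trans (∑-⊛ˡ rs u _) (cong (u ⊛_) (∑-1 rs)) ⟩
    u ⊛ + length rs ∎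
    where
    open ≡-Reasoning
    rs = representatives
    u = ∑[ a ← elems FB ] 𝟙 (U? a)
    distribute : ∀ a x → 𝟙 (fixes? a x) ≡ (∑[ r ← rs ] (𝟙 (fixes? a x) ⊛ 𝟙 (x ∼? r)))
    distribute a x = trans (sym (ℤ.*-identityʳ (𝟙 (fixes? a x)))) (trans
      (𝟙-guard (fixes? a x) λ (_ , g , _) → sym (count-representatives x representatives-inequivalent (representative x g)))
      (sym (∑-⊛ˡ rs (𝟙 (fixes? a x)) _)))
    orbit : ∀ r → (∑[ x ← elems FA ] ∑[ a ← elems FB ] 𝟙 (moves? r x a)) ≡ u
    orbit r = trans (∑-swap (elems FA) (elems FB) _) (∑-cong (elems FB) λ a → trans
      (∑-cong (elems FA) λ x → trans (𝟙-× (U? a) (x ≟ act a r)) (ℤ.*-comm (𝟙 (U? a)) (𝟙 (x ≟ act a r))))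
      (∑-pick FA (act a r) (λ _ → 𝟙 (U? a))))

-- Counting fixed connection sets and comparing coefficients

increasing-primes⇒coprime : ∀ {ℓ} {p : Fin ℓ → ℕ} → (∀ i → Prime (p i)) → (∀ i j → i Fin.< j → p i < p j) → PairwiseCoprime p
increasing-primes⇒coprime {p = p} pr inc i j i≢j = compare (Fin.<-cmp i j)
  where
  compare : Tri (i Fin.< j) (i ≡ j) (j Fin.< i) → Coprime (p i) (p j)
  compare (tri< lt _ _) = Coprime.sym (Coprime.prime⇒coprime (pr j) {{Prime.prime⇒nonZero (pr i)}} (inc i j lt))
  compare (tri≈ _ e _)  = contradiction e i≢j
  compare (tri> _ _ lt) = Coprime.prime⇒coprime (pr i) {{Prime.prime⇒nonZero (pr j)}} (inc j i lt)

module Counting {ℓ : ℕ} (p : Fin ℓ → ℕ) (pr : ∀ i → Prime (p i)) (odd : ∀ i → ¬ 2 ∣ p i) (coprime : PairwiseCoprime p)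
  (m : ℕ) (n≡ : suc m ≡ prodFin p) (k : ℕ) where

  open ConnectionSets p pr odd coprime m n≡

  private
    n : ℕ
    n = suc m

  NegClosed : Subset n → Set
  NegClosed Ω = ∀ x → x ∈ Ω → (-Z x) ∈ Ω

  Good : Subset n → Set
  Good Ω = (NegClosed Ω × Full Ω) × ∣ Ω ∣ ≡ k

  good? : ∀ Ω → Dec (Good Ω)
  good? Ω = (Fin.all? (λ x → (x ∈? Ω) →-dec ((-Z x) ∈? Ω)) ×-dec full? Ω) ×-dec (∣ Ω ∣ ℕ.≟ k)

  good⇒connection : ∀ {Ω} → Good Ω → IsConnectionSet Ω × ∣ Ω ∣ ≡ k
  good⇒connection ((neg , nz , ¬v) , e) = (neg , (λ h → nz 0Z h ≈-refl) , ¬vanishes⇒generates ¬v) , e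

  connection⇒good : ∀ {Ω} → IsConnectionSet Ω → ∣ Ω ∣ ≡ k → Good Ω
  connection⇒good {Ω} (neg , 0∉ , gen) e = (neg , (λ x h z → 0∉ (subst (_∈ Ω) (⟦⟧-injective z) h)) , generates⇒¬vanishes neg gen) , e

  U : Fin n → Set
  U a = Coprime (toℕ a) n

  U? : ∀ a → Dec (U a)
  U? a = coprime? (toℕ a) n

  U⇒Unit : ∀ {a} → U a → Unit n ⟦ a ⟧
  U⇒Unit {a} = coprime⇒unit (toℕ a)

  one : Fin n
  one = reduce (+ 1)

  U-one : U one
  U-one = unit⇒coprime (+ 1 , ≈-trans (≈-reflexive (ℤ.*-identityˡ ⟦ one ⟧)) (⟦reduce⟧ (+ 1)))

  _∙_ : Fin n → Fin n → Fin n
  a ∙ b = mul ⟦ a ⟧ b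

  ∙-assoc : ∀ a b c → (a ∙ b) ∙ c ≡ a ∙ (b ∙ c)
  ∙-assoc a b c = trans (mul-cong (⟦mul⟧ ⟦ a ⟧ b) c) (sym (mul-mul ⟦ a ⟧ ⟦ b ⟧ c))

  ∙-comm : ∀ a b → a ∙ b ≡ b ∙ a
  ∙-comm a b = reduce-cong (≈-reflexive (ℤ.*-comm ⟦ a ⟧ ⟦ b ⟧))

  one-∙ : ∀ a → one ∙ a ≡ a
  one-∙ a = trans (mul-cong (⟦reduce⟧ (+ 1)) a) (mul-1 a)

  U-∙ : ∀ {a b} → U a → U b → U (a ∙ b)
  U-∙ {a} {b} u v = unit⇒coprime (d ⊛ c , (begin≈
    d ⊛ c ⊛ ⟦ a ∙ b ⟧           ≈⟨ ≈-⊛ˡ (d ⊛ c) (⟦mul⟧ ⟦ a ⟧ b) ⟩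
    d ⊛ c ⊛ (⟦ a ⟧ ⊛ ⟦ b ⟧)     ≡≈⟨ lemma d c ⟦ a ⟧ ⟦ b ⟧ ⟩
    c ⊛ ⟦ a ⟧ ⊛ (d ⊛ ⟦ b ⟧)     ≈⟨ ≈-⊛ (proj₂ (U⇒Unit u)) (proj₂ (U⇒Unit v)) ⟩
    + 1 ∎≈))
    where
    open ≈-Reasoning n
    c = proj₁ (U⇒Unit u)
    d = proj₁ (U⇒Unit v)
    lemma : ∀ d c a b → d ⊛ c ⊛ (a ⊛ b) ≡ c ⊛ a ⊛ (d ⊛ b)
    lemma = solve-∀

  inverse : ∀ {a} → U a → Σ (Fin n) λ b → U b × b ∙ a ≡ one × a ∙ b ≡ one
  inverse {a} u = b′ , unit⇒coprime (⟦ a ⟧ , ≈-trans (≈-reflexive (ℤ.*-comm ⟦ a ⟧ ⟦ b′ ⟧)) b′a≈1) ,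
      reduce-cong b′a≈1 , trans (∙-comm a b′) (reduce-cong b′a≈1)
    where
    b = proj₁ (U⇒Unit u)
    b′ : Fin n
    b′ = reduce b
    b′a≈1 : ⟦ b′ ⟧ ⊛ ⟦ a ⟧ ≈ + 1 [ n ]
    b′a≈1 = ≈-trans (≈-⊛ʳ ⟦ a ⟧ (⟦reduce⟧ b)) (proj₂ (U⇒Unit u))

  module _ (a : Fin n) (Ω : Subset n) where
    act? : ∀ x → Dec (mul ⟦ a ⟧ x ∈ Ω)
    act? x = mul ⟦ a ⟧ x ∈? Ω

    -- The preimage of Ω under multiplication by a, that is a⁻¹ Ω, so that membership is tested by
    -- multiplying. As units commute, this still satisfies the law of a left action.
    act : Subset n
    act = ⟪ act? ⟫

  act-one : ∀ Ω → act one Ω ≡ Ω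
  act-one Ω = Subset.⊆-antisym (λ {x} h → subst (_∈ Ω) (one-∙ x) (∈⟪⟫⁻ (act? one Ω) h))
    (λ {x} h → ∈⟪⟫⁺ (act? one Ω) (subst (_∈ Ω) (sym (one-∙ x)) h))

  act-∙ : ∀ a b Ω → act (a ∙ b) Ω ≡ act a (act b Ω)
  act-∙ a b Ω = Subset.⊆-antisym
      (λ {x} h → ∈⟪⟫⁺ (act? a (act b Ω)) (∈⟪⟫⁺ (act? b Ω) (subst (_∈ Ω) (swap x) (∈⟪⟫⁻ (act? (a ∙ b) Ω) h))))
      (λ {x} h → ∈⟪⟫⁺ (act? (a ∙ b) Ω) (subst (_∈ Ω) (sym (swap x)) (∈⟪⟫⁻ (act? b Ω) (∈⟪⟫⁻ (act? a (act b Ω)) h))))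
    where
    swap : ∀ x → (a ∙ b) ∙ x ≡ b ∙ (a ∙ x)
    swap x = trans (cong (_∙ x) (∙-comm a b)) (∙-assoc b a x)

  mul-neg : ∀ a x → mul a (-Z x) ≡ -Z (mul a x)
  mul-neg a x = ⟦⟧-injective (begin≈
    ⟦ mul a (-Z x) ⟧     ≈⟨ ⟦mul⟧ a (-Z x) ⟩
    a ⊛ ⟦ -Z x ⟧         ≈⟨ ≈-⊛ˡ a (⟦-Z⟧ x) ⟩
    a ⊛ ⊝ ⟦ x ⟧          ≡≈⟨ sym (ℤ.neg-distribʳ-* a ⟦ x ⟧) ⟩
    ⊝ (a ⊛ ⟦ x ⟧)        ≈⟨ ≈-⊝ (≈-sym (⟦mul⟧ a x)) ⟩
    ⊝ ⟦ mul a x ⟧        ≈⟨ ≈-sym (⟦-Z⟧ (mul a x)) ⟩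
    ⟦ -Z (mul a x) ⟧ ∎≈)
    where open ≈-Reasoning n

  ⊛-zeroʳ-≈ : ∀ {q} a {x} → x ≈ + 0 [ q ] → a ⊛ x ≈ + 0 [ q ]
  ⊛-zeroʳ-≈ a e = ≈-trans (≈-⊛ˡ a e) (≈-reflexive (ℤ.*-zeroʳ a))

  module _ {a : Fin n} (u : U a) where
    private
      b = proj₁ (U⇒Unit u)
      ba = proj₂ (U⇒Unit u)
      ab : ⟦ a ⟧ ⊛ b ≈ + 1 [ n ]
      ab = ≈-trans (≈-reflexive (ℤ.*-comm ⟦ a ⟧ b)) ba
      b∘a : ∀ x → mul b (mul ⟦ a ⟧ x) ≡ x
      b∘a = mul-inverse {a = ⟦ a ⟧} {b} ba
      a∘b : ∀ y → mul ⟦ a ⟧ (mul b y) ≡ y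
      a∘b = mul-inverse {a = b} {⟦ a ⟧} ab

    card-act : ∀ Ω → ∣ act a Ω ∣ ≡ ∣ Ω ∣
    card-act Ω = ℤ.+-injective (trans (card-⟪⟫ (act? a Ω)) (trans
      (count-bij (finFinite n) (finFinite n) (act? a Ω) (_∈? Ω) (mul ⟦ a ⟧) (mul b)
        (λ x h → h , b∘a x)
        (λ y h → subst (_∈ Ω) (sym (a∘b y)) h , a∘b y))
      (sym (card Ω))))

    good-act : ∀ {Ω} → Good Ω → Good (act a Ω)
    good-act {Ω} ((neg , nz , ¬v) , e) =
      ((λ x h → ∈⟪⟫⁺ (act? a Ω) (subst (_∈ Ω) (sym (mul-neg ⟦ a ⟧ x)) (neg _ (∈⟪⟫⁻ (act? a Ω) h)))) ,
       (λ x h z → nz _ (∈⟪⟫⁻ (act? a Ω) h) (≈-trans (⟦mul⟧ ⟦ a ⟧ x) (⊛-zeroʳ-≈ ⟦ a ⟧ z))) ,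
       (λ i v → ¬v i λ y h → ≈-trans (≈-reflexive (cong ⟦_⟧ (sym (a∘b y))))
          (≈-trans (≈-at i (⟦mul⟧ ⟦ a ⟧ (mul b y)))
            (⊛-zeroʳ-≈ ⟦ a ⟧ (v (mul b y) (∈⟪⟫⁺ (act? a Ω) (subst (_∈ Ω) (sym (a∘b y)) h))))))) ,
      trans (card-act Ω) e

  open Burnside (subsetFinite n) (finFinite n) U? _∙_ one U-one U-∙ ∙-assoc (λ a → trans (∙-comm a one) (one-∙ a)) inverse
    act act-one act-∙ good? (λ {_} {Ω} u → good-act u {Ω}) public

  act⇒preimage : ∀ {a Ω Ω′} → Ω ≡ act a Ω′ → Preimage ⟦ a ⟧ Ω Ω′
  act⇒preimage {a} {Ω} {Ω′} refl x = ∈⟪⟫⁻ (act? a Ω′) , ∈⟪⟫⁺ (act? a Ω′)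

  preimage⇒act : ∀ {a Ω Ω′} → Preimage ⟦ a ⟧ Ω Ω′ → Ω ≡ act a Ω′
  preimage⇒act {a} {Ω} {Ω′} h = Subset.⊆-antisym (λ {x} q → ∈⟪⟫⁺ (act? a Ω′) (proj₁ (h x) q)) (λ {x} q → proj₂ (h x) (∈⟪⟫⁻ (act? a Ω′) q))

  ∼⇒WeakEquiv : ∀ {Ω Ω′} → Ω ∼ Ω′ → WeakEquiv Ω Ω′
  ∼⇒WeakEquiv (a , u , e) = preimage⇒WeakEquiv (U⇒Unit u) (act⇒preimage {a} e)

  WeakEquiv⇒∼ : ∀ {Ω Ω′} → WeakEquiv Ω Ω′ → Ω ∼ Ω′
  WeakEquiv⇒∼ w = let a , u , h = WeakEquiv⇒preimage w in a , u , preimage⇒act {a} h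

  numWeakClasses : NumWeakClasses {m} k (length representatives)
  numWeakClasses = lookupˡ representatives ,
    (λ j → good⇒connection (All.lookup representatives-good (Mem.∈-lookup j))) ,
    (λ i j w → lookup-inequivalent representatives-inequivalent i j (WeakEquiv⇒∼ w)) ,
    (λ Ω c e → let h = representative Ω (connection⇒good c e) in Any.index h , ∼⇒WeakEquiv (Any.lookup-index h))

  U⇒nonzero : ∀ {a} → U a → ∀ i → ¬ ⟦ a ⟧ ≈ + 0 [ p i ]
  U⇒nonzero u i z = Prime.¬prime[1] (subst Prime (u (0≈⇒∣ z , subst (p i ∣_) (sym n≡) (∣-prodFin p i))) (pr i))

  nonzero⇒U : ∀ {a} → (∀ i → ¬ ⟦ a ⟧ ≈ + 0 [ p i ]) → U a
  nonzero⇒U {a} h = subst (Coprime (toℕ a)) (sym n≡) (coprime-prodFin {p = p} λ i {q} (q∣a , q∣p) →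
    [ id , (λ { refl → contradiction (∣⇒0≈ q∣a) (h i) }) ]′ (Prime.prime⇒irreducible (pr i) q∣p))

  fixedBy : Fin n → ℤ
  fixedBy a = ∑[ Ω ← allSubsets n ] 𝟙 (fixes? a Ω)

  module _ (alpha : Vector ℕ ℓ → Subset ℓ → ℕ)
    (isAlpha : ∀ d → (∀ i → d i ∣ (p i ∸ 1)) → ∀ T → 1 ≤ ∣ T ∣ → IsAlpha p d T (alpha d T)) where

    -- Being symmetric and fixed by a is stability under the two generators -1 and a, which is the
    -- same as being a union of classes of `_~_`.
    fixedBy-inner : ∀ a → U a → ∀ d → (∀ i → HasIndex (p i) ⟦ a ⟧ (d i)) → fixedBy a ≡ coeff k (inner p alpha d)
    fixedBy-inner a u d hd = trans
        (∑-cong (allSubsets n) λ Ω → 𝟙-cong (fixes? a Ω) ((closed? Ω ×-dec full? Ω) ×-dec (∣ Ω ∣ ℕ.≟ k))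
          (λ (_ , ((neg , f) , e) , fix) → (closed neg fix , f) , e)
          (λ ((c , f) , e) → u , ((closed⇒neg c , f) , e) , closed⇒fixed c))
        (sym (coeff-inner k))
      where
      open FixedSets ⟦ a ⟧ d hd alpha (isAlpha d (λ i → proj₁ (hd i)))
      ~-neg : ∀ x → x ~ (-Z x)
      ~-neg x = true , 0 , ≈-trans (⟦-Z⟧ x) (≈-reflexive (lemma ⟦ x ⟧))
        where lemma : ∀ x → ⊝ x ≡ ⊝ + 1 ⊛ (+ 1 ⊛ x)
              lemma = solve-∀
      ~-mul : ∀ x → x ~ mul ⟦ a ⟧ x
      ~-mul x = false , 1 , ≈-trans (⟦mul⟧ ⟦ a ⟧ x) (≈-reflexive (lemma ⟦ a ⟧ ⟦ x ⟧))
        where lemma : ∀ a x → a ⊛ x ≡ + 1 ⊛ (a ⊛ + 1 ⊛ x)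
              lemma = solve-∀
      closed⇒neg : ∀ {Ω} → Closed Ω → NegClosed Ω
      closed⇒neg c x h = c x _ (~-neg x) h
      closed⇒fixed : ∀ {Ω} → Closed Ω → act a Ω ≡ Ω
      closed⇒fixed {Ω} c = Subset.⊆-antisym (λ {x} h → c _ x (~-sym (~-mul x)) (∈⟪⟫⁻ (act? a Ω) h))
        (λ {x} h → ∈⟪⟫⁺ (act? a Ω) (c x _ (~-mul x) h))
      closed : ∀ {Ω} → NegClosed Ω → act a Ω ≡ Ω → Closed Ω
      -- From x, j multiplications by a and at most one change of sign lead to y without leaving Ω.
      closed {Ω} neg fix x y (s , j , e) h = subst (_∈ Ω) (sym (⟦⟧-injective (≈-trans e (≈-sym (≈-trans (⟦mul⟧ (sgn s) _)
          (≈-⊛ˡ (sgn s) (⟦reduce⟧ (⟦ a ⟧ ↑ j ⊛ ⟦ x ⟧)))))))) (signed s (powers j))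
        where
        step : ∀ {z} → z ∈ Ω → mul ⟦ a ⟧ z ∈ Ω
        step {z} q = ∈⟪⟫⁻ (act? a Ω) (subst (z ∈_) (sym fix) q)
        powers : ∀ j → mul (⟦ a ⟧ ↑ j) x ∈ Ω
        powers zero    = subst (_∈ Ω) (sym (mul-1 x)) h
        powers (suc j) = subst (_∈ Ω) (mul-mul ⟦ a ⟧ (⟦ a ⟧ ↑ j) x) (step (powers j))
        signed : ∀ s {z} → z ∈ Ω → mul (sgn s) z ∈ Ω
        signed false {z} q = subst (_∈ Ω) (sym (mul-1 z)) q
        signed true  {z} q = subst (_∈ Ω) (⟦⟧-injective (≈-trans (⟦-Z⟧ z) (≈-trans (≈-reflexive (sym (ℤ.-1*i≡-i ⟦ z ⟧))) (≈-sym (⟦mul⟧ (⊝ + 1) z))))) (neg z q)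

    Ls : Fin ℓ → List ℕ
    Ls i = divisors (p i ∸ 1)

    indexed? : ∀ (d : Vector ℕ ℓ) (a : Fin n) i → Dec (d i ≡ index (pr i) ⟦ a ⟧)
    indexed? d a i = d i ℕ.≟ index (pr i) ⟦ a ⟧

    -- alpha takes tuples as functions, and pointwise equal tuples need not be equal; so the tuple of indices of a
    -- is never formed, but selected from the list of all tuples by an indicator.
    indexed : Vector ℕ ℓ → Fin n → ℤ
    indexed d a = ∏ (λ i → 𝟙 (indexed? d a i))

    ∑-indexed-tuples : ∀ a → U a → (∑[ d ← tuples ℓ Ls ] indexed d a) ≡ + 1
    ∑-indexed-tuples a u = trans (∑-tuples ℓ Ls (λ i x → 𝟙 (x ℕ.≟ index (pr i) ⟦ a ⟧)))
      (∏-1 _ λ i → divisors-once (p i ∸ 1) {{p-1≢0 (pr i)}} _ (proj₁ (index-unit (pr i) (U⇒nonzero u i))))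

    ∑-indexed-units : ∀ d → d ∈ˡ tuples ℓ Ls → (∑[ a ← allFin n ] indexed d a) ≡ + weight p alpha d
    ∑-indexed-units d h = trans (∑-crt-n (λ i z → 𝟙 (d i ℕ.≟ index (pr i) z)) (λ i e → cong (λ x → 𝟙 (d i ℕ.≟ x)) (index-cong (pr i) e)))
      (trans (∏-cong λ i → count-index (pr i) (d i) (∈-tuples⁻ ℓ Ls h i)) (sym (+-prodFin (λ i → φ ((p i ∸ 1) ÷ d i)))))

    -- Where the indicator is 1, the indices of a divide p_i - 1 and so are not 0. Hence a is a
    -- unit, and d is a valid tuple for it.
    indexed-fixedBy : ∀ d → d ∈ˡ tuples ℓ Ls → ∀ a → indexed d a ⊛ fixedBy a ≡ indexed d a ⊛ coeff k (inner p alpha d)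
    indexed-fixedBy d h a = subst (λ w → w ⊛ fixedBy a ≡ w ⊛ coeff k (inner p alpha d))
        (𝟙-∏ (indexed? d a) (Fin.all? (indexed? d a)) id id)
        (𝟙-guard (Fin.all? (indexed? d a)) λ e → fixedBy-inner a (nonzero⇒U λ i → nonzero e i) d
          λ i → subst (HasIndex (p i) ⟦ a ⟧) (sym (e i)) (index-unit (pr i) (nonzero e i)))
      where
      nonzero : (∀ i → d i ≡ index (pr i) ⟦ a ⟧) → ∀ i → ¬ ⟦ a ⟧ ≈ + 0 [ p i ]
      nonzero e i = index-∣p-1 (pr i) (subst (_∣ p i ∸ 1) (e i) (∈-divisors⁻ (∈-tuples⁻ ℓ Ls h i)))

    coeff-RHS : coeff k (RHS p alpha) ≡ (∑[ a ← allFin n ] fixedBy a)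
    coeff-RHS = sym (begin
      (∑[ a ← allFin n ] fixedBy a)
        ≡⟨ ∑-cong (allFin n) (λ a → insert a (U? a)) ⟩
      (∑[ a ← allFin n ] ∑[ d ← tuples ℓ Ls ] (indexed d a ⊛ fixedBy a))
        ≡⟨ ∑-swap (allFin n) (tuples ℓ Ls) _ ⟩
      (∑[ d ← tuples ℓ Ls ] ∑[ a ← allFin n ] (indexed d a ⊛ fixedBy a))
        ≡⟨ ∑-cong∈ (tuples ℓ Ls) (λ d h → trans (∑-cong (allFin n) (indexed-fixedBy d h)) (trans (∑-⊛ʳ (allFin n) (coeff k (inner p alpha d)) (indexed d))
             (trans (cong (_⊛ coeff k (inner p alpha d)) (∑-indexed-units d h)) (sym (coeff-scaleP (+ weight p alpha d) (inner p alpha d) k))))) ⟩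
      (∑[ d ← tuples ℓ Ls ] coeff k (scaleP (+ weight p alpha d) (inner p alpha d)))
        ≡⟨ coeff-sumP (tuples ℓ Ls) _ k ⟨
      coeff k (RHS p alpha) ∎)
      where
      open ≡-Reasoning
      -- For a unit exactly one tuple has indicator 1; for a non-unit both sides are 0, because
      -- `Fixes` includes `U`.
      insert : ∀ a → Dec (U a) → fixedBy a ≡ (∑[ d ← tuples ℓ Ls ] (indexed d a ⊛ fixedBy a))
      insert a (yes u) = trans (sym (ℤ.*-identityˡ (fixedBy a))) (trans (cong (_⊛ fixedBy a) (sym (∑-indexed-tuples a u)))
        (sym (∑-⊛ʳ (tuples ℓ Ls) (fixedBy a) _)))
      insert a (no ¬u) = trans zero-fixed (sym (∑-0 (tuples ℓ Ls) λ d → trans (cong (indexed d a ⊛_) zero-fixed) (ℤ.*-zeroʳ (indexed d a))))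
        where zero-fixed : fixedBy a ≡ + 0
              zero-fixed = ∑-0 (allSubsets n) λ Ω → 𝟙-no (fixes? a Ω) (¬u ∘ proj₁)

    φ*classes : + (φ n * length representatives) ≡ coeff k (RHS p alpha)
    φ*classes = trans (ℤ.pos-* (φ n) _) (trans (cong (_⊛ + length representatives) (φ-count n)) (trans (sym orbit-count) (sym coeff-RHS)))

    -- No set is counted: the empty set vanishes at the first prime, which exists by 1 ≤ ℓ, and a
    -- set with at least n elements is all of ℤ_n and contains 0.
    coeff-RHS-0 : 1 ≤ ℓ → k ≡ 0 ⊎ n ≤ k → coeff k (RHS p alpha) ≡ + 0
    coeff-RHS-0 (s≤s _) h = trans coeff-RHS (∑-0 (allFin n) λ a → ∑-0 (allSubsets n) λ Ω → 𝟙-no (fixes? a Ω) λ (_ , g , _) → none h g)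
      where
      none : ∀ {Ω} → k ≡ 0 ⊎ n ≤ k → ¬ Good Ω
      none {Ω} (inj₁ refl) ((_ , _ , ¬v) , e) = ¬v Fin.zero λ x q → contradiction
        (ℕ.≤-trans (subst (_≤ ∣ Ω ∣) (Subset.∣⁅x⁆∣≡1 x) (Subset.p⊆q⇒∣p∣≤∣q∣ λ r → subst (_∈ Ω) (sym (Subset.x∈⁅y⁆⇒x≡y x r)) q)) (ℕ.≤-reflexive e)) λ ()
      none {Ω} (inj₂ le) ((_ , nz , _) , e) = nz 0Z (subst (0Z ∈_) (sym (Subset.∣p∣≡n⇒p≡⊤ (ℕ.≤-antisym (Subset.∣p∣≤n Ω) (subst (n ≤_) (sym e) le)))) Subset.∈⊤) ≈-refl

theorem4p6 : (ℓ : ℕ) → 1 ≤ ℓ → (p : Fin ℓ → ℕ) →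
    (∀ i → Prime (p i)) → (∀ i → ¬ (2 ∣ p i)) →
    (∀ i j → i Fin.< j → p i < p j) →
    (m : ℕ) → suc m ≡ prodFin p →
    (alpha : Vector ℕ ℓ → Subset ℓ → ℕ) →
    (∀ d → (∀ i → d i ∣ (p i ∸ 1)) → ∀ T → 1 ≤ ∣ T ∣ → IsAlpha p d T (alpha d T)) →
    (∀ k → 1 ≤ k → k ≤ m →
      ∃ λ c → NumWeakClasses {m} k c × + (φ (suc m) * c) ≡ coeff k (RHS p alpha))
    × (∀ k → (k ≡ 0 ⊎ suc m ≤ k) → coeff k (RHS p alpha) ≡ + 0)
theorem4p6 ℓ 1≤ℓ p pr odd inc m n≡ alpha isAlpha =
  (λ k _ _ → let open Counting p pr odd coprime m n≡ k in length representatives , numWeakClasses , φ*classes alpha isAlpha) ,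
  (λ k h → let open Counting p pr odd coprime m n≡ k in coeff-RHS-0 alpha isAlpha 1≤ℓ h)
  where
  coprime : PairwiseCoprime p
  coprime = increasing-primes⇒coprime pr inc
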